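{- Let $d\ge1$ and $q\ge3$. Then $\operatorname{edim}(H(d,q))=q-1$; moreover a faithful unit-distance realization of $H(d,q)$ in $\mathbb{R}^{q-1}$ is given by the Minkowski sum of $d$ regular unit $(q-1)$-simplices in generic position. In particular, among $q\ge 3$, $q=3$ is exactly the case in which the realization stays in the plane. For $q=2$ the situation is exceptional: $H(d,2)=Q_d$ is the hypercube, and $\operatorname{edim}(H(d,2))=2$ for every $d\ge2$.
   Context: The Hamming graph $H(d,q)=K_q^{\square d}$ has vertex set $\{0,\dots,q-1\}^d$, two words being adjacent iff they differ in exactly one coordinate. A faithful unit-distance realization of a graph $G=(V,E)$ in $\mathbb{R}^k$ is an injective map $p:V\to\mathbb{R}^k$ with $\|p(u)-p(v)\|=1$ if and only if $uv\in E$. The Euclidean dimension $\operatorname{edim}(G)$ is the least $k$ for which $G$ has a faithful unit-distance realization in $\mathbb{R}^k$. Minkowski sum of simplices: let $T_1,\dots,T_d\subset\mathbb{R}^{q-1}$ be regular simplices with all edges of length $1$, the vertices of $T_i$ being labelled $T_i[0],\dots,T_i[q-1]$; vertex $a=(a_1,\dots,a_d)$ is placed at $P(a)=\sum_{i=1}^d T_i[a_i]$. "In generic position" means that the $T_i$ are obtained from a fixed labelled regular unit simplex by rotations $\rho_i\in SO(q-1)$, with $(\rho_1,\dots,\rho_d)$ outside some proper real-analytic (measure-zero) subset of $SO(q-1)^d$. -}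

module Defs where

open import Algebra.Bundles using (CommutativeRing)
open import Data.Bool.Base using (Bool)
open import Data.Fin.Base using (Fin; zero; suc; toℕ)
open import Data.Fin.Properties using (_≟_)
open import Data.Nat.Base as ℕ using (ℕ; zero; suc; _∸_)
open import Data.Nat.Combinatorics using (_C_)
open import Data.Product using (Σ-syntax; ∃; ∃-syntax; ∃!; _×_; _,_)
open import Data.Vec.Base using (Vec; lookup; []; _∷_)
open import Data.Vec.Functional using (Vector; head; tail; concat; removeAt; zipWith)
open import Function.Base using (_∘_)
open import Function.Bundles using (_⇔_; _⤖_; Bijection)
open import Function.Definitions using (Injective)
open import Level using (0ℓ)
open import Relation.Binary.Core using (Rel)
open import Relation.Binary.Definitions using (Symmetric; Irreflexive; tri<; tri≈; tri>)
open import Relation.Binary.PropositionalEquality.Core using (_≡_; _≢_; ≢-sym; refl)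
open import Relation.Binary.Structures using (IsStrictTotalOrder)
open import Relation.Nullary.Decidable.Core using (does)
open import Relation.Nullary.Negation.Core using (¬_)
open import Relation.Unary using (Pred; _∈_; Satisfiable)
import Algebra.Properties.Semiring.Exp as Exp
import Algebra.Properties.Semiring.Sum as Sum
import Data.Vec.Functional.Relation.Binary.Equality.Setoid as VectorEquality
import Relation.Binary.Construct.StrictToNonStrict as NonStrict

-- The classical real numbers: a Dedekind-complete ordered field is unique up
-- to unique isomorphism, and any of them serves as ℝ.
--
-- Completeness is meant classically. As every y < s is exceeded by an actual
-- member of S, the supremum of { 0 } ∪ { 1 ∣ P } decides P, so excluded middle
-- for Set follows from `supremum`; the theory over ℝ is classical analysis.

record CompleteOrderedField : Set₁ where
  infix 4 _<_
  field
    commutativeRing : CommutativeRing 0ℓ 0ℓ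

  open CommutativeRing commutativeRing public
    renaming (refl to ≈-refl; sym to ≈-sym; trans to ≈-trans)

  field
    0≉1                : ¬ (0# ≈ 1#)
    inverse            : ∀ x → ¬ (x ≈ 0#) → ∃[ y ] x * y ≈ 1#
    _<_                : Rel Carrier 0ℓ
    isStrictTotalOrder : IsStrictTotalOrder _≈_ _<_
    +-monoˡ-<          : ∀ z {x y} → x < y → z + x < z + y
    *-positive         : ∀ {x y} → 0# < x → 0# < y → 0# < x * y

  open IsStrictTotalOrder isStrictTotalOrder public using (compare)
  open NonStrict _≈_ _<_ public using (_≤_)

  UpperBound : Pred Carrier 0ℓ → Pred Carrier 0ℓ
  UpperBound S b = ∀ x → x ∈ S → x ≤ b

  field
    supremum : (S : Pred Carrier 0ℓ) → Satisfiable S → Satisfiable (UpperBound S) →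
               ∃[ s ] UpperBound S s × (∀ y → y < s → ∃[ x ] x ∈ S × y < x)

record Graph : Set₁ where
  infix 4 _~_
  field
    Vertex : Set
    _~_    : Rel Vertex 0ℓ
    sym    : Symmetric _~_
    irrefl : Irreflexive _≡_ _~_

_≅_ : Graph → Graph → Set
G ≅ H = Σ[ f ∈ (G.Vertex ⤖ H.Vertex) ]
          (∀ u v → (u G.~ v) ⇔ (Bijection.to f u H.~ Bijection.to f v))
  where
  module G = Graph G
  module H = Graph H

words : (d : ℕ) → Set → Graph
words d A = record
  { Vertex = Vec A d
  ; _~_    = λ u v → ∃! _≡_ λ i → lookup u i ≢ lookup v i
  ; sym    = λ { (i , u≢v , unique) → i , ≢-sym u≢v , λ v≢u → unique (≢-sym v≢u) }
  ; irrefl = λ { refl (i , u≢u , _) → u≢u refl }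
  }

hamming : (d q : ℕ) → Graph
hamming d q = words d (Fin q)

hypercube : ℕ → Graph
hypercube d = words d Bool

module Euclidean (ℝ : CompleteOrderedField) where

  open CompleteOrderedField ℝ hiding (zero)
  open Exp semiring using (_^_)
  open Sum semiring using (sum)
  open VectorEquality setoid using (_≋_)

  Point : ℕ → Set
  Point = Vector Carrier

  infixl 6 _⊖_

  _⊖_ : ∀ {k} → Point k → Point k → Point k
  _⊖_ = zipWith _-_

  ⟨_,_⟩ : ∀ {k} → Point k → Point k → Carrier
  ⟨ x , y ⟩ = sum (zipWith _*_ x y)

  -- ‖ x ‖≈ r says that r is the nonnegative square root of ⟨ x , x ⟩.
  ‖_‖≈_ : ∀ {k} → Point k → Carrier → Set
  ‖ x ‖≈ r = 0# ≤ r × r * r ≈ ⟨ x , x ⟩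

  Ball : ∀ {k} → Point k → Carrier → Pred (Point k) 0ℓ
  Ball x r y = ∃[ s ] ‖ y ⊖ x ‖≈ s × s < r

  record IsFaithful (G : Graph) {k : ℕ} (p : Graph.Vertex G → Point k) : Set where
    open Graph G
    field
      injective    : Injective _≡_ _≋_ p
      unitDistance : ∀ u v → (‖ p u ⊖ p v ‖≈ 1#) ⇔ (u ~ v)

  Realizable : Graph → ℕ → Set
  Realizable G k = ∃ (IsFaithful G {k})

  edim_≡_ : Graph → ℕ → Set
  edim G ≡ k = Realizable G k × (∀ j → Realizable G j → k ℕ.≤ j)

  Matrix : ℕ → Set
  Matrix n = Vector (Point n) n

  identity : ∀ {n} → Matrix n
  identity i j with does (i ≟ j)
  ... | Bool.true  = 1#
  ... | Bool.false = 0#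

  det : ∀ {n} → Matrix n → Carrier
  det {zero}  A = 1#
  det {suc n} A =
    sum λ j → (- 1#) ^ toℕ j * (A zero j * det λ i → removeAt (A (suc i)) j)

  SO : ∀ n → Pred (Matrix n) 0ℓ
  SO n A = (∀ i j → ⟨ (λ k → A k i) , (λ k → A k j) ⟩ ≈ identity i j) × det A ≈ 1#

  SO^ : ∀ d n → Pred (Vector (Matrix n) d) 0ℓ
  SO^ d n ρ = ∀ i → ρ i ∈ SO n

  infixr 7 _·_

  _·_ : ∀ {n} → Matrix n → Point n → Point n
  (A · x) i = ⟨ A i , x ⟩

  IsRegularUnitSimplex : ∀ {q} → Pred (Vector (Point (q ∸ 1)) q) 0ℓ
  IsRegularUnitSimplex T = ∀ i j → i ≢ j → ‖ T i ⊖ T j ‖≈ 1#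

  minkowski : ∀ {d n q} → Vector (Matrix n) d → Vector (Point n) q → Vec (Fin q) d → Point n
  minkowski ρ T a k = sum λ i → (ρ i · T (lookup a i)) k

  ∣_∣ : Carrier → Carrier
  ∣ x ∣ with compare 0# x
  ... | tri< _ _ _ = x
  ... | tri≈ _ _ _ = x
  ... | tri> _ _ _ = - x

  Limit : (ℕ → Carrier) → Carrier → Set
  Limit s l = ∀ ε → 0# < ε → ∃[ N ] ∀ n → N ℕ.≤ n → ∣ s n - l ∣ < ε

  -- Multi-indices are inductive vectors, so that pointwise equal ones are equal.
  monomial : ∀ {N} → Vec ℕ N → Point N → Carrier
  monomial []      h = 1#
  monomial (a ∷ α) h = head h ^ a * monomial α (tail h)

  -- The sum of t α over all multi-indices α with every entry < K.
  boxSum : ∀ {N} → ℕ → (Vec ℕ N → Carrier) → Carrier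
  boxSum {zero}  K t = t []
  boxSum {suc N} K t = sum {K} λ a → boxSum K λ α → t (toℕ a ∷ α)

  -- Absolutely convergent multiple series; bounded box sums of absolute values
  -- make the sum independent of the order of summation.
  HasSum : ∀ {N} → (Vec ℕ N → Carrier) → Carrier → Set
  HasSum t l = (∃[ b ] ∀ K → boxSum K (∣_∣ ∘ t) ≤ b) × Limit (λ K → boxSum K t) l

  AnalyticAt : ∀ {N} → (Point N → Carrier) → Pred (Point N) 0ℓ
  AnalyticAt {N} f x =
    ∃[ r ] 0# < r × Σ[ c ∈ (Vec ℕ N → Carrier) ]
      (∀ y → y ∈ Ball x r → HasSum (λ α → c α * monomial α (y ⊖ x)) (f y))

  module _ {d n : ℕ} where

    coordinates : Vector (Matrix n) d → Point (d ℕ.* (n ℕ.* n))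
    coordinates ρ = concat λ i → concat (ρ i)

    -- Near each point of SO(n)ᵈ, the set is the common zero locus of finitely
    -- many analytic functions. Functions on an open subset of the ambient matrix
    -- space suffice, SO(n)ᵈ being an embedded analytic submanifold of it.
    IsAnalyticSubset : Pred (Pred (Vector (Matrix n) d) 0ℓ) 0ℓ
    IsAnalyticSubset E =
      ∀ ρ → ρ ∈ SO^ d n → ∃[ r ] 0# < r ×
        ∃[ m ] Σ[ f ∈ Vector (Point (d ℕ.* (n ℕ.* n)) → Carrier) m ]
          (∀ j y → y ∈ Ball (coordinates ρ) r → AnalyticAt (f j) y) ×
          (∀ σ → σ ∈ SO^ d n → coordinates σ ∈ Ball (coordinates ρ) r →
             (σ ∈ E) ⇔ (∀ j → f j (coordinates σ) ≈ 0#))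

    IsProper : Pred (Pred (Vector (Matrix n) d) 0ℓ) 0ℓ
    IsProper E = ∃[ ρ ] ρ ∈ SO^ d n × ¬ (ρ ∈ E)

    -- E ∩ SO(n)ᵈ has countable covers by balls of arbitrarily small total volume,
    -- volume being measured in dimension dim SO(n)ᵈ = d · n(n-1)/2. These are the
    -- null sets of the Riemannian volume, equivalently of Haar measure.
    IsNull : Pred (Pred (Vector (Matrix n) d) 0ℓ) 0ℓ
    IsNull E =
      ∀ ε → 0# < ε →
        Σ[ c ∈ (ℕ → Point (d ℕ.* (n ℕ.* n))) ] Σ[ r ∈ (ℕ → Carrier) ]
          (∀ k → 0# < r k) ×
          (∀ K → sum {K} (λ k → r (toℕ k) ^ (d ℕ.* (n C 2))) ≤ ε) ×
          (∀ ρ → ρ ∈ SO^ d n → ρ ∈ E → ∃[ k ] coordinates ρ ∈ Ball (c k) (r k))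

    Generically : Pred (Pred (Vector (Matrix n) d) 0ℓ) _
    Generically P =
      ∃[ E ] IsAnalyticSubset E × IsProper E × IsNull E ×
        (∀ ρ → ρ ∈ SO^ d n → ¬ (ρ ∈ E) → ρ ∈ P)

{-# OPTIONS --safe #-}
module Submission where

-- The complement of the good rotations is the zero set of a polynomial in the
-- matrix entries, namely the product of |P(a) - P(b)|² - κ over κ ∈ {0, 1} and the
-- pairs of words a, b at Hamming distance at least 2; adjacent words are at distance
-- 1 for any rotations. Writing an orthogonal matrix, up to sign, as a reflection
-- along (1, t) times 1 ⊕ ρ′ charts O(n) rationally by n(n-1)/2 parameters in [-1, 1].
-- In such a chart the polynomial becomes a rational function which is not
-- identically zero, since each factor can be made nonzero by moving two of the
-- rotations. A nonzero polynomial vanishes on few cells of a fine grid, so the zero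
-- set is null; on the charts' points that move only two coordinates at a time the
-- determinant is explicit, so the zero set is proper. The lower bound on the
-- dimension is the trace of the projection onto the span of q-1 simplex edges.

open import Defs
open import Algebra.Solver.Ring.AlmostCommutativeRing using (AlmostCommutativeRing; _-Raw-AlmostCommutative⟶_; fromCommutativeRing)
open import Data.Bool.Base using (Bool; false; if_then_else_; not; true)
open import Data.Empty using (⊥; ⊥-elim)
open import Data.Fin.Base using (Fin; _↑ʳ_; _↑ˡ_; combine; fromℕ; fromℕ<; inject₁; punchIn; remQuot; splitAt; suc; toℕ; zero)
open import Data.Fin.Properties using (2↔Bool; _≟_; remQuot-combine; toℕ-fromℕ; toℕ-inject₁)
open import Data.Integer.Base as ℤ using (+_; -[1+_]; ℤ)
open import Data.List.Base as List using (List; []; _++_; _∷_; allFin; cartesianProduct; concatMap; length; map)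
open import Data.List.Membership.Propositional using () renaming (_∈_ to _∈ₗ_)
open import Data.List.Membership.Propositional.Properties using (∈-++⁺ʳ; ∈-++⁺ˡ; ∈-allFin; ∈-cartesianProduct⁺; ∈-concatMap⁺; ∈-map⁺)
open import Data.List.Properties using (length-++; length-map; length-tabulate)
open import Data.List.Relation.Unary.All as All using (All; []; _∷_)
open import Data.List.Relation.Unary.All.Properties using (All¬⇒¬Any; ¬Any⇒All¬)
open import Data.List.Relation.Unary.Any as Any using (Any; here; there)
open import Data.List.Relation.Unary.Any.Properties using (lookup-index)
open import Data.Maybe.Base using (Maybe; just; nothing)
open import Data.Nat.Base as ℕ using (_∸_; suc; s≤s; zero; z≤n; ℕ)
open import Data.Nat.DivMod using (m%n<n; m/n*n≤m; m≡m%n+[m/n]*n)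
open import Data.Product using (_,_; _×_; proj₁; proj₂; uncurry; Σ; Σ-syntax; ∃!; ∃-syntax)
open import Data.Sum.Base using ([_,_]′; _⊎_; inj₁; inj₂)
open import Data.Unit.Base using (tt; ⊤)
open import Data.Vec.Base as Vec using (Vec; []; _∷_; lookup; replicate; tabulate)
open import Data.Vec.Functional as V using (Vector; head; removeAt; tail)
open import Data.Vec.Functional.Properties using (lookup-++ʳ; lookup-++ˡ)
open import Data.Vec.Properties using (lookup-map; lookup∘tabulate; map-cong; map-id; map-∘; tabulate-cong; tabulate∘lookup)
open import Function.Base using (_∘_; id)
open import Function.Bundles using (Equivalence; Inverse; _⇔_; mk↔ₛ′; mk⇔)
open import Function.Properties.Inverse using (↔⇒⤖)
open import Level using (0ℓ)
open import Relation.Binary.Definitions using (tri<; tri>; tri≈)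
open import Relation.Binary.PropositionalEquality.Core as ≡ using (_≡_; _≢_; cong; cong₂; refl; subst)
open import Relation.Binary.Structures using (IsStrictTotalOrder)
open import Relation.Nullary.Decidable.Core using (Dec; does; no; yes)
open import Relation.Nullary.Negation.Core using (¬_)
open import Relation.Unary using (_∈_)
import Algebra.Properties.Monoid.Mult.TCOptimised as Mult′
import Algebra.Properties.Ring as RingProperties
import Algebra.Properties.Semiring.Exp as Exp
import Algebra.Properties.Semiring.Mult.TCOptimised as SemiringMult′
import Algebra.Properties.Semiring.Sum as Sum
import Algebra.Solver.Ring as RingSolver
import Data.Fin.Properties as Finₚ
import Data.Integer.Properties as ℤₚ
import Data.List.Relation.Unary.All.Properties as Allₚ
import Data.List.Relation.Unary.Any.Properties as Anyₚ
import Data.Nat.Combinatorics as Combinatorics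
import Data.Nat.Properties as ℕₚ
import Data.Nat.Solver as ℕSolver
import Relation.Binary.Reasoning.Setoid as SetoidReasoning

-- Nullity is measured in the dimension of SO(n)ᵈ, which is itself null in the space of matrices; a
-- count of cells there would prove nothing, and this forces the charts. The function is shown to be
-- nonzero in each chart separately, for an arbitrary choice of signs, so that no continuation from
-- one chart to the next is needed and both components of O(n) are treated alike; determinants enter
-- only when a point of SO(n)ᵈ outside the zero set is exhibited. The value κ = 0 guards
-- injectivity, and κ = 1 keeps non-adjacent words off the unit distance. Each factor may be handled
-- at parameters of its own, because finitely many nonzero polynomials have a common point where
-- none of them vanishes. The cell count runs by induction on the number of variables and replaces a
-- point by the corner of its cell, which destroys exact zeros. Hence it is the sets where |p| ≤ η
-- that are counted, and "nonzero" becomes "larger than η" throughout. The genericity argument needs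
-- only n ≥ 2 and unit edges, not a full-dimensional simplex. A unit segment in the plane therefore
-- yields the hypercubes as well.

module HammingDimension (ℝ : CompleteOrderedField) where
  open CompleteOrderedField ℝ hiding (zero; _≤_) renaming (≈-trans to trans; ≈-sym to sym)
  open CompleteOrderedField ℝ using () renaming (_≤_ to infix 4 _≤_)
  open Euclidean ℝ
  open Exp semiring using (_^_; ^-congˡ)
  open Sum semiring
    using (sum; sum-cong-≋; sum-replicate-zero; ∑-distrib-+; ∑-comm; *-distribˡ-sum; *-distribʳ-sum)
  open RingProperties ring using (-‿distribˡ-*; -‿distribʳ-*; -0#≈0#)

  -- Ordered field arithmetic

  private
    module ×′ = Mult′ +-monoid

    embed : ℕ → Carrier
    embed n = n ×′.× 1#

    embed-+ : ∀ m n → embed (m ℕ.+ n) ≈ embed m + embed n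
    embed-+ = ×′.×-homo-+ 1#

    embed-* : ∀ m n → embed (m ℕ.* n) ≈ embed m * embed n
    embed-* = SemiringMult′.×1-homo-* semiring

    embed-suc : ∀ n → embed (suc n) ≈ embed n + 1#
    embed-suc n = trans (reflexive (cong embed (ℕₚ.+-comm 1 n))) (embed-+ n 1)

  -- The solver needs coefficients with decidable equality in order to cancel.
  private
    acr : AlmostCommutativeRing 0ℓ 0ℓ
    acr = fromCommutativeRing commutativeRing

    open import Algebra.Properties.AbelianGroup +-abelianGroup using (⁻¹-∙-comm; ⁻¹-involutive)

    ⟦_⟧ℤ : ℤ → Carrier
    ⟦ + n ⟧ℤ      = embed n
    ⟦ -[1+ n ] ⟧ℤ = - embed (suc n)

    -ℤ : ∀ i → ⟦ ℤ.- i ⟧ℤ ≈ - ⟦ i ⟧ℤ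
    -ℤ (+ zero)  = sym -0#≈0#
    -ℤ (+ suc n) = ≈-refl
    -ℤ -[1+ n ]  = sym (⁻¹-involutive _)

    ⊖ℤ : ∀ m n → ⟦ m ℤ.⊖ n ⟧ℤ ≈ embed m - embed n
    ⊖ℤ m       zero    = trans (sym (+-identityʳ _)) (+-congˡ (sym -0#≈0#))
    ⊖ℤ zero    (suc n) = sym (+-identityˡ _)
    ⊖ℤ (suc m) (suc n) = trans (reflexive (cong ⟦_⟧ℤ (ℤₚ.[1+m]⊖[1+n]≡m⊖n m n)))
      (trans (⊖ℤ m n) (sym (trans (+-cong (embed-suc m) (-‿cong (embed-suc n)))
        (trans (+-congˡ (sym (⁻¹-∙-comm _ _)))
        (trans (+-assoc _ _ _) (+-congˡ
          (trans (+-congˡ (+-comm _ _)) (trans (sym (+-assoc _ _ _))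
          (trans (+-congʳ (-‿inverseʳ _)) (+-identityˡ _))))))))))

    +ℤ : ∀ i j → ⟦ i ℤ.+ j ⟧ℤ ≈ ⟦ i ⟧ℤ + ⟦ j ⟧ℤ
    +ℤ (+ m)    (+ n)    = embed-+ m n
    +ℤ (+ m)    -[1+ n ] = ⊖ℤ m (suc n)
    +ℤ -[1+ m ] (+ n)    = trans (⊖ℤ n (suc m)) (+-comm _ _)
    +ℤ -[1+ m ] -[1+ n ] = trans
      (-‿cong (trans (reflexive (cong embed (cong suc (≡.sym (ℕₚ.+-suc m n))))) (embed-+ (suc m) (suc n))))
      (sym (⁻¹-∙-comm _ _))

    *ℤ⁺ : ∀ m n → ⟦ + m ℤ.* + n ⟧ℤ ≈ embed m * embed n
    *ℤ⁺ m n = trans (reflexive (cong ⟦_⟧ℤ (≡.sym (ℤₚ.pos-* m n)))) (embed-* m n)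

    *ℤ± : ∀ m j → ⟦ + m ℤ.* j ⟧ℤ ≈ embed m * ⟦ j ⟧ℤ
    *ℤ± m (+ n)    = *ℤ⁺ m n
    *ℤ± m -[1+ n ] = trans (reflexive (cong ⟦_⟧ℤ (≡.sym (ℤₚ.neg-distribʳ-* (+ m) (+ suc n)))))
      (trans (-ℤ (+ m ℤ.* + suc n)) (trans (-‿cong (*ℤ⁺ m (suc n))) (-‿distribʳ-* _ _)))

    *ℤ : ∀ i j → ⟦ i ℤ.* j ⟧ℤ ≈ ⟦ i ⟧ℤ * ⟦ j ⟧ℤ
    *ℤ (+ m)    j = *ℤ± m j
    *ℤ -[1+ m ] j = trans (reflexive (cong ⟦_⟧ℤ (≡.sym (ℤₚ.neg-distribˡ-* (+ suc m) j))))
      (trans (-ℤ (+ suc m ℤ.* j)) (trans (-‿cong (*ℤ± (suc m) j)) (-‿distribˡ-* _ _)))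

    ℤ⟶ℝ : ℤ.+-*-rawRing -Raw-AlmostCommutative⟶ acr
    ℤ⟶ℝ = record
      { ⟦_⟧    = ⟦_⟧ℤ
      ; +-homo = +ℤ
      ; *-homo = *ℤ
      ; -‿homo = -ℤ
      ; 0-homo = ≈-refl
      ; 1-homo = ≈-refl
      }

    _ℤ≟_ : ∀ i j → Maybe (⟦ i ⟧ℤ ≈ ⟦ j ⟧ℤ)
    i ℤ≟ j with i ℤₚ.≟ j
    ... | yes i≡j = just (reflexive (cong ⟦_⟧ℤ i≡j))
    ... | no  _   = nothing

  open RingSolver ℤ.+-*-rawRing acr ℤ⟶ℝ _ℤ≟_
    using (solve; _:=_; con; _:+_; _:*_; _:-_; :-_)

  :0 :1 :2 : ∀ {n} → RingSolver.Polynomial ℤ.+-*-rawRing acr ℤ⟶ℝ _ℤ≟_ n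
  :0 = con (+ 0)
  :1 = con (+ 1)
  :2 = con (+ 2)

  2# : Carrier
  2# = 1# + 1#

  abstract
    ι : ℕ → Carrier
    ι = embed

    ι-zero : ι 0 ≈ 0#
    ι-zero = ≈-refl

    ι-+ : ∀ m n → ι (m ℕ.+ n) ≈ ι m + ι n
    ι-+ = embed-+

    ι-* : ∀ m n → ι (m ℕ.* n) ≈ ι m * ι n
    ι-* = embed-*

    ι-suc : ∀ n → ι (suc n) ≈ ι n + 1#
    ι-suc = embed-suc

  open IsStrictTotalOrder isStrictTotalOrder
    using (<-resp-≈) renaming (trans to <-trans; irrefl to <-irrefl; asym to <-asym)
  module ER = SetoidReasoning setoid

  <-≤-trans : ∀ {x y z} → x < y → y ≤ z → x < z
  <-≤-trans x<y (inj₁ y<z) = <-trans x<y y<z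
  <-≤-trans x<y (inj₂ y≈z) = proj₁ <-resp-≈ y≈z x<y

  ≤-<-trans : ∀ {x y z} → x ≤ y → y < z → x < z
  ≤-<-trans (inj₁ x<y) y<z = <-trans x<y y<z
  ≤-<-trans (inj₂ x≈y) y<z = proj₂ <-resp-≈ (sym x≈y) y<z

  ≤-refl : ∀ {x} → x ≤ x
  ≤-refl = inj₂ ≈-refl

  ≤-trans : ∀ {x y z} → x ≤ y → y ≤ z → x ≤ z
  ≤-trans (inj₁ x<y) y≤z = inj₁ (<-≤-trans x<y y≤z)
  ≤-trans (inj₂ x≈y) (inj₁ y<z) = inj₁ (≤-<-trans (inj₂ x≈y) y<z)
  ≤-trans (inj₂ x≈y) (inj₂ y≈z) = inj₂ (trans x≈y y≈z)

  ≤-resp : ∀ {x x′ y y′} → x ≈ x′ → y ≈ y′ → x ≤ y → x′ ≤ y′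
  ≤-resp x≈ y≈ x≤y = ≤-trans (inj₂ (sym x≈)) (≤-trans x≤y (inj₂ y≈))

  <-resp : ∀ {x x′ y y′} → x ≈ x′ → y ≈ y′ → x < y → x′ < y′
  <-resp x≈ y≈ x<y = ≤-<-trans (inj₂ (sym x≈)) (<-≤-trans x<y (inj₂ y≈))

  <⇒≱ : ∀ {x y} → x < y → ¬ (y ≤ x)
  <⇒≱ x<y y≤x = <-irrefl ≈-refl (<-≤-trans x<y y≤x)

  ≤-or-> : ∀ x y → (x ≤ y) ⊎ (y < x)
  ≤-or-> x y with compare x y
  ... | tri< a _ _ = inj₁ (inj₁ a)
  ... | tri≈ _ b _ = inj₁ (inj₂ b)
  ... | tri> _ _ c = inj₂ c

  ≮⇒≥ : ∀ {x y} → ¬ (x < y) → y ≤ x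
  ≮⇒≥ {x} {y} x≮y = [ id , (λ x<y → ⊥-elim (x≮y x<y)) ]′ (≤-or-> y x)

  ≤-antisym : ∀ {x y} → x ≤ y → y ≤ x → x ≈ y
  ≤-antisym (inj₂ x≈y) _   = x≈y
  ≤-antisym (inj₁ x<y) y≤x = ⊥-elim (<⇒≱ x<y y≤x)

  >⇒≉ : ∀ {x y} → y < x → ¬ (x ≈ y)
  >⇒≉ y<x x≈y = <-irrefl (sym x≈y) y<x

  +-monoˡ-≤ : ∀ z {x y} → x ≤ y → z + x ≤ z + y
  +-monoˡ-≤ z (inj₁ x<y) = inj₁ (+-monoˡ-< z x<y)
  +-monoˡ-≤ z (inj₂ x≈y) = inj₂ (+-congˡ x≈y)

  +-monoʳ-≤ : ∀ z {x y} → x ≤ y → x + z ≤ y + z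
  +-monoʳ-≤ z x≤y = ≤-resp (+-comm _ _) (+-comm _ _) (+-monoˡ-≤ z x≤y)

  +-mono-≤ : ∀ {x x′ y y′} → x ≤ x′ → y ≤ y′ → x + y ≤ x′ + y′
  +-mono-≤ {x′ = x′} {y = y} x≤ y≤ = ≤-trans (+-monoʳ-≤ y x≤) (+-monoˡ-≤ x′ y≤)

  +-mono-<-≤ : ∀ {x x′ y y′} → x < x′ → y ≤ y′ → x + y < x′ + y′
  +-mono-<-≤ {x} {x′} {y} x< y≤ =
    <-≤-trans (<-resp (+-comm _ _) (+-comm _ _) (+-monoˡ-< y x<)) (+-monoˡ-≤ x′ y≤)

  x≤y⇒0≤y-x : ∀ {x y} → x ≤ y → 0# ≤ y - x
  x≤y⇒0≤y-x {x} x≤y = ≤-resp (-‿inverseʳ x) ≈-refl (+-monoʳ-≤ (- x) x≤y)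

  0≤y-x⇒x≤y : ∀ {x y} → 0# ≤ y - x → x ≤ y
  0≤y-x⇒x≤y {x} {y} p = ≤-resp (+-identityʳ x) (solve 2 (λ x y → x :+ (y :- x) := y) ≈-refl x y) (+-monoˡ-≤ x p)

  x<y⇒0<y-x : ∀ {x y} → x < y → 0# < y - x
  x<y⇒0<y-x {x} {y} x<y = <-resp (-‿inverseˡ x) (+-comm _ _) (+-monoˡ-< (- x) x<y)

  0<y-x⇒x<y : ∀ {x y} → 0# < y - x → x < y
  0<y-x⇒x<y {x} {y} p = <-resp (+-identityʳ x) (solve 2 (λ x y → x :+ (y :- x) := y) ≈-refl x y) (+-monoˡ-< x p)

  -‿anti-≤ : ∀ {x y} → x ≤ y → - y ≤ - x
  -‿anti-≤ {x} {y} x≤y = 0≤y-x⇒x≤y (≤-resp ≈-refl (solve 2 (λ x y → y :- x := (:- x) :- (:- y)) ≈-refl x y) (x≤y⇒0≤y-x x≤y))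

  *-nonneg : ∀ {x y} → 0# ≤ x → 0# ≤ y → 0# ≤ x * y
  *-nonneg (inj₁ x) (inj₁ y) = inj₁ (*-positive x y)
  *-nonneg {x} {y} (inj₂ 0≈x) _ = inj₂ (sym (trans (*-congʳ (sym 0≈x)) (zeroˡ y)))
  *-nonneg {x} {y} _ (inj₂ 0≈y) = inj₂ (sym (trans (*-congˡ (sym 0≈y)) (zeroʳ x)))

  +-nonneg : ∀ {x y} → 0# ≤ x → 0# ≤ y → 0# ≤ x + y
  +-nonneg p q = ≤-resp (+-identityˡ 0#) ≈-refl (+-mono-≤ p q)

  +-pos-nonneg : ∀ {x y} → 0# < x → 0# ≤ y → 0# < x + y
  +-pos-nonneg p q = <-resp (+-identityˡ 0#) ≈-refl (+-mono-<-≤ p q)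

  *-monoˡ-≤ : ∀ {z x y} → 0# ≤ z → x ≤ y → z * x ≤ z * y
  *-monoˡ-≤ {z} {x} {y} 0≤z x≤y = 0≤y-x⇒x≤y
    (≤-resp ≈-refl (solve 3 (λ x y z → z :* (y :- x) := z :* y :- z :* x) ≈-refl x y z) (*-nonneg 0≤z (x≤y⇒0≤y-x x≤y)))

  *-monoʳ-≤ : ∀ {z x y} → 0# ≤ z → x ≤ y → x * z ≤ y * z
  *-monoʳ-≤ 0≤z x≤y = ≤-resp (*-comm _ _) (*-comm _ _) (*-monoˡ-≤ 0≤z x≤y)

  *-mono-≤ : ∀ {x x′ y y′} → 0# ≤ x′ → 0# ≤ y → x ≤ x′ → y ≤ y′ → x * y ≤ x′ * y′
  *-mono-≤ 0≤x′ 0≤y x≤ y≤ = ≤-trans (*-monoʳ-≤ 0≤y x≤) (*-monoˡ-≤ 0≤x′ y≤)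

  *-monoˡ-< : ∀ {z x y} → 0# < z → x < y → z * x < z * y
  *-monoˡ-< {z} {x} {y} 0<z x<y = 0<y-x⇒x<y
    (<-resp ≈-refl (solve 3 (λ x y z → z :* (y :- x) := z :* y :- z :* x) ≈-refl x y z) (*-positive 0<z (x<y⇒0<y-x x<y)))

  *-cancelˡ-≤ : ∀ {z x y} → 0# < z → z * x ≤ z * y → x ≤ y
  *-cancelˡ-≤ {z} {x} {y} 0<z p with ≤-or-> x y
  ... | inj₁ x≤y = x≤y
  ... | inj₂ y<x = ⊥-elim (<⇒≱ (*-monoˡ-< 0<z y<x) p)

  sq-nonneg : ∀ x → 0# ≤ x * x
  sq-nonneg x with ≤-or-> 0# x
  ... | inj₁ 0≤x = *-nonneg 0≤x 0≤x
  ... | inj₂ x<0 = ≤-resp ≈-refl (solve 1 (λ x → (:0 :- x) :* (:0 :- x) := x :* x) ≈-refl x)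
                     (*-nonneg (x≤y⇒0≤y-x (inj₁ x<0)) (x≤y⇒0≤y-x (inj₁ x<0)))

  0≤1 : 0# ≤ 1#
  0≤1 = ≤-resp ≈-refl (*-identityˡ 1#) (sq-nonneg 1#)

  0<1 : 0# < 1#
  0<1 = [ id , (λ 0≈1 → ⊥-elim (0≉1 0≈1)) ]′ 0≤1

  0<2 : 0# < 2#
  0<2 = +-pos-nonneg 0<1 0≤1

  2≉0 : ¬ (2# ≈ 0#)
  2≉0 = >⇒≉ 0<2

  x<x+1 : ∀ x → x < x + 1#
  x<x+1 x = <-resp (+-identityʳ x) ≈-refl (+-monoˡ-< x 0<1)

  -- Junk: 0 ⁻¹ = 0.
  infix 9 _⁻¹
  _⁻¹ : Carrier → Carrier
  x ⁻¹ with compare x 0#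
  ... | tri< _ x≉0 _ = proj₁ (inverse x x≉0)
  ... | tri≈ _ _ _   = 0#
  ... | tri> _ x≉0 _ = proj₁ (inverse x x≉0)

  ⁻¹-inverse : ∀ {x} → ¬ (x ≈ 0#) → x * x ⁻¹ ≈ 1#
  ⁻¹-inverse {x} x≉0 with compare x 0#
  ... | tri< _ x≉0′ _ = proj₂ (inverse x x≉0′)
  ... | tri≈ _ x≈0 _  = ⊥-elim (x≉0 x≈0)
  ... | tri> _ x≉0′ _ = proj₂ (inverse x x≉0′)

  *-cancel : ∀ {x y z} → ¬ (z ≈ 0#) → z * x ≈ z * y → x ≈ y
  *-cancel {x} {y} {z} z≉0 p = begin
    x                ≈⟨ *-identityˡ x ⟨
    1# * x           ≈⟨ *-congʳ (⁻¹-inverse z≉0) ⟨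
    z * z ⁻¹ * x     ≈⟨ solve 3 (λ z i x → z :* i :* x := i :* (z :* x)) ≈-refl z (z ⁻¹) x ⟩
    z ⁻¹ * (z * x)   ≈⟨ *-congˡ p ⟩
    z ⁻¹ * (z * y)   ≈⟨ solve 3 (λ z i x → z :* i :* x := i :* (z :* x)) ≈-refl z (z ⁻¹) y ⟨
    z * z ⁻¹ * y     ≈⟨ *-congʳ (⁻¹-inverse z≉0) ⟩
    1# * y           ≈⟨ *-identityˡ y ⟩
    y                ∎
    where open ER

  integral : ∀ {x y} → x * y ≈ 0# → ¬ (x ≈ 0#) → y ≈ 0#
  integral p x≉0 = *-cancel x≉0 (trans p (sym (zeroʳ _)))

  *-≉0 : ∀ {x y} → ¬ (x ≈ 0#) → ¬ (y ≈ 0#) → ¬ (x * y ≈ 0#)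
  *-≉0 x≉0 y≉0 p = y≉0 (integral p x≉0)

  ⁻¹-pos : ∀ {x} → 0# < x → 0# < x ⁻¹
  ⁻¹-pos {x} 0<x with ≤-or-> (x ⁻¹) 0#
  ... | inj₂ p = p
  ... | inj₁ p = ⊥-elim (<⇒≱ 0<1 (≤-resp (⁻¹-inverse (>⇒≉ 0<x)) (zeroʳ x) (*-monoˡ-≤ (inj₁ 0<x) p)))

  ½ : Carrier
  ½ = 2# ⁻¹

  0<½ : 0# < ½
  0<½ = ⁻¹-pos 0<2

  ½+½ : ½ + ½ ≈ 1#
  ½+½ = trans (solve 1 (λ h → h :+ h := :2 :* h) ≈-refl ½) (⁻¹-inverse 2≉0)

  halve : ∀ x → ½ * x + ½ * x ≈ x
  halve x = trans (sym (distribʳ x ½ ½)) (trans (*-congʳ ½+½) (*-identityˡ x))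

  0<½* : ∀ {x} → 0# < x → 0# < ½ * x
  0<½* = *-positive 0<½

  ½*x<x : ∀ {x} → 0# < x → ½ * x < x
  ½*x<x {x} 0<x = <-resp (+-identityʳ _) (halve x) (+-monoˡ-< (½ * x) (0<½* 0<x))

  commonLower : ∀ {x y} → 0# < x → 0# < y → ∃[ z ] 0# < z × z ≤ x × z ≤ y
  commonLower {x} {y} 0<x 0<y with ≤-or-> x y
  ... | inj₁ x≤y = x , 0<x , ≤-refl , x≤y
  ... | inj₂ y<x = y , 0<y , inj₁ y<x , ≤-refl

  -- Consequences of completeness: excluded middle, square roots, the Archimedean property

  abstract
    excludedMiddle : (P : Set) → Dec P
    excludedMiddle P with supremum S (0# , inj₁ ≈-refl) (1# , bound)
      where
      S : Carrier → Set
      S x = (x ≈ 0#) ⊎ (x ≈ 1# × P)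
      bound : UpperBound S 1#
      bound x (inj₁ x≈0)       = ≤-resp (sym x≈0) ≈-refl 0≤1
      bound x (inj₂ (x≈1 , _)) = inj₂ x≈1
    ... | s , upper , least with ≤-or-> s 0#
    ... | inj₁ s≤0 = no λ p → <⇒≱ 0<1 (≤-trans (upper 1# (inj₂ (≈-refl , p))) s≤0)
    ... | inj₂ 0<s with least 0# 0<s
    ... | x , inj₁ x≈0       , 0<x = ⊥-elim (<-irrefl (sym x≈0) 0<x)
    ... | x , inj₂ (_ , p) , _   = yes p

  ¬¬-elim : {P : Set} → ¬ ¬ P → P
  ¬¬-elim {P} ¬¬p with excludedMiddle P
  ... | yes p = p
  ... | no ¬p = ⊥-elim (¬¬p ¬p)

  ¬∀⟶∃¬ : {A : Set} (P : A → Set) → ¬ (∀ x → P x) → ∃[ x ] ¬ P x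
  ¬∀⟶∃¬ P ¬∀ = ¬¬-elim λ ¬∃ → ¬∀ λ x → ¬¬-elim λ ¬Px → ¬∃ (x , ¬Px)

  sq≈0⇒≈0 : ∀ {x} → x * x ≈ 0# → x ≈ 0#
  sq≈0⇒≈0 p = ¬¬-elim λ x≉0 → *-≉0 x≉0 x≉0 p

  sumsq≈0 : ∀ {x y} → 0# ≤ x → 0# ≤ y → x + y ≈ 0# → x ≈ 0#
  sumsq≈0 {x} {y} 0≤x 0≤y p = ≤-antisym
    (≤-resp (+-identityʳ x) p (+-monoˡ-≤ x 0≤y)) 0≤x

  sq-mono-≤ : ∀ {x y} → 0# ≤ x → x ≤ y → x * x ≤ y * y
  sq-mono-≤ 0≤x x≤y = *-mono-≤ (≤-trans 0≤x x≤y) 0≤x x≤y x≤y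

  sq-reflect-< : ∀ {x y} → 0# ≤ y → x * x < y * y → x < y
  sq-reflect-< {x} {y} 0≤y p with ≤-or-> y x
  ... | inj₁ y≤x = ⊥-elim (<⇒≱ p (sq-mono-≤ 0≤y y≤x))
  ... | inj₂ x<y = x<y

  abstract
    -- The root is the supremum s of the x ≥ 0 with x² ≤ a. If s² < a, any positive δ ≤ 1 with δ (1
    -- + 2s) ≤ a - s² still gives (s + δ)² ≤ a. If s² > a, the Newton step δ = (s² - a) / 2s gives
    -- (s - δ)² = a + δ² > a, so no such x lies above s - δ.
    sqrt : ∀ a → 0# ≤ a → ∃[ s ] 0# ≤ s × s * s ≈ a
    sqrt a 0≤a with supremum (λ x → 0# ≤ x × x * x ≤ a) (0# , ≤-refl , ≤-resp (sym (zeroˡ 0#)) ≈-refl 0≤a)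
                      (a + 1# , bound)
      where
      bound : ∀ x → 0# ≤ x × x * x ≤ a → x ≤ a + 1#
      bound x (0≤x , x²≤a) = ≮⇒≥ λ a+1<x → <⇒≱ (<-trans (x<x+1 a) a+1<x)
        (≤-trans (≤-resp (*-identityʳ x) ≈-refl (*-monoˡ-≤ 0≤x
          (≤-trans (≤-resp (+-identityˡ 1#) ≈-refl (+-monoʳ-≤ 1# 0≤a)) (inj₁ a+1<x)))) x²≤a)
    ... | s , upper , least = s , 0≤s , s²≈a
      where
      0≤s : 0# ≤ s
      0≤s = upper 0# (≤-refl , ≤-resp (sym (zeroˡ 0#)) ≈-refl 0≤a)
      s²≮a : ¬ (s * s < a)
      s²≮a s²<a with commonLower (*-positive (x<y⇒0<y-x s²<a) (⁻¹-pos 0<w)) 0<1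
        where
        0<w : 0# < 1# + (s + s)
        0<w = +-pos-nonneg 0<1 (+-nonneg 0≤s 0≤s)
      ... | δ , 0<δ , δ≤D/w , δ≤1 = <⇒≱ (<-resp (+-identityʳ s) ≈-refl (+-monoˡ-< s 0<δ))
          (upper (s + δ) (+-nonneg 0≤s (inj₁ 0<δ) , 0≤y-x⇒x≤y (≤-resp ≈-refl
            (solve 3 (λ s a δ → δ :* (:1 :- δ) :+ (a :- s :* s :- δ :* (:1 :+ (s :+ s))) := a :- (s :+ δ) :* (s :+ δ)) ≈-refl s a δ)
            (+-nonneg (*-nonneg (inj₁ 0<δ) (x≤y⇒0≤y-x δ≤1)) (x≤y⇒0≤y-x δw≤D)))))
        where
        0<w : 0# < 1# + (s + s)
        0<w = +-pos-nonneg 0<1 (+-nonneg 0≤s 0≤s)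
        δw≤D : δ * (1# + (s + s)) ≤ a - s * s
        δw≤D = ≤-resp ≈-refl (trans (*-assoc _ _ _) (trans (*-congˡ (trans (*-comm _ _) (⁻¹-inverse (>⇒≉ 0<w)))) (*-identityʳ _)))
                 (*-monoʳ-≤ (inj₁ 0<w) δ≤D/w)
      s²≯a : ¬ (a < s * s)
      s²≯a a<s² = contra (least (s - δ) (0<y-x⇒x<y (<-resp ≈-refl (solve 2 (λ s δ → δ := s :- (s :- δ)) ≈-refl s δ) 0<δ)))
        where
        0<s : 0# < s
        0<s = sq-reflect-< 0≤s (≤-<-trans (≤-resp (sym (zeroˡ 0#)) ≈-refl 0≤a) a<s²)
        0<2s : 0# < s + s
        0<2s = +-pos-nonneg 0<s 0≤s
        δ : Carrier
        δ = (s * s - a) * (s + s) ⁻¹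
        0<δ : 0# < δ
        0<δ = *-positive (x<y⇒0<y-x a<s²) (⁻¹-pos 0<2s)
        2sδ : (s + s) * δ ≈ s * s - a
        2sδ = trans (solve 3 (λ w x i → w :* (x :* i) := x :* (w :* i)) ≈-refl _ _ _)
                (trans (*-congˡ (⁻¹-inverse (>⇒≉ 0<2s))) (*-identityʳ _))
        0≤s-δ : 0# ≤ s - δ
        0≤s-δ = *-cancelˡ-≤ 0<2s (≤-resp (sym (zeroʳ _))
          (sym (trans (solve 2 (λ s δ → (s :+ s) :* (s :- δ) := (s :+ s) :* s :- (s :+ s) :* δ) ≈-refl s δ)
            (trans (+-congˡ (-‿cong 2sδ)) (solve 2 (λ s a → (s :+ s) :* s :- (s :* s :- a) := s :* s :+ a) ≈-refl s a))))
          (+-nonneg (sq-nonneg s) 0≤a))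
        a<[s-δ]² : a < (s - δ) * (s - δ)
        a<[s-δ]² = 0<y-x⇒x<y (<-resp ≈-refl
          (sym (trans (solve 3 (λ s a δ → (s :- δ) :* (s :- δ) :- a := (s :* s :- a :- (s :+ s) :* δ) :+ δ :* δ) ≈-refl s a δ)
            (trans (+-congʳ (trans (+-congˡ (-‿cong 2sδ)) (-‿inverseʳ _))) (+-identityˡ _))))
          (*-positive 0<δ 0<δ))
        contra : ∃[ x ] (0# ≤ x × x * x ≤ a) × s - δ < x → ⊥
        contra (x , (0≤x , x²≤a) , s-δ<x) = <-asym s-δ<x (sq-reflect-< 0≤s-δ (≤-<-trans x²≤a a<[s-δ]²))
      s²≈a : s * s ≈ a
      s²≈a = ≤-antisym (≮⇒≥ s²≯a) (≮⇒≥ s²≮a)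

  ι-nonneg : ∀ n → 0# ≤ ι n
  ι-nonneg zero    = inj₂ (sym ι-zero)
  ι-nonneg (suc n) = ≤-resp ≈-refl (sym (ι-suc n)) (+-nonneg (ι-nonneg n) 0≤1)

  ι-pos : ∀ n → 0# < ι (suc n)
  ι-pos n = <-resp ≈-refl (sym (ι-suc n)) (≤-<-trans (ι-nonneg n) (x<x+1 (ι n)))

  ι-mono-≤ : ∀ {m n} → m ℕ.≤ n → ι m ≤ ι n
  ι-mono-≤ {m} {n} m≤n = ≤-resp (+-identityʳ _)
    (trans (sym (ι-+ m (n ∸ m))) (reflexive (cong ι (ℕₚ.m+[n∸m]≡n m≤n))))
    (+-monoˡ-≤ (ι m) (ι-nonneg (n ∸ m)))

  ι-mono-< : ∀ {m n} → m ℕ.< n → ι m < ι n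
  ι-mono-< {m} {n} m<n = <-≤-trans (<-resp ≈-refl (sym (ι-suc m)) (x<x+1 (ι m))) (ι-mono-≤ m<n)

  ι-reflect-≤ : ∀ {m n} → ι m ≤ ι n → m ℕ.≤ n
  ι-reflect-≤ {m} {n} p with m ℕₚ.≤? n
  ... | yes m≤n = m≤n
  ... | no  m≰n = ⊥-elim (<⇒≱ (ι-mono-< (ℕₚ.≰⇒> m≰n)) p)

  abstract
    archimedean : ∀ x → ∃[ n ] x ≤ ι n
    archimedean x = ¬¬-elim λ ¬∃ → unbounded (λ n → inj₁ ([ (λ x≤ι → ⊥-elim (¬∃ (n , x≤ι))) , id ]′ (≤-or-> x (ι n))))
      where
      unbounded : (∀ n → ι n ≤ x) → ⊥
      unbounded ι≤x with supremum (λ y → ∃[ n ] y ≈ ι n) (0# , 0 , sym ι-zero) (x , λ { y (n , y≈ι) → ≤-resp (sym y≈ι) ≈-refl (ι≤x n) })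
      ... | s , upper , least with least (s - 1#) (0<y-x⇒x<y (<-resp ≈-refl (solve 1 (λ s → :1 := s :- (s :- :1)) ≈-refl s) 0<1))
      ... | y , (n , y≈ι) , s-1<y = <⇒≱
        (<-resp (solve 1 (λ s → s :- :1 :+ :1 := s) ≈-refl s) ≈-refl (+-mono-<-≤ s-1<y (≤-refl {1#})))
        (upper (y + 1#) (suc n , trans (+-congʳ y≈ι) (sym (ι-suc n))))

  -- Absolute values

  ∣∣-nonneg : ∀ x → 0# ≤ ∣ x ∣
  ∣∣-nonneg x with compare 0# x
  ... | tri< a _ _ = inj₁ a
  ... | tri≈ _ b _ = inj₂ b
  ... | tri> _ _ c = inj₁ (<-resp ≈-refl (+-identityˡ _) (x<y⇒0<y-x c))

  ∣∣-± : ∀ x → ∣ x ∣ ≡ x ⊎ ∣ x ∣ ≡ - x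
  ∣∣-± x with compare 0# x
  ... | tri< _ _ _ = inj₁ refl
  ... | tri≈ _ _ _ = inj₁ refl
  ... | tri> _ _ _ = inj₂ refl

  x≤∣x∣ : ∀ x → x ≤ ∣ x ∣
  x≤∣x∣ x with compare 0# x
  ... | tri< _ _ _ = ≤-refl
  ... | tri≈ _ _ _ = ≤-refl
  ... | tri> _ _ c = ≤-trans (inj₁ c) (inj₁ (<-resp ≈-refl (+-identityˡ _) (x<y⇒0<y-x c)))

  -x≤∣x∣ : ∀ x → - x ≤ ∣ x ∣
  -x≤∣x∣ x with ∣∣-± x
  ... | inj₂ eq = inj₂ (reflexive (≡.sym eq))
  ... | inj₁ eq = ≤-trans (≤-resp ≈-refl -0#≈0# (-‿anti-≤ (subst (0# ≤_) eq (∣∣-nonneg x)))) (∣∣-nonneg x)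

  ∣∣-lub : ∀ {x b} → x ≤ b → - x ≤ b → ∣ x ∣ ≤ b
  ∣∣-lub {x} x≤b -x≤b with ∣∣-± x
  ... | inj₁ eq = subst (_≤ _) (≡.sym eq) x≤b
  ... | inj₂ eq = subst (_≤ _) (≡.sym eq) -x≤b

  ∣∣-cong : ∀ {x y} → x ≈ y → ∣ x ∣ ≈ ∣ y ∣
  ∣∣-cong x≈y = ≤-antisym (half x≈y) (half (sym x≈y))
    where
    half : ∀ {x y} → x ≈ y → ∣ x ∣ ≤ ∣ y ∣
    half {x} {y} x≈y = ∣∣-lub (≤-trans (inj₂ x≈y) (x≤∣x∣ y)) (≤-trans (inj₂ (-‿cong x≈y)) (-x≤∣x∣ y))

  ∣∣-of-nonneg : ∀ {x} → 0# ≤ x → ∣ x ∣ ≈ x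
  ∣∣-of-nonneg {x} 0≤x = ≤-antisym
    (∣∣-lub ≤-refl (≤-trans (≤-resp ≈-refl -0#≈0# (-‿anti-≤ 0≤x)) 0≤x)) (x≤∣x∣ x)

  ∣-x∣ : ∀ x → ∣ - x ∣ ≈ ∣ x ∣
  ∣-x∣ x = ≤-antisym
    (∣∣-lub (-x≤∣x∣ x) (≤-resp (solve 1 (λ x → x := :- (:- x)) ≈-refl x) ≈-refl (x≤∣x∣ x)))
    (∣∣-lub (≤-resp (solve 1 (λ x → :- (:- x) := x) ≈-refl x) ≈-refl (-x≤∣x∣ (- x))) (x≤∣x∣ (- x)))

  ∣x+y∣≤ : ∀ x y → ∣ x + y ∣ ≤ ∣ x ∣ + ∣ y ∣
  ∣x+y∣≤ x y = ∣∣-lub (+-mono-≤ (x≤∣x∣ x) (x≤∣x∣ y))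
    (≤-resp (solve 2 (λ x y → (:- x) :+ (:- y) := :- (x :+ y)) ≈-refl x y) ≈-refl (+-mono-≤ (-x≤∣x∣ x) (-x≤∣x∣ y)))

  ∣x-y∣≤ : ∀ x y → ∣ x - y ∣ ≤ ∣ x ∣ + ∣ y ∣
  ∣x-y∣≤ x y = ≤-trans (∣x+y∣≤ x (- y)) (+-monoˡ-≤ ∣ x ∣ (inj₂ (∣-x∣ y)))

  ∣xy∣ : ∀ x y → ∣ x * y ∣ ≈ ∣ x ∣ * ∣ y ∣
  ∣xy∣ x y with ∣∣-± x | ∣∣-± y
  ... | inj₁ p | inj₁ q = trans (∣∣-of-nonneg (*-nonneg (subst (0# ≤_) p (∣∣-nonneg x)) (subst (0# ≤_) q (∣∣-nonneg y))))
                            (reflexive (≡.sym (cong₂ _*_ p q)))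
  ... | inj₁ p | inj₂ q = trans (sym (∣-x∣ _)) (trans
      (∣∣-cong (solve 2 (λ x y → :- (x :* y) := x :* (:- y)) ≈-refl x y)) (trans
      (∣∣-of-nonneg (*-nonneg (subst (0# ≤_) p (∣∣-nonneg x)) (subst (0# ≤_) q (∣∣-nonneg y))))
      (reflexive (≡.sym (cong₂ _*_ p q)))))
  ... | inj₂ p | inj₁ q = trans (sym (∣-x∣ _)) (trans
      (∣∣-cong (solve 2 (λ x y → :- (x :* y) := (:- x) :* y) ≈-refl x y)) (trans
      (∣∣-of-nonneg (*-nonneg (subst (0# ≤_) p (∣∣-nonneg x)) (subst (0# ≤_) q (∣∣-nonneg y))))
      (reflexive (≡.sym (cong₂ _*_ p q)))))
  ... | inj₂ p | inj₂ q = trans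
      (∣∣-cong (solve 2 (λ x y → x :* y := (:- x) :* (:- y)) ≈-refl x y)) (trans
      (∣∣-of-nonneg (*-nonneg (subst (0# ≤_) p (∣∣-nonneg x)) (subst (0# ≤_) q (∣∣-nonneg y))))
      (reflexive (≡.sym (cong₂ _*_ p q))))

  ∣∣≉0 : ∀ {x} → ¬ (x ≈ 0#) → 0# < ∣ x ∣
  ∣∣≉0 {x} x≉0 = [ id , (λ 0≈∣x∣ → ⊥-elim (x≉0 (≤-antisym
    (≤-resp ≈-refl (sym 0≈∣x∣) (x≤∣x∣ x))
    (≤-resp -0#≈0# (solve 1 (λ x → :- (:- x) := x) ≈-refl x) (-‿anti-≤ (≤-resp ≈-refl (sym 0≈∣x∣) (-x≤∣x∣ x))))))) ]′ (∣∣-nonneg x)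

  ∣0∣ : ∣ 0# ∣ ≈ 0#
  ∣0∣ = ∣∣-of-nonneg ≤-refl

  sq≤sq⇒∣∣≤ : ∀ {x b} → 0# ≤ b → x * x ≤ b * b → ∣ x ∣ ≤ b
  sq≤sq⇒∣∣≤ {x} {b} 0≤b p = ∣∣-lub (≮⇒≥ λ b<x → <⇒≱ (sq< 0≤b b<x) p)
    (≮⇒≥ λ b<-x → <⇒≱ (<-resp ≈-refl (solve 1 (λ x → (:- x) :* (:- x) := x :* x) ≈-refl x) (sq< 0≤b b<-x)) p)
    where
    sq< : ∀ {x y} → 0# ≤ x → x < y → x * x < y * y
    sq< {x} {y} 0≤x x<y = ≤-<-trans (*-monoˡ-≤ 0≤x (inj₁ x<y))
      (<-resp (*-comm _ _) ≈-refl (*-monoˡ-< (≤-<-trans 0≤x x<y) x<y))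

  -- Polynomials and rational functions

  sum-cong : ∀ {n} {f g : Vector Carrier n} → (∀ i → f i ≈ g i) → sum f ≈ sum g
  sum-cong {n} = sum-cong-≋ {n}

  sum-zero : ∀ {n} {f : Vector Carrier n} → (∀ i → f i ≈ 0#) → sum f ≈ 0#
  sum-zero {n} f≈0 = trans (sum-cong f≈0) (sum-replicate-zero n)

  sum-mono : ∀ {n} {f g : Vector Carrier n} → (∀ i → f i ≤ g i) → sum f ≤ sum g
  sum-mono {zero}  f≤g = ≤-refl
  sum-mono {suc n} f≤g = +-mono-≤ (f≤g zero) (sum-mono (f≤g ∘ suc))

  sum-nonneg : ∀ {n} {f : Vector Carrier n} → (∀ i → 0# ≤ f i) → 0# ≤ sum f
  sum-nonneg {zero}  0≤f = ≤-refl
  sum-nonneg {suc n} 0≤f = +-nonneg (0≤f zero) (sum-nonneg (0≤f ∘ suc))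

  sum-scaleˡ : ∀ {n} c (f : Vector Carrier n) → sum (λ i → c * f i) ≈ c * sum f
  sum-scaleˡ c f = sym (*-distribˡ-sum c f)

  -- [ c ] is a constant in no variables, and p ▹ P stands for p + x₀ P, where
  -- p does not involve the first variable x₀.
  infixr 5 _▹_
  data Poly : ℕ → Set where
    [_] : Carrier → Poly 0
    ε   : ∀ {N} → Poly (suc N)
    _▹_ : ∀ {N} → Poly N → Poly (suc N) → Poly (suc N)

  eval : ∀ {N} → Poly N → Point N → Carrier
  eval [ c ]    t = c
  eval ε        t = 0#
  eval (p ▹ P) t = eval p (tail t) + head t * eval P t

  constant : ∀ N → Carrier → Poly N
  constant zero    c = [ c ]
  constant (suc N) c = constant N c ▹ ε

  variableᵖ : ∀ {N} → Fin N → Poly N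
  variableᵖ {suc N} zero    = constant N 0# ▹ constant N 1# ▹ ε
  variableᵖ {suc N} (suc i) = variableᵖ i ▹ ε

  infixl 6 _+ᵖ_
  infixl 7 _*ᵖ_ _*ˢ_

  _+ᵖ_ : ∀ {N} → Poly N → Poly N → Poly N
  [ c ]   +ᵖ [ c′ ]  = [ c + c′ ]
  ε       +ᵖ Q       = Q
  (p ▹ P) +ᵖ ε       = p ▹ P
  (p ▹ P) +ᵖ (q ▹ Q) = (p +ᵖ q) ▹ (P +ᵖ Q)

  mutual
    _*ᵖ_ : ∀ {N} → Poly N → Poly N → Poly N
    [ c ]         *ᵖ [ c′ ] = [ c * c′ ]
    ε             *ᵖ Q      = ε
    _▹_ {N} p P *ᵖ Q      = p *ˢ Q +ᵖ (constant N 0# ▹ (P *ᵖ Q))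

    _*ˢ_ : ∀ {N} → Poly N → Poly (suc N) → Poly (suc N)
    p *ˢ ε       = ε
    p *ˢ (q ▹ Q) = (p *ᵖ q) ▹ (p *ˢ Q)

  eval-constant : ∀ N c t → eval (constant N c) t ≈ c
  eval-constant zero    c t = ≈-refl
  eval-constant (suc N) c t = trans (+-cong (eval-constant N c (tail t)) (zeroʳ _)) (+-identityʳ c)

  eval-variable : ∀ {N} (i : Fin N) t → eval (variableᵖ i) t ≈ t i
  eval-variable {suc N} zero    t = trans
    (+-cong (eval-constant N 0# (tail t)) (*-congˡ (+-cong (eval-constant N 1# (tail t)) ≈-refl)))
    (solve 1 (λ x → :0 :+ x :* (:1 :+ x :* :0) := x) ≈-refl (head t))
  eval-variable {suc N} (suc i) t = trans (+-cong (eval-variable i (tail t)) (zeroʳ _)) (+-identityʳ _)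

  eval-+ : ∀ {N} (p q : Poly N) t → eval (p +ᵖ q) t ≈ eval p t + eval q t
  eval-+ [ c ]   [ c′ ]  t = ≈-refl
  eval-+ ε       Q       t = sym (+-identityˡ _)
  eval-+ (p ▹ P) ε       t = sym (+-identityʳ _)
  eval-+ (p ▹ P) (q ▹ Q) t = trans (+-cong (eval-+ p q (tail t)) (*-congˡ (eval-+ P Q t)))
    (solve 5 (λ x a b c d → a :+ b :+ x :* (c :+ d) := a :+ x :* c :+ (b :+ x :* d)) ≈-refl (head t) _ _ _ _)

  mutual
    eval-* : ∀ {N} (p q : Poly N) t → eval (p *ᵖ q) t ≈ eval p t * eval q t
    eval-* [ c ] [ c′ ] t = ≈-refl
    eval-* ε     Q      t = sym (zeroˡ _)
    eval-* (_▹_ {N} p P) Q t = trans (eval-+ (p *ˢ Q) _ t)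
      (trans (+-cong (eval-*ˢ p Q t) (+-cong (eval-constant N 0# (tail t)) (*-congˡ (eval-* P Q t))))
      (solve 4 (λ p x P Q → p :* Q :+ (:0 :+ x :* (P :* Q)) := (p :+ x :* P) :* Q) ≈-refl _ (head t) _ _))

    eval-*ˢ : ∀ {N} (p : Poly N) Q t → eval (p *ˢ Q) t ≈ eval p (tail t) * eval Q t
    eval-*ˢ p ε       t = sym (zeroʳ _)
    eval-*ˢ p (q ▹ Q) t = trans (+-cong (eval-* p q (tail t)) (*-congˡ (eval-*ˢ p Q t)))
      (solve 4 (λ p x q Q → p :* q :+ x :* (p :* Q) := p :* (q :+ x :* Q)) ≈-refl _ (head t) _ _)

  -- Abstracting the class of functions lets one traversal of the product of constraints show both
  -- that it is polynomial in the matrix entries, for analyticity, and that it is rational in chart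
  -- parameters, for nullity.
  record Closed {X : Set} (𝒫 : (X → Carrier) → Set) : Set where
    field
      respects  : ∀ {f g} → (∀ x → f x ≈ g x) → 𝒫 f → 𝒫 g
      constants : ∀ c → 𝒫 (λ _ → c)
      sums      : ∀ {f g} → 𝒫 f → 𝒫 g → 𝒫 (λ x → f x + g x)
      products  : ∀ {f g} → 𝒫 f → 𝒫 g → 𝒫 (λ x → f x * g x)

    negations : ∀ {f} → 𝒫 f → 𝒫 (λ x → - f x)
    negations {f} Pf = respects (λ x → solve 1 (λ y → (:- :1) :* y := :- y) ≈-refl (f x)) (products (constants (- 1#)) Pf)

    differences : ∀ {f g} → 𝒫 f → 𝒫 g → 𝒫 (λ x → f x - g x)
    differences Pf Pg = sums Pf (negations Pg)

    finiteSums : ∀ {n} {f : Fin n → X → Carrier} → (∀ i → 𝒫 (f i)) → 𝒫 (λ x → sum (λ i → f i x))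
    finiteSums {zero}  Pf = constants 0#
    finiteSums {suc n} Pf = sums (Pf zero) (finiteSums (Pf ∘ suc))

  IsPoly : ∀ {N} → (Point N → Carrier) → Set
  IsPoly {N} f = Σ[ p ∈ Poly N ] ∀ t → f t ≈ eval p t

  isPoly-closed : ∀ {N} → Closed (IsPoly {N})
  isPoly-closed {N} = record
    { respects  = λ f≈g (p , f≈) → p , λ t → trans (sym (f≈g t)) (f≈ t)
    ; constants = λ c → constant N c , λ t → sym (eval-constant N c t)
    ; sums      = λ (p , f≈) (q , g≈) → p +ᵖ q , λ t → trans (+-cong (f≈ t) (g≈ t)) (sym (eval-+ p q t))
    ; products  = λ (p , f≈) (q , g≈) → p *ᵖ q , λ t → trans (*-cong (f≈ t) (g≈ t)) (sym (eval-* p q t))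
    }

  isPoly-variable : ∀ {N} (i : Fin N) → IsPoly (λ t → t i)
  isPoly-variable i = variableᵖ i , λ t → sym (eval-variable i t)

  -- The denominator is bounded below by 1, not merely nonzero: then |f| ≤ |den f| yields bounds and
  -- Lipschitz constants, and the inverse of an f ≥ 1 is obtained by exchanging numerator and
  -- denominator. The charts only ever invert ⟨ u , u ⟩ for u = (1, t), which is at least 1.
  record IsRat {N} (f : Point N → Carrier) : Set where
    constructor mkRat
    field
      num den : Poly N
      1≤den   : ∀ t → 1# ≤ eval den t
      den*f   : ∀ t → eval den t * f t ≈ eval num t

  1≤* : ∀ {x y} → 1# ≤ x → 1# ≤ y → 1# ≤ x * y
  1≤* 1≤x 1≤y = ≤-resp (*-identityˡ 1#) ≈-refl (*-mono-≤ (≤-trans 0≤1 1≤x) 0≤1 1≤x 1≤y)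

  isPoly⇒isRat : ∀ {N} {f : Point N → Carrier} → IsPoly f → IsRat f
  isPoly⇒isRat {N} (p , f≈) = mkRat p (constant N 1#) (λ t → inj₂ (sym (eval-constant N 1# t)))
    (λ t → trans (*-cong (eval-constant N 1# t) (f≈ t)) (*-identityˡ _))

  isRat-closed : ∀ {N} → Closed (IsRat {N})
  isRat-closed {N} = record
    { respects  = λ f≈g (mkRat p q 1≤q eq) → mkRat p q 1≤q λ t → trans (*-congˡ (sym (f≈g t))) (eq t)
    ; constants = λ c → isPoly⇒isRat (Closed.constants isPoly-closed c)
    ; sums      = λ (mkRat p q 1≤q eq) (mkRat p′ q′ 1≤q′ eq′) → mkRat (q′ *ᵖ p +ᵖ q *ᵖ p′) (q *ᵖ q′)
        (λ t → ≤-resp ≈-refl (sym (eval-* q q′ t)) (1≤* (1≤q t) (1≤q′ t)))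
        (λ t → trans (*-congʳ (eval-* q q′ t)) (trans
          (solve 4 (λ q q′ f g → q :* q′ :* (f :+ g) := q′ :* (q :* f) :+ q :* (q′ :* g)) ≈-refl _ _ _ _)
          (sym (trans (eval-+ (q′ *ᵖ p) (q *ᵖ p′) t)
            (+-cong (trans (eval-* q′ p t) (*-congˡ (sym (eq t)))) (trans (eval-* q p′ t) (*-congˡ (sym (eq′ t)))))))))
    ; products  = λ (mkRat p q 1≤q eq) (mkRat p′ q′ 1≤q′ eq′) → mkRat (p *ᵖ p′) (q *ᵖ q′)
        (λ t → ≤-resp ≈-refl (sym (eval-* q q′ t)) (1≤* (1≤q t) (1≤q′ t)))
        (λ t → trans (*-congʳ (eval-* q q′ t)) (trans
          (solve 4 (λ q q′ f g → q :* q′ :* (f :* g) := (q :* f) :* (q′ :* g)) ≈-refl _ _ _ _)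
          (sym (trans (eval-* p p′ t) (*-cong (sym (eq t)) (sym (eq′ t)))))))
    }

  0<of1≤ : ∀ {x} → 1# ≤ x → 0# < x
  0<of1≤ = <-≤-trans 0<1

  isRat-⁻¹ : ∀ {N} {f : Point N → Carrier} → (∀ t → 1# ≤ f t) → IsRat f → IsRat (λ t → f t ⁻¹)
  isRat-⁻¹ {N} {f} 1≤f (mkRat p q 1≤q eq) = mkRat q p
    (λ t → ≤-resp ≈-refl (eq t) (1≤* (1≤q t) (1≤f t)))
    (λ t → trans (*-congʳ (sym (eq t))) (trans (*-assoc _ _ _)
      (trans (*-congˡ (⁻¹-inverse (>⇒≉ (0<of1≤ (1≤f t))))) (*-identityʳ _))))

  Box : ∀ {N} → Point N → Set
  Box t = ∀ i → 0# ≤ t i × t i ≤ 1#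

  eval-bounded : ∀ {N} (p : Poly N) → ∃[ B ] 0# ≤ B × (∀ t → Box t → ∣ eval p t ∣ ≤ B)
  eval-bounded [ c ] = ∣ c ∣ , ∣∣-nonneg c , λ _ _ → ≤-refl
  eval-bounded ε     = 0# , ≤-refl , λ _ _ → inj₂ ∣0∣
  eval-bounded (p ▹ P) with eval-bounded p | eval-bounded P
  ... | B , 0≤B , p≤B | C , 0≤C , P≤C = B + C , +-nonneg 0≤B 0≤C , λ t t∈ →
    ≤-trans (∣x+y∣≤ _ _) (+-mono-≤ (p≤B (tail t) (t∈ ∘ suc))
      (≤-resp (sym (∣xy∣ _ _)) (*-identityˡ C)
        (*-mono-≤ 0≤1 (∣∣-nonneg _) (≤-resp (sym (∣∣-of-nonneg (proj₁ (t∈ zero)))) ≈-refl (proj₂ (t∈ zero))) (P≤C t t∈))))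

  LipschitzOn : ∀ {N} → (Point N → Carrier) → Carrier → Set
  LipschitzOn f L = ∀ t t′ δ → Box t → Box t′ → 0# ≤ δ → (∀ i → ∣ t i - t′ i ∣ ≤ δ) → ∣ f t - f t′ ∣ ≤ L * δ

  eval-lipschitz : ∀ {N} (p : Poly N) → ∃[ L ] 0# ≤ L × LipschitzOn (eval p) L
  eval-lipschitz [ c ] = 0# , ≤-refl , λ _ _ δ _ _ _ _ → inj₂ (trans (∣∣-cong (-‿inverseʳ c)) (trans ∣0∣ (sym (zeroˡ δ))))
  eval-lipschitz ε     = 0# , ≤-refl , λ _ _ δ _ _ _ _ → inj₂ (trans (∣∣-cong (-‿inverseʳ 0#)) (trans ∣0∣ (sym (zeroˡ δ))))
  eval-lipschitz (p ▹ P) with eval-lipschitz p | eval-lipschitz P | eval-bounded P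
  ... | L , 0≤L , p-lip | L′ , 0≤L′ , P-lip | C , 0≤C , P≤C =
    L + (L′ + C) , +-nonneg 0≤L (+-nonneg 0≤L′ 0≤C) , λ t t′ δ t∈ t′∈ 0≤δ t≈t′ →
      let x = head t ; x′ = head t′ ; a = eval p (tail t) ; a′ = eval p (tail t′) ; A = eval P t ; A′ = eval P t′ in
      ≤-resp (∣∣-cong (solve 6 (λ x x′ a a′ A A′ → a :- a′ :+ (x :* (A :- A′) :+ (x :- x′) :* A′) := a :+ x :* A :- (a′ :+ x′ :* A′)) ≈-refl x x′ a a′ A A′))
        (solve 4 (λ L L′ C δ → L :* δ :+ (:1 :* (L′ :* δ) :+ δ :* C) := (L :+ (L′ :+ C)) :* δ) ≈-refl L L′ C δ)
        (≤-trans (∣x+y∣≤ _ _) (+-mono-≤ (p-lip (tail t) (tail t′) δ (t∈ ∘ suc) (t′∈ ∘ suc) 0≤δ (t≈t′ ∘ suc))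
          (≤-trans (∣x+y∣≤ _ _) (+-mono-≤
            (≤-resp (sym (∣xy∣ _ _)) ≈-refl (*-mono-≤ 0≤1 (∣∣-nonneg _)
              (≤-resp (sym (∣∣-of-nonneg (proj₁ (t∈ zero)))) ≈-refl (proj₂ (t∈ zero))) (P-lip t t′ δ t∈ t′∈ 0≤δ t≈t′)))
            (≤-resp (sym (∣xy∣ _ _)) ≈-refl (*-mono-≤ 0≤δ (∣∣-nonneg _) (t≈t′ zero) (P≤C t′ t′∈)))))))

  -- Polynomials as power series

  coefficient : ∀ {N} → Poly N → Vec ℕ N → Carrier
  coefficient [ c ]   []          = c
  coefficient ε       _           = 0#
  coefficient (p ▹ P) (zero ∷ α)  = coefficient p α
  coefficient (p ▹ P) (suc a ∷ α) = coefficient P (a ∷ α)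

  size : ∀ {N} → Poly N → ℕ
  size [ c ]   = 0
  size ε       = 0
  size (p ▹ P) = size p ℕ.⊔ suc (size P)

  boxSum-cong : ∀ {N} K {t t′ : Vec ℕ N → Carrier} → (∀ α → t α ≈ t′ α) → boxSum K t ≈ boxSum K t′
  boxSum-cong {zero}  K t≈ = t≈ []
  boxSum-cong {suc N} K t≈ = sum-cong {K} λ a → boxSum-cong K λ α → t≈ (toℕ a ∷ α)

  boxSum-zero : ∀ {N} K → boxSum {N} K (λ _ → 0#) ≈ 0#
  boxSum-zero {zero}  K = ≈-refl
  boxSum-zero {suc N} K = sum-zero {K} λ _ → boxSum-zero {N} K

  boxSum-scale : ∀ {N} K c (t : Vec ℕ N → Carrier) → boxSum K (λ α → c * t α) ≈ c * boxSum K t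
  boxSum-scale {zero}  K c t = ≈-refl
  boxSum-scale {suc N} K c t = trans (sum-cong {K} λ a → boxSum-scale K c λ α → t (toℕ a ∷ α)) (sum-scaleˡ {K} c _)

  private
    term : ∀ {N} → Poly N → Point N → Vec ℕ N → Carrier
    term p h α = coefficient p α * monomial α h

    -- A box sum whose first index has its own range J. Splitting off the constant coefficient in
    -- the first variable lowers J by one but leaves the range K of the other indices alone, so the
    -- induction needs the two ranges apart.
    slices : ∀ {N} → ℕ → ℕ → (Vec ℕ (suc N) → Carrier) → Carrier
    slices J K t = sum {J} λ a → boxSum K λ α → t (toℕ a ∷ α)

    term-zero : ∀ {N} (p : Poly N) P h α → term (p ▹ P) h (zero ∷ α) ≈ term p (tail h) α
    term-zero p P h α = *-congˡ (*-identityˡ _)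

    term-suc : ∀ {N} (p : Poly N) P h a α → term (p ▹ P) h (suc a ∷ α) ≈ head h * term P h (a ∷ α)
    term-suc p P h a α = solve 4 (λ x c y m → c :* ((x :* y) :* m) := x :* (c :* (y :* m))) ≈-refl (head h) _ _ _

  mutual
    boxSum-eval : ∀ {N} (p : Poly N) h K → size p ℕ.≤ K → boxSum K (term p h) ≈ eval p h
    boxSum-eval [ c ]   h K _ = *-identityʳ c
    boxSum-eval ε       h K q = slices-eval ε h K K q q
    boxSum-eval (p ▹ P) h K q = slices-eval (p ▹ P) h K K q q

    slices-eval : ∀ {N} (P : Poly (suc N)) h J K → size P ℕ.≤ J → size P ℕ.≤ K → slices J K (term P h) ≈ eval P h
    slices-eval {N} ε h J K _ _ = sum-zero {J} λ a → trans (boxSum-cong {N} K λ α → zeroˡ _) (boxSum-zero {N} K)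
    slices-eval (p ▹ P) h zero    K p≤0 _ = ⊥-elim (ℕₚ.n≮0 (ℕₚ.≤-trans (ℕₚ.m≤n⊔m (size p) (suc (size P))) p≤0))
    slices-eval {N} (p ▹ P) h (suc J) K ≤J ≤K = +-cong
      (trans (boxSum-cong {N} K (term-zero p P h)) (boxSum-eval p (tail h) K (ℕₚ.≤-trans (ℕₚ.m≤m⊔n (size p) _) ≤K)))
      (trans (sum-cong {J} λ a → trans (boxSum-cong {N} K λ α → term-suc p P h (toℕ a) α) (boxSum-scale {N} K (head h) _))
        (trans (sum-scaleˡ {J} (head h) _) (*-congˡ (slices-eval P h J K
          (ℕₚ.≤-pred (ℕₚ.≤-trans (ℕₚ.m≤n⊔m (size p) _) ≤J))
          (ℕₚ.≤-trans (ℕₚ.n≤1+n _) (ℕₚ.≤-trans (ℕₚ.m≤n⊔m (size p) _) ≤K))))))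

  -- A majorant: its value at the absolute values of the coordinates of h bounds all box sums of
  -- absolute values of the terms at once, which is the absolute convergence demanded by `HasSum`.
  absᵖ : ∀ {N} → Poly N → Poly N
  absᵖ [ c ]   = [ ∣ c ∣ ]
  absᵖ ε       = ε
  absᵖ (p ▹ P) = absᵖ p ▹ absᵖ P

  private
    abs-point : ∀ {N} → Point N → Point N
    abs-point h i = ∣ h i ∣

  eval-absᵖ-nonneg : ∀ {N} (p : Poly N) h → 0# ≤ eval (absᵖ p) (abs-point h)
  eval-absᵖ-nonneg [ c ]   h = ∣∣-nonneg c
  eval-absᵖ-nonneg ε       h = ≤-refl
  eval-absᵖ-nonneg (p ▹ P) h = +-nonneg (eval-absᵖ-nonneg p (tail h)) (*-nonneg (∣∣-nonneg _) (eval-absᵖ-nonneg P h))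

  mutual
    boxSum-bounded : ∀ {N} (p : Poly N) h K → boxSum K (∣_∣ ∘ term p h) ≤ eval (absᵖ p) (abs-point h)
    boxSum-bounded [ c ]   h K = inj₂ (∣∣-cong (*-identityʳ c))
    boxSum-bounded ε       h K = slices-bounded ε h K K
    boxSum-bounded (p ▹ P) h K = slices-bounded (p ▹ P) h K K

    slices-bounded : ∀ {N} (P : Poly (suc N)) h J K → slices J K (∣_∣ ∘ term P h) ≤ eval (absᵖ P) (abs-point h)
    slices-bounded {N} ε h J K = inj₂ (sum-zero {J} λ a → trans (boxSum-cong {N} K λ α → trans (∣∣-cong (zeroˡ _)) ∣0∣) (boxSum-zero {N} K))
    slices-bounded (p ▹ P) h zero    K = eval-absᵖ-nonneg (p ▹ P) h
    slices-bounded {N} (p ▹ P) h (suc J) K = +-mono-≤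
      (≤-trans (inj₂ (boxSum-cong {N} K (λ α → ∣∣-cong (term-zero p P h α)))) (boxSum-bounded p (tail h) K))
      (≤-trans (inj₂ (trans (sum-cong {J} λ a → trans
          (boxSum-cong {N} K λ α → trans (∣∣-cong (term-suc p P h (toℕ a) α)) (∣xy∣ _ _)) (boxSum-scale {N} K ∣ head h ∣ _))
          (sum-scaleˡ {J} ∣ head h ∣ _)))
        (*-monoˡ-≤ (∣∣-nonneg _) (slices-bounded P h J K)))

  -- The Taylor series at x terminates, so box sums agree with f from `size p` on and every radius
  -- would do. Assuming a polynomial in the increment h at each x avoids re-expanding one polynomial
  -- about another point.
  analytic-of-poly : ∀ {N} {f : Point N → Carrier} → (∀ {x y} → (∀ i → x i ≈ y i) → f x ≈ f y) →
                     (∀ x → IsPoly (λ h → f (λ i → x i + h i))) → ∀ x → AnalyticAt f x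
  analytic-of-poly {N} {f} f-cong f-poly x = 1# , 0<1 , coefficient p , λ y _ →
    (eval (absᵖ p) (abs-point (y ⊖ x)) , boxSum-bounded p (y ⊖ x)) ,
    λ δ 0<δ → size p , λ K ≤K → ≤-<-trans (inj₂ (trans (∣∣-cong (trans (+-congʳ (converges y K ≤K)) (-‿inverseʳ _))) ∣0∣)) 0<δ
    where
    p = proj₁ (f-poly x)
    converges : ∀ y K → size p ℕ.≤ K → boxSum K (term p (y ⊖ x)) ≈ f y
    converges y K ≤K = trans (boxSum-eval p (y ⊖ x) K ≤K) (trans (sym (proj₂ (f-poly x) (y ⊖ x)))
      (f-cong λ i → solve 2 (λ x y → x :+ (y :- x) := y) ≈-refl (x i) (y i)))

  -- Formal nonvanishing, as a path to a nonzero constant among the coefficients; the inductions on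
  -- the number of variables follow this path.
  data NonZeroᵖ : ∀ {N} → Poly N → Set where
    [_]   : ∀ {c} → ¬ (c ≈ 0#) → NonZeroᵖ [ c ]
    here  : ∀ {N} {p : Poly N} {P} → NonZeroᵖ p → NonZeroᵖ (p ▹ P)
    there : ∀ {N} {p : Poly N} {P} → NonZeroᵖ P → NonZeroᵖ (p ▹ P)

  nonZero-of-point : ∀ {N} (p : Poly N) t → ¬ (eval p t ≈ 0#) → NonZeroᵖ p
  nonZero-of-point [ c ]   t c≉0 = [ c≉0 ]
  nonZero-of-point ε       t 0≉0 = ⊥-elim (0≉0 ≈-refl)
  nonZero-of-point (p ▹ P) t ≉0 with excludedMiddle (eval p (tail t) ≈ 0#) | excludedMiddle (eval P t ≈ 0#)
  ... | no p≉0  | _       = here (nonZero-of-point p (tail t) p≉0)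
  ... | yes _   | no P≉0  = there (nonZero-of-point P t P≉0)
  ... | yes p≈0 | yes P≈0 = ⊥-elim (≉0 (trans (+-cong p≈0 (trans (*-congˡ P≈0) (zeroʳ _))) (+-identityˡ 0#)))

  -- Zeros of polynomials on a fine grid

  horner : List Carrier → Carrier → Carrier
  horner []       x = 0#
  horner (a ∷ as) x = a + x * horner as x

  quotient : Carrier → List Carrier → List Carrier
  quotient r []               = []
  quotient r (a ∷ [])         = []
  quotient r (a ∷ as@(_ ∷ _)) = horner as r ∷ quotient r as

  quotient-spec : ∀ r q x → horner q x - horner q r ≈ (x - r) * horner (quotient r q) x
  quotient-spec r []               x = solve 2 (λ r x → :0 :- :0 := (x :- r) :* :0) ≈-refl r x
  quotient-spec r (a ∷ [])         x = solve 3 (λ a r x → a :+ x :* :0 :- (a :+ r :* :0) := (x :- r) :* :0) ≈-refl a r x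
  quotient-spec r (a ∷ as@(_ ∷ _)) x = trans
    (solve 5 (λ a r x A B → a :+ x :* A :- (a :+ r :* B) := (x :- r) :* B :+ x :* (A :- B)) ≈-refl a r x (horner as x) (horner as r))
    (trans (+-congˡ (*-congˡ (quotient-spec r as x)))
    (solve 4 (λ r x B G → (x :- r) :* B :+ x :* ((x :- r) :* G) := (x :- r) :* (B :+ x :* G)) ≈-refl r x (horner as r) (horner (quotient r as) x)))

  quotient-length : ∀ r q {m} → length q ℕ.≤ suc m → length (quotient r q) ℕ.≤ m
  quotient-length r []               _       = z≤n
  quotient-length r (a ∷ [])         _       = z≤n
  quotient-length r (a ∷ as@(_ ∷ _)) {suc m} (s≤s p) = s≤s (quotient-length r as p)

  quotient-zero : ∀ r q → horner q r ≈ 0# → All (_≈ 0#) (quotient r q) → All (_≈ 0#) q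
  quotient-zero r []               _  _ = []
  quotient-zero r (a ∷ [])         q≈0 _ = trans (sym (trans (+-congˡ (zeroʳ r)) (+-identityʳ a))) q≈0 ∷ []
  quotient-zero r (a ∷ as@(_ ∷ _)) q≈0 (A≈0 ∷ rest) =
    trans (sym (trans (+-congˡ (trans (*-congˡ A≈0) (zeroʳ r))) (+-identityʳ a))) q≈0 ∷ quotient-zero r as A≈0 rest

  -- A coefficient a followed by the tail as equals q(r) - r as(r), and as(r) is itself a
  -- coefficient of the quotient. So each coefficient is at most 2η, and the doubling does not
  -- compound along the list.
  quotient-small : ∀ r q {η} → ∣ r ∣ ≤ 1# → ∣ horner q r ∣ ≤ η → All (λ c → ∣ c ∣ ≤ η) (quotient r q) → All (λ c → ∣ c ∣ ≤ η + η) q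
  quotient-small r []               _ _ _ = []
  quotient-small r (a ∷ [])         {η} _ q≤η _ = ≤-trans
    (≤-resp (∣∣-cong (trans (+-congˡ (zeroʳ r)) (+-identityʳ a))) ≈-refl q≤η)
    (≤-resp (+-identityʳ η) ≈-refl (+-monoˡ-≤ η (≤-trans (∣∣-nonneg _) q≤η))) ∷ []
  quotient-small r (a ∷ as@(_ ∷ _)) {η} r≤1 q≤η (A≤η ∷ rest) = ≤-trans
    (≤-resp (∣∣-cong (solve 3 (λ a r A → a :+ r :* A :- r :* A := a) ≈-refl a r (horner as r))) ≈-refl (∣x-y∣≤ _ (r * horner as r)))
    (+-mono-≤ q≤η (≤-resp (sym (∣xy∣ _ _)) (*-identityˡ η) (*-mono-≤ 0≤1 (∣∣-nonneg _) r≤1 A≤η)))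
    ∷ quotient-small r as r≤1 A≤η rest

  anyNonzero-quotient : ∀ r q → horner q r ≈ 0# → Any (λ c → ¬ (c ≈ 0#)) q → Any (λ c → ¬ (c ≈ 0#)) (quotient r q)
  anyNonzero-quotient r q q≈0 any = ¬¬-elim λ ¬any →
    All¬⇒¬Any (All.map (λ c≈0 c≉0 → c≉0 c≈0) (quotient-zero r q q≈0 (All.map ¬¬-elim (¬Any⇒All¬ _ ¬any)))) any

  anyLarge-quotient : ∀ r q {η} → ∣ r ∣ ≤ 1# → ∣ horner q r ∣ ≤ η →
                      Any (λ c → η + η < ∣ c ∣) q → Any (λ c → η < ∣ c ∣) (quotient r q)
  anyLarge-quotient r q r≤1 q≤η any = ¬¬-elim λ ¬any →
    All¬⇒¬Any (All.map (λ c≤ c> → <⇒≱ c> c≤) (quotient-small r q r≤1 q≤η (All.map ≮⇒≥ (¬Any⇒All¬ _ ¬any)))) any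

  finitelyManyRoots : ∀ m q → length q ℕ.≤ m → Any (λ c → ¬ (c ≈ 0#)) q → ∃[ rs ] ∀ x → horner q x ≈ 0# → Any (x ≈_) rs
  finitelyManyRoots zero    (_ ∷ _) () _
  finitelyManyRoots (suc m) q q≤m any with excludedMiddle (∃[ r ] horner q r ≈ 0#)
  ... | no ¬root = [] , λ x q≈0 → ⊥-elim (¬root (x , q≈0))
  ... | yes (r , q≈0) with finitelyManyRoots m (quotient r q) (quotient-length r q q≤m) (anyNonzero-quotient r q q≈0 any)
  ... | rs , complete = r ∷ rs , λ x qx≈0 → root x qx≈0 (excludedMiddle (x ≈ r))
    where
    root : ∀ x → horner q x ≈ 0# → Dec (x ≈ r) → Any (x ≈_) (r ∷ rs)
    root x qx≈0 (yes x≈r) = here x≈r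
    root x qx≈0 (no  x≉r) = there (complete x (integral
      (trans (sym (quotient-spec r q x)) (trans (+-cong qx≈0 (-‿cong q≈0)) (-‿inverseʳ 0#)))
      λ x-r≈0 → x≉r (trans (solve 2 (λ x r → x := x :- r :+ r) ≈-refl x r) (trans (+-congʳ x-r≈0) (+-identityˡ r)))))

  absSum : List Carrier → Carrier
  absSum []       = 0#
  absSum (x ∷ xs) = ∣ x ∣ + absSum xs

  absSum-nonneg : ∀ xs → 0# ≤ absSum xs
  absSum-nonneg []       = ≤-refl
  absSum-nonneg (x ∷ xs) = +-nonneg (∣∣-nonneg x) (absSum-nonneg xs)

  member≤absSum : ∀ {x} xs → Any (x ≈_) xs → x ≤ absSum xs
  member≤absSum (y ∷ ys) (here x≈y) = ≤-trans (inj₂ x≈y) (≤-trans (x≤∣x∣ y)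
    (≤-resp (+-identityʳ _) ≈-refl (+-monoˡ-≤ ∣ y ∣ (absSum-nonneg ys))))
  member≤absSum (y ∷ ys) (there x∈) = ≤-trans (member≤absSum ys x∈)
    (≤-resp (+-identityˡ _) ≈-refl (+-monoʳ-≤ (absSum ys) (∣∣-nonneg y)))

  ≤-sum : ∀ {n} (f : Vector Carrier n) → (∀ i → 0# ≤ f i) → ∀ i → f i ≤ sum f
  ≤-sum f 0≤f zero    = ≤-resp (+-identityʳ _) ≈-refl (+-monoˡ-≤ (f zero) (sum-nonneg (0≤f ∘ suc)))
  ≤-sum f 0≤f (suc i) = ≤-trans (≤-sum (f ∘ suc) (0≤f ∘ suc) i) (≤-resp (+-identityˡ _) ≈-refl (+-monoʳ-≤ _ (0≤f zero)))

  coefficientsAt : ∀ {N} → Poly (suc N) → Point N → List Carrier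
  coefficientsAt ε       t = []
  coefficientsAt (p ▹ P) t = eval p t ∷ coefficientsAt P t

  degree : ∀ {N} → Poly (suc N) → ℕ
  degree ε       = 0
  degree (p ▹ P) = suc (degree P)

  length-coefficientsAt : ∀ {N} (P : Poly (suc N)) t → length (coefficientsAt P t) ≡ degree P
  length-coefficientsAt ε       t = refl
  length-coefficientsAt (p ▹ P) t = cong suc (length-coefficientsAt P t)

  eval-horner : ∀ {N} (P : Poly (suc N)) x t → eval P (x V.∷ t) ≈ horner (coefficientsAt P t) x
  eval-horner ε       x t = ≈-refl
  eval-horner (p ▹ P) x t = +-congˡ (*-congˡ (eval-horner P x t))

  -- The last component says that `eval c t` is an entry of `coefficientsAt P t`. The quantification
  -- over Q serves both uses: values that are nonzero, and values above a threshold.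
  nonZeroCoefficient : ∀ {N} {P : Poly (suc N)} → NonZeroᵖ P → Σ[ c ∈ Poly N ] NonZeroᵖ c ×
    (∀ (Q : Carrier → Set) t → Q (eval c t) → Any Q (coefficientsAt P t))
  nonZeroCoefficient (here {p = p} p≢0) = p , p≢0 , λ Q t q → here q
  nonZeroCoefficient (there P≢0) with nonZeroCoefficient P≢0
  ... | c , c≢0 , occurs = c , c≢0 , λ Q t q → there (occurs Q t q)

  -- By induction there is a t at which a chosen coefficient of every p i is nonzero. Each p i then
  -- has finitely many roots in the first variable over t, and x is put beyond the sum of the
  -- absolute values of all these roots.
  commonNonzero : ∀ {N m} (p : Fin m → Poly N) → (∀ i → NonZeroᵖ (p i)) → ∃[ t ] ∀ i → ¬ (eval (p i) t ≈ 0#)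
  commonNonzero {zero}  p p≢0 = V.[] , λ i → constant-nonzero (p≢0 i)
    where
    constant-nonzero : ∀ {p : Poly 0} → NonZeroᵖ p → ¬ (eval p V.[] ≈ 0#)
    constant-nonzero [ c≉0 ] = c≉0
  commonNonzero {suc N} {m} p p≢0 = x V.∷ t , λ i p≈0 → <⇒≱ (x<x+1 _) (≤-trans
      (member≤absSum (roots i) (proj₂ (allRoots i) x (trans (sym (eval-horner (p i) x t)) p≈0)))
      (≤-sum (absSum ∘ roots) (absSum-nonneg ∘ roots) i))
    where
    coeff : ∀ i → _
    coeff i = nonZeroCoefficient (p≢0 i)
    common : ∃[ t ] ∀ i → ¬ (eval (proj₁ (coeff i)) t ≈ 0#)
    common = commonNonzero (proj₁ ∘ coeff) (λ i → proj₁ (proj₂ (coeff i)))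
    t : Point N
    t = proj₁ common
    allRoots : ∀ i → ∃[ rs ] ∀ x → horner (coefficientsAt (p i) t) x ≈ 0# → Any (x ≈_) rs
    allRoots i = finitelyManyRoots _ (coefficientsAt (p i) t) ℕₚ.≤-refl
      (proj₂ (proj₂ (coeff i)) (λ c → ¬ (c ≈ 0#)) t (proj₂ common i))
    roots : Fin m → List Carrier
    roots = proj₁ ∘ allRoots
    x : Carrier
    x = sum (absSum ∘ roots) + 1#

  -- The box [0,1]ᴺ is divided into Mᴺ cells of side 1/M.
  InInterval : ∀ {M} → Fin M → Carrier → Set
  InInterval {M} k x = ι (toℕ k) ≤ ι M * x × ι M * x ≤ ι (suc (toℕ k))

  InCell : ∀ {N M} → Vec (Fin M) N → Point N → Set
  InCell k t = ∀ i → InInterval (lookup k i) (t i)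

  0<M : ∀ {M} → Fin M → 0# < ι M
  0<M {suc M} _ = ι-pos M

  interval⊆[0,1] : ∀ {M} (k : Fin M) {x} → InInterval k x → 0# ≤ x × x ≤ 1#
  interval⊆[0,1] k (lo , hi) =
    *-cancelˡ-≤ (0<M k) (≤-resp (sym (zeroʳ _)) ≈-refl (≤-trans (ι-nonneg (toℕ k)) lo)) ,
    *-cancelˡ-≤ (0<M k) (≤-resp ≈-refl (sym (*-identityʳ _)) (≤-trans hi (ι-mono-≤ (Finₚ.toℕ<n k))))

  window : ∀ {M} → ℕ → ℕ → List (Fin M)
  window         a zero    = []
  window {M} a (suc n) with a ℕₚ.<? M
  ... | yes a<M = fromℕ< a<M ∷ window (suc a) n
  ... | no  _   = window (suc a) n

  length-window : ∀ {M} a n → length (window {M} a n) ℕ.≤ n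
  length-window         a zero    = z≤n
  length-window {M} a (suc n) with a ℕₚ.<? M
  ... | yes a<M = s≤s (length-window (suc a) n)
  ... | no  _   = ℕₚ.m≤n⇒m≤1+n (length-window (suc a) n)

  ∈-window : ∀ {M} a n (k : Fin M) → a ℕ.≤ toℕ k → toℕ k ℕ.< a ℕ.+ n → k ∈ₗ window a n
  ∈-window a zero k a≤k k<a = ⊥-elim (ℕₚ.<⇒≱ k<a (subst (ℕ._≤ toℕ k) (≡.sym (ℕₚ.+-identityʳ a)) a≤k))
  ∈-window {M} a (suc n) k a≤k k< with a ℕₚ.<? M | ℕₚ.m≤n⇒m<n∨m≡n a≤k
  ... | yes a<M | inj₁ a<k = there (∈-window (suc a) n k a<k (subst (toℕ k ℕ.<_) (ℕₚ.+-suc a n) k<))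
  ... | yes a<M | inj₂ a≡k = here (Finₚ.toℕ-injective (≡.trans (≡.sym a≡k) (≡.sym (Finₚ.toℕ-fromℕ< a<M))))
  ... | no  _   | inj₁ a<k = ∈-window (suc a) n k a<k (subst (toℕ k ℕ.<_) (ℕₚ.+-suc a n) k<)
  ... | no  a≮M | inj₂ a≡k = ⊥-elim (a≮M (subst (ℕ._< M) (≡.sym a≡k) (Finₚ.toℕ<n k)))

  separated : ∀ {M} {k k′ : Fin M} {R x x′ s} → InInterval k x → InInterval k′ x′ → s * ι M ≤ ι R →
              toℕ k ℕ.+ R ℕ.< toℕ k′ → s ≤ x′ - x
  separated {M} {k} {k′} {R} {x} {x′} {s} (_ , Mx≤) (≤Mx′ , _) sM≤R k+R<k′ = *-cancelˡ-≤ (0<M k) (≤-trans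
    (≤-resp (*-comm _ _) ≈-refl sM≤R) (≤-resp
      (trans (+-congʳ (trans (reflexive (cong ι (≡.sym (ℕₚ.+-suc _ _)))) (trans (reflexive (cong ι (ℕₚ.+-suc (toℕ k) R)))
        (trans (reflexive (cong (λ z → ι (suc z)) (ℕₚ.+-comm (toℕ k) R))) (trans (reflexive (cong ι (≡.sym (ℕₚ.+-suc R (toℕ k))))) (ι-+ R (suc (toℕ k))))))))
        (solve 2 (λ r k → r :+ k :- k := r) ≈-refl (ι R) (ι (suc (toℕ k)))))
      (solve 3 (λ m x y → m :* y :- m :* x := m :* (y :- x)) ≈-refl (ι M) x x′)
      (+-mono-≤ (≤-trans (ι-mono-≤ k+R<k′) ≤Mx′) (-‿anti-≤ Mx≤))))

  -- A small value of q at r leaves, beyond distance s of r, only points at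
  -- which the quotient by x - r is small.
  fewSmallIntervals : ∀ m {η s} → 0# < η → 0# < s → ∃[ θ ] 0# < θ ×
    (∀ q → length q ℕ.≤ m → Any (λ c → η < ∣ c ∣) q → ∀ M R → s * ι M ≤ ι R →
      Σ[ ks ∈ List (Fin M) ] length ks ℕ.≤ m ℕ.* suc (R ℕ.+ R) ×
        (∀ k x → InInterval k x → ∣ horner q x ∣ ≤ θ → k ∈ₗ ks))
  fewSmallIntervals zero    0<η 0<s = 1# , 0<1 , λ { [] _ () ; (_ ∷ _) () _ }
  fewSmallIntervals (suc m) {η} {s} 0<η 0<s with fewSmallIntervals m (0<½* 0<η) 0<s
  -- The bound ½η ensures that the quotient keeps a coefficient above ½η. The bound ½sθ′ gives |q(x)
  -- - q(r)| ≤ sθ′, hence a quotient of size at most θ′ where |x - r| ≥ s. This θ depends on neither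
  -- q nor the grid.
  ... | θ′ , 0<θ′ , few with commonLower (0<½* 0<η) (0<½* (*-positive 0<s 0<θ′))
  ... | θ , 0<θ , θ≤½η , θ≤½sθ′ = θ , 0<θ , result
    where
    result : ∀ q → length q ℕ.≤ suc m → Any (λ c → η < ∣ c ∣) q → ∀ M R → s * ι M ≤ ι R →
      Σ[ ks ∈ List (Fin M) ] length ks ℕ.≤ suc m ℕ.* suc (R ℕ.+ R) ×
        (∀ k x → InInterval k x → ∣ horner q x ∣ ≤ θ → k ∈ₗ ks)
    result q q≤m large M R sM≤R with excludedMiddle (Σ[ k ∈ Fin M ] ∃[ x ] InInterval k x × ∣ horner q x ∣ ≤ θ)
    ... | no none = [] , z≤n , λ k x x∈k small → ⊥-elim (none (k , x , x∈k , small))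
    ... | yes (k₀ , r , r∈k₀ , q[r]≤θ) with few (quotient r q) (quotient-length r q q≤m)
            (anyLarge-quotient r q (≤-trans (inj₂ (∣∣-of-nonneg (proj₁ (interval⊆[0,1] k₀ r∈k₀)))) (proj₂ (interval⊆[0,1] k₀ r∈k₀)))
              (≤-trans q[r]≤θ θ≤½η) (Any.map (≤-<-trans (inj₂ (halve η))) large)) M R sM≤R
    ... | ks , ks≤ , complete = near ++ ks ,
        ℕₚ.≤-trans (ℕₚ.≤-reflexive (length-++ near {ks})) (ℕₚ.+-mono-≤ {length near} {suc (R ℕ.+ R)} {length ks} (length-window {M} (toℕ k₀ ∸ R) (suc (R ℕ.+ R))) ks≤) , covered
      where
      near : List (Fin M)
      near = window (toℕ k₀ ∸ R) (suc (R ℕ.+ R))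
      far : ∀ k x → InInterval k x → ∣ horner q x ∣ ≤ θ → s ≤ ∣ x - r ∣ → k ∈ₗ near ++ ks
      far k x x∈k small s≤ = ∈-++⁺ʳ near (complete k x x∈k (*-cancelˡ-≤ 0<s (≤-trans
        (*-monoʳ-≤ (∣∣-nonneg _) s≤) (≤-trans (inj₂ (trans (sym (∣xy∣ _ _)) (∣∣-cong (sym (quotient-spec r q x)))))
        (≤-trans (∣x-y∣≤ _ _) (≤-trans (+-mono-≤ (≤-trans small θ≤½sθ′) (≤-trans q[r]≤θ θ≤½sθ′)) (inj₂ (halve _))))))))
      covered : ∀ k x → InInterval k x → ∣ horner q x ∣ ≤ θ → k ∈ₗ near ++ ks
      covered k x x∈k small with toℕ k ℕ.+ R ℕₚ.<? toℕ k₀ | toℕ k₀ ℕ.+ R ℕₚ.<? toℕ k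
      ... | yes k+R<k₀ | _ = far k x x∈k small
              (≤-trans (separated x∈k r∈k₀ sM≤R k+R<k₀) (≤-trans (inj₂ (solve 2 (λ r x → r :- x := :- (x :- r)) ≈-refl r x)) (-x≤∣x∣ _)))
      ... | _ | yes k₀+R<k = far k x x∈k small (≤-trans (separated r∈k₀ x∈k sM≤R k₀+R<k) (x≤∣x∣ _))
      -- Here k is within R of k₀, hence among the 2R + 1 indices that start at k₀ ∸ R. When the
      -- subtraction is truncated the window starts at 0 and merely reaches further to the right.
      ... | no ≮₁ | no ≮₂ = ∈-++⁺ˡ (∈-window (toℕ k₀ ∸ R) _ k
              (ℕₚ.m≤n+o⇒m∸n≤o (toℕ k₀) R (subst (toℕ k₀ ℕ.≤_) (ℕₚ.+-comm (toℕ k) R) (ℕₚ.≮⇒≥ ≮₁)))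
              (subst (toℕ k ℕ.<_) (≡.sym (ℕₚ.+-suc _ _)) (s≤s (ℕₚ.≤-trans (ℕₚ.≮⇒≥ ≮₂)
                (subst (toℕ k₀ ℕ.+ R ℕ.≤_) (ℕₚ.+-assoc (toℕ k₀ ∸ R) R R)
                  (ℕₚ.+-monoˡ-≤ R (subst (toℕ k₀ ℕ.≤_) (ℕₚ.+-comm R _) (ℕₚ.m≤n+m∸n (toℕ k₀) R))))))))

  corner : ∀ {N M} → Vec (Fin M) N → Point N
  corner {M = M} k i = ι (toℕ (lookup k i)) * ι M ⁻¹

  M*M⁻¹ : ∀ {M} → Fin M → ∀ x → ι M * (x * ι M ⁻¹) ≈ x
  M*M⁻¹ k x = trans (solve 3 (λ m x i → m :* (x :* i) := x :* (m :* i)) ≈-refl _ x _)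
    (trans (*-congˡ (⁻¹-inverse (>⇒≉ (0<M k)))) (*-identityʳ x))

  corner∈cell : ∀ {N M} (k : Vec (Fin M) N) → InCell k (corner k)
  corner∈cell k i = inj₂ (sym (M*M⁻¹ (lookup k i) _)) ,
    ≤-trans (inj₂ (M*M⁻¹ (lookup k i) _)) (ι-mono-≤ (ℕₚ.n≤1+n (toℕ (lookup k i))))

  cell⊆box : ∀ {N M} (k : Vec (Fin M) N) {t} → InCell k t → Box t
  cell⊆box k t∈k i = interval⊆[0,1] (lookup k i) (t∈k i)

  near-corner : ∀ {N M} (k : Vec (Fin M) N) {t} → InCell k t → ∀ i → ∣ t i - corner k i ∣ ≤ ι M ⁻¹
  near-corner {M = M} k {t} t∈k i = ≤-trans (inj₂ (∣∣-of-nonneg (x≤y⇒0≤y-x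
      (*-cancelˡ-≤ 0<m (≤-trans (inj₂ (M*M⁻¹ (lookup k i) _)) (proj₁ (t∈k i)))))))
    (*-cancelˡ-≤ 0<m (≤-trans (inj₂ (trans (solve 3 (λ m x y → m :* (x :- y) := m :* x :- m :* y) ≈-refl (ι M) (t i) (corner k i)) (+-congˡ (-‿cong (M*M⁻¹ (lookup k i) _)))))
      (≤-trans (+-monoʳ-≤ _ (≤-trans (proj₂ (t∈k i)) (inj₂ (ι-suc (toℕ (lookup k i))))))
      (inj₂ (trans (solve 1 (λ k → k :+ :1 :- k := :1) ≈-refl (ι (toℕ (lookup k i)))) (sym (⁻¹-inverse (>⇒≉ 0<m))))))))
    where
    0<m : 0# < ι M
    0<m = 0<M (lookup k i)

  length-concatMap : ∀ {A B : Set} (f : A → List B) b xs → (∀ x → length (f x) ℕ.≤ b) → length (concatMap f xs) ℕ.≤ length xs ℕ.* b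
  length-concatMap f b []       f≤b = z≤n
  length-concatMap f b (x ∷ xs) f≤b = ℕₚ.≤-trans (ℕₚ.≤-reflexive (length-++ (f x))) (ℕₚ.+-mono-≤ (f≤b x) (length-concatMap f b xs f≤b))

  ∈-concatMap : ∀ {A B : Set} (f : A → List B) {xs x y} → x ∈ₗ xs → y ∈ₗ f x → y ∈ₗ concatMap f xs
  ∈-concatMap f x∈xs y∈fx = ∈-concatMap⁺ f (Any.map (λ { refl → y∈fx }) x∈xs)

  extensions : ∀ {A : Set} {N} → List A → Vec A N → List (Vec A (suc N))
  extensions as k = map (_∷ k) as

  allVecs : ∀ {A : Set} → List A → ∀ N → List (Vec A N)
  allVecs as zero    = [] ∷ []
  allVecs as (suc N) = concatMap (extensions as) (allVecs as N)

  length-allVecs : ∀ {A : Set} (as : List A) N → length (allVecs as N) ℕ.≤ length as ℕ.^ N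
  length-allVecs as zero    = ℕₚ.≤-refl
  length-allVecs as (suc N) = ℕₚ.≤-trans
    (length-concatMap (extensions as) (length as) (allVecs as N) (λ k → ℕₚ.≤-reflexive (length-map (_∷ k) as)))
    (ℕₚ.≤-trans (ℕₚ.*-monoˡ-≤ (length as) (length-allVecs as N)) (ℕₚ.≤-reflexive (ℕₚ.*-comm (length as ℕ.^ N) (length as))))

  ∈-allVecs : ∀ {A : Set} {as : List A} → (∀ a → a ∈ₗ as) → ∀ {N} (v : Vec A N) → v ∈ₗ allVecs as N
  ∈-allVecs all []      = here refl
  ∈-allVecs all (a ∷ v) = ∈-concatMap (extensions _) (∈-allVecs all v) (∈-map⁺ (_∷ v) (all a))

  private
    -- Each of the two families takes at most half of the allowance. The l abandoned columns have M
    -- cells each, and l ≤ Mᴺ / 2K. The other columns, at most Mᴺ, contribute m (2R + 1) ≤ 3mR cells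
    -- each, and R ≤ M / B with B ≥ 6mK.
    count : ∀ {K M m R B Mᴺ l l′ l″} → 6 ℕ.* (m ℕ.* K) ℕ.≤ B → 1 ℕ.≤ R → R ℕ.* B ℕ.≤ M →
            l ℕ.* (2 ℕ.* K) ℕ.≤ Mᴺ → l′ ℕ.≤ l ℕ.* M → l″ ℕ.≤ Mᴺ ℕ.* (m ℕ.* suc (R ℕ.+ R)) →
            (l′ ℕ.+ l″) ℕ.* K ℕ.≤ M ℕ.* Mᴺ
    count {K} {M} {m} {R} {B} {Mᴺ} {l} {l′} {l″} ≤B 1≤R RB≤M l≤ l′≤ l″≤ = ℕₚ.*-cancelˡ-≤ 2 (begin
      2 ℕ.* ((l′ ℕ.+ l″) ℕ.* K)
        ≤⟨ ℕₚ.*-monoʳ-≤ 2 (ℕₚ.*-monoˡ-≤ K (ℕₚ.+-mono-≤ l′≤ (ℕₚ.≤-trans l″≤ (ℕₚ.*-monoʳ-≤ Mᴺ (ℕₚ.*-monoʳ-≤ m (ℕₚ.+-monoˡ-≤ (R ℕ.+ R) 1≤R)))))) ⟩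
      2 ℕ.* ((l ℕ.* M ℕ.+ Mᴺ ℕ.* (m ℕ.* (R ℕ.+ (R ℕ.+ R)))) ℕ.* K)
        ≡⟨ +-*-Solver.solve 6 (λ l M N m R K → +-*-Solver.con 2 :*′ ((l :*′ M :+′ N :*′ (m :*′ (R :+′ (R :+′ R)))) :*′ K)
             :=′ (l :*′ (+-*-Solver.con 2 :*′ K)) :*′ M :+′ N :*′ (R :*′ (+-*-Solver.con 6 :*′ (m :*′ K)))) refl l M Mᴺ m R K ⟩
      l ℕ.* (2 ℕ.* K) ℕ.* M ℕ.+ Mᴺ ℕ.* (R ℕ.* (6 ℕ.* (m ℕ.* K)))
        ≤⟨ ℕₚ.+-mono-≤ (ℕₚ.*-monoˡ-≤ M l≤) (ℕₚ.*-monoʳ-≤ Mᴺ (ℕₚ.≤-trans (ℕₚ.*-monoʳ-≤ R ≤B) RB≤M)) ⟩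
      Mᴺ ℕ.* M ℕ.+ Mᴺ ℕ.* M
        ≡⟨ +-*-Solver.solve 2 (λ N M → N :*′ M :+′ N :*′ M :=′ +-*-Solver.con 2 :*′ (M :*′ N)) refl Mᴺ M ⟩
      2 ℕ.* (M ℕ.* Mᴺ) ∎)
      where
      open ℕₚ.≤-Reasoning
      open ℕSolver using (module +-*-Solver)
      open +-*-Solver using () renaming (_:*_ to _:*′_; _:+_ to _:+′_; _:=_ to _:=′_)

  euclid : ∀ b M → Σ[ R ∈ ℕ ] R ℕ.* suc b ℕ.≤ M × M ℕ.< suc R ℕ.* suc b
  euclid b M = M ℕ./ suc b , m/n*n≤m M (suc b) ,
    subst (ℕ._< suc (M ℕ./ suc b) ℕ.* suc b) (≡.sym (m≡m%n+[m/n]*n M (suc b))) (ℕₚ.+-monoˡ-< (M ℕ./ suc b ℕ.* suc b) (m%n<n M (suc b)))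

  -- R is the integer part of M / B. It is positive because B ≤ M, and so M < (R + 1) B ≤ 2RB. Thus
  -- the separation s = 1 / 2B, which is fixed before the grid is, spans at most R cells.
  gridScale : ∀ B M → 1 ℕ.≤ B → B ℕ.≤ M → Σ[ R ∈ ℕ ] 1 ℕ.≤ R × R ℕ.* B ℕ.≤ M × (2# * ι B) ⁻¹ * ι M ≤ ι R
  gridScale (suc b) M _ B≤M with euclid b M
  ... | zero  , _    , M<B      = ⊥-elim (ℕₚ.<⇒≱ M<B (ℕₚ.≤-trans (ℕₚ.≤-reflexive (ℕₚ.+-identityʳ (suc b))) B≤M))
  ... | suc r , RB≤M , M<[1+R]B = suc r , s≤s z≤n , RB≤M ,
      *-cancelˡ-≤ 0<2B (≤-trans (inj₂ (trans (sym (*-assoc _ _ _)) (trans (*-congʳ (⁻¹-inverse (>⇒≉ 0<2B))) (*-identityˡ _))))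
        (≤-trans (ι-mono-≤ {M} {(suc r ℕ.+ suc r) ℕ.* suc b} (ℕₚ.≤-trans (ℕₚ.<⇒≤ M<[1+R]B) (ℕₚ.*-monoˡ-≤ (suc b) (s≤s (ℕₚ.m≤n+m (suc r) r)))))
          (inj₂ (trans (ι-* (suc r ℕ.+ suc r) (suc b)) (trans (*-congʳ (ι-+ (suc r) (suc r)))
            (solve 2 (λ r b → (r :+ r) :* b := (:2 :* b) :* r) ≈-refl (ι (suc r)) (ι (suc b))))))))
    where
    0<2B : 0# < 2# * ι (suc b)
    0<2B = *-positive 0<2 (ι-pos b)

  -- The list holds at most a fraction 1/K of the cells and includes each cell that meets the set
  -- where |p| ≤ η.
  ThinAt : ∀ {N} → Poly N → ℕ → Carrier → ℕ → Set
  ThinAt {N} p K η M = Σ[ ks ∈ List (Vec (Fin M) N) ] length ks ℕ.* K ℕ.≤ M ℕ.^ N ×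
    (∀ k t → InCell k t → ∣ eval p t ∣ ≤ η → k ∈ₗ ks)

  -- A Fubini argument on the columns of cells that share all coordinates but the first. Where the
  -- coefficient c is small at the corner, the induction hypothesis lists the column and all its
  -- cells are given up. Elsewhere P restricted to the line through the corner has a coefficient
  -- above η, and few intervals carry small values.
  module ThinStep {N} (P : Poly (suc N)) (c : Poly N) {K M R : ℕ} {η θ L : Carrier}
    (occurs : ∀ t → η < ∣ eval c t ∣ → Any (λ c → η < ∣ c ∣) (coefficientsAt P t))
    (thin-c : ThinAt c (2 ℕ.* K) η M)
    (few : ∀ q → length q ℕ.≤ degree P → Any (λ c → η < ∣ c ∣) q →
      Σ[ js ∈ List (Fin M) ] length js ℕ.≤ degree P ℕ.* suc (R ℕ.+ R) ×
        (∀ j x → InInterval j x → ∣ horner q x ∣ ≤ θ → j ∈ₗ js))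
    (lip : LipschitzOn (eval P) L)
    (L/M≤½θ : 0# < ι M → L * ι M ⁻¹ ≤ ½ * θ)
    where

    ks : List (Vec (Fin M) N)
    ks = proj₁ thin-c

    columnWith : ∀ k → Σ[ js ∈ List (Fin M) ] length js ℕ.≤ degree P ℕ.* suc (R ℕ.+ R) × (k ∈ₗ ks ⊎
      (∀ j x → InInterval j x → ∣ horner (coefficientsAt P (corner k)) x ∣ ≤ θ → j ∈ₗ js))
    columnWith k with ≤-or-> ∣ eval c (corner k) ∣ η
    ... | inj₁ small = [] , z≤n , inj₁ (proj₂ (proj₂ thin-c) k (corner k) (corner∈cell k) small)
    ... | inj₂ large with few (coefficientsAt P (corner k)) (ℕₚ.≤-reflexive (length-coefficientsAt P (corner k))) (occurs (corner k) large)
    ... | js , js≤ , complete = js , js≤ , inj₂ complete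

    column : Vec (Fin M) N → List (Fin M)
    column k = proj₁ (columnWith k)

    fullColumns partialColumns : List (Vec (Fin M) (suc N))
    fullColumns    = concatMap (extensions (allFin M)) ks
    partialColumns = concatMap (λ k → extensions (column k) k) (allVecs (allFin M) N)

    length-fullColumns : length fullColumns ℕ.≤ length ks ℕ.* M
    length-fullColumns = length-concatMap (extensions (allFin M)) M ks
      λ k → ℕₚ.≤-reflexive (≡.trans (length-map (_∷ k) (allFin M)) (length-tabulate id))

    length-partialColumns : length partialColumns ℕ.≤ M ℕ.^ N ℕ.* (degree P ℕ.* suc (R ℕ.+ R))
    length-partialColumns = ℕₚ.≤-trans
      (length-concatMap (λ k → extensions (column k) k) (degree P ℕ.* suc (R ℕ.+ R)) (allVecs (allFin M) N)
        λ k → ℕₚ.≤-trans (ℕₚ.≤-reflexive (length-map (_∷ k) (column k))) (proj₁ (proj₂ (columnWith k))))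
      (ℕₚ.*-monoˡ-≤ (degree P ℕ.* suc (R ℕ.+ R)) (ℕₚ.≤-trans (length-allVecs (allFin M) N)
        (ℕₚ.≤-reflexive (cong (ℕ._^ N) (length-tabulate {n = M} id)))))

    module _ {j : Fin M} {k : Vec (Fin M) N} {t : Point (suc N)} (t∈ : InCell (j ∷ k) t) where
      -- Only the first coordinate of t is kept; the others move to the corner, over which the
      -- one-variable polynomial of the column is formed. The Lipschitz bound prices the move at L/M
      -- ≤ ½θ, and hence |P| ≤ ½θ at t becomes |P| ≤ θ at t′.
      t′ : Point (suc N)
      t′ = t zero V.∷ corner k

      0<M⁻¹ : 0# < ι M ⁻¹
      0<M⁻¹ = ⁻¹-pos (0<M j)

      t′∈box : Box t′
      t′∈box zero    = interval⊆[0,1] j (t∈ zero)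
      t′∈box (suc i) = cell⊆box k (corner∈cell k) i

      t′≈t : ∀ i → ∣ t′ i - t i ∣ ≤ ι M ⁻¹
      t′≈t zero    = ≤-trans (inj₂ (trans (∣∣-cong (-‿inverseʳ (t zero))) ∣0∣)) (inj₁ 0<M⁻¹)
      t′≈t (suc i) = ≤-trans (inj₂ (trans
        (∣∣-cong (solve 2 (λ x y → x :- y := :- (y :- x)) ≈-refl (corner k i) (t (suc i)))) (∣-x∣ _)))
        (near-corner k (t∈ ∘ suc) i)

      eval-near : ∣ eval P t ∣ ≤ ½ * θ → ∣ eval P t′ ∣ ≤ θ
      eval-near small = ≤-trans
        (inj₂ (∣∣-cong (solve 2 (λ a b → a := a :- b :+ b) ≈-refl (eval P t′) (eval P t))))
        (≤-trans (∣x+y∣≤ (eval P t′ - eval P t) (eval P t)) (≤-trans (+-mono-≤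
          (≤-trans (lip t′ t (ι M ⁻¹) t′∈box (cell⊆box (j ∷ k) t∈) (inj₁ 0<M⁻¹) t′≈t) (L/M≤½θ (0<M j))) small)
          (inj₂ (halve θ))))

      covered : ∣ eval P t ∣ ≤ ½ * θ → (j ∷ k) ∈ₗ fullColumns ++ partialColumns
      covered small with proj₂ (proj₂ (columnWith k))
      ... | inj₁ k∈ks     = ∈-++⁺ˡ (∈-concatMap (extensions (allFin M)) k∈ks (∈-map⁺ (_∷ k) (∈-allFin j)))
      ... | inj₂ complete = ∈-++⁺ʳ fullColumns (∈-concatMap (λ k → extensions (column k) k) (∈-allVecs ∈-allFin k)
        (∈-map⁺ (_∷ k) (complete j (t zero) (t∈ zero)
          (≤-trans (inj₂ (∣∣-cong (sym (eval-horner P (t zero) (corner k))))) (eval-near small)))))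

    thinAt : ∀ {B} → 6 ℕ.* (degree P ℕ.* K) ℕ.≤ B → 1 ℕ.≤ R → R ℕ.* B ℕ.≤ M → ThinAt P K (½ * θ) M
    thinAt ≤B 1≤R RB≤M = fullColumns ++ partialColumns ,
      ℕₚ.≤-trans (ℕₚ.≤-reflexive (cong (ℕ._* K) (length-++ fullColumns {partialColumns})))
        (count {K} {M} {degree P} {R} {l = length ks} ≤B 1≤R RB≤M (proj₁ (proj₂ thin-c)) length-fullColumns length-partialColumns) ,
      λ { (j ∷ k) t t∈ small → covered {j} {k} {t} t∈ small }

  private
    L/M≤½θ : ∀ {L θ m} → 0# < θ → L * (½ * θ) ⁻¹ ≤ m → 0# < m → L * m ⁻¹ ≤ ½ * θ
    L/M≤½θ {L} {θ} {m} 0<θ L≤m 0<m = *-cancelˡ-≤ 0<m (≤-trans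
      (inj₂ (trans (solve 3 (λ m l i → m :* (l :* i) := l :* (m :* i)) ≈-refl m L (m ⁻¹))
        (trans (*-congˡ (⁻¹-inverse (>⇒≉ 0<m))) (*-identityʳ L))))
      (≤-trans (inj₂ (sym (trans (*-assoc L ((½ * θ) ⁻¹) (½ * θ))
          (trans (*-congˡ (trans (*-comm _ _) (⁻¹-inverse (>⇒≉ (0<½* 0<θ))))) (*-identityʳ L)))))
        (*-monoʳ-≤ (inj₁ (0<½* 0<θ)) L≤m)))

    0<s : ∀ {B} → 1 ℕ.≤ B → 0# < (2# * ι B) ⁻¹
    0<s 1≤B = ⁻¹-pos (*-positive 0<2 (<-resp ι-zero ≈-refl (ι-mono-< 1≤B)))

    thinStep : ∀ {N} (P : Poly (suc N)) (c : Poly N) K {η M₁ B L} → 0# < η →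
      (∀ t → η < ∣ eval c t ∣ → Any (λ c → η < ∣ c ∣) (coefficientsAt P t)) →
      (∀ M → M₁ ℕ.≤ M → ThinAt c (2 ℕ.* K) η M) →
      LipschitzOn (eval P) L →
      1 ℕ.≤ B → 6 ℕ.* (degree P ℕ.* K) ℕ.≤ B → ∃[ η ] 0# < η × ∃[ M₀ ] ∀ M → M₀ ℕ.≤ M → ThinAt P K η M
    -- The threshold for M joins three demands: M₁ for the induction hypothesis, M₂ for L/M ≤ ½θ,
    -- and B for the existence of a positive R.
    thinStep {N} P c K {η} {M₁} {B} {L} 0<η occurs thin-c lip 1≤B ≤B = ½ * θ , 0<½* 0<θ , M₁ ℕ.+ M₂ ℕ.+ B , main
      where
      fewP = fewSmallIntervals (degree P) 0<η (0<s 1≤B)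
      θ : Carrier
      θ = proj₁ fewP
      0<θ : 0# < θ
      0<θ = proj₁ (proj₂ fewP)
      arch : ∃[ n ] L * (½ * θ) ⁻¹ ≤ ι n
      arch = archimedean (L * (½ * θ) ⁻¹)
      M₂ : ℕ
      M₂ = proj₁ arch
      main : ∀ M → M₁ ℕ.+ M₂ ℕ.+ B ℕ.≤ M → ThinAt P K (½ * θ) M
      main M M≥ = step (gridScale B M 1≤B (ℕₚ.≤-trans (ℕₚ.m≤n+m B (M₁ ℕ.+ M₂)) M≥))
        where
        step : Σ[ R ∈ ℕ ] 1 ℕ.≤ R × R ℕ.* B ℕ.≤ M × (2# * ι B) ⁻¹ * ι M ≤ ι R → ThinAt P K (½ * θ) M
        step (R , 1≤R , RB≤M , sM≤R) = ThinStep.thinAt P c {K} {M} {R} {η} {θ} {L} occurs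
          (thin-c M (ℕₚ.≤-trans (ℕₚ.≤-trans (ℕₚ.m≤m+n M₁ M₂) (ℕₚ.m≤m+n _ B)) M≥))
          (λ q q≤m large → proj₂ (proj₂ fewP) q q≤m large M R sM≤R) lip
          (L/M≤½θ 0<θ (≤-trans (proj₂ arch) (ι-mono-≤ (ℕₚ.≤-trans (ℕₚ.≤-trans (ℕₚ.m≤n+m M₂ M₁) (ℕₚ.m≤m+n _ B)) M≥))))
          {B} ≤B 1≤R RB≤M

  thin : ∀ {N} (p : Poly N) → NonZeroᵖ p → ∀ K → ∃[ η ] 0# < η × ∃[ M₀ ] ∀ M → M₀ ℕ.≤ M → ThinAt p K η M
  thin [ c ] [ c≉0 ] K = ½ * ∣ c ∣ , 0<½* (∣∣≉0 c≉0) , 0 , λ M _ → [] , z≤n , λ _ _ _ ∣c∣≤ → ⊥-elim (<⇒≱ (½*x<x (∣∣≉0 c≉0)) ∣c∣≤)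
  thin {suc N} P P≢0 K with nonZeroCoefficient P≢0
  ... | c , c≢0 , occurs with thin c c≢0 (2 ℕ.* K) | eval-lipschitz P
  ... | η , 0<η , M₁ , thin-c | L , _ , lip =
    thinStep P c K 0<η (occurs (λ c → η < ∣ c ∣)) thin-c lip (s≤s z≤n) (ℕₚ.n≤1+n (6 ℕ.* (degree P ℕ.* K)))

  -- Charts of the orthogonal group

  ⟨⟩-cong : ∀ {n} {x x′ y y′ : Point n} → (∀ i → x i ≈ x′ i) → (∀ i → y i ≈ y′ i) → ⟨ x , y ⟩ ≈ ⟨ x′ , y′ ⟩
  ⟨⟩-cong x≈ y≈ = sum-cong λ i → *-cong (x≈ i) (y≈ i)

  ⟨⟩-comm : ∀ {n} (x y : Point n) → ⟨ x , y ⟩ ≈ ⟨ y , x ⟩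
  ⟨⟩-comm x y = sum-cong λ i → *-comm (x i) (y i)

  ⟨⟩-addˡ : ∀ {n} (x y z : Point n) → ⟨ (λ i → x i + y i) , z ⟩ ≈ ⟨ x , z ⟩ + ⟨ y , z ⟩
  ⟨⟩-addˡ x y z = trans (sum-cong λ i → distribʳ (z i) (x i) (y i)) (∑-distrib-+ (λ i → x i * z i) (λ i → y i * z i))

  ⟨⟩-scaleˡ : ∀ {n} c (x z : Point n) → ⟨ (λ i → c * x i) , z ⟩ ≈ c * ⟨ x , z ⟩
  ⟨⟩-scaleˡ c x z = trans (sum-cong λ i → *-assoc c (x i) (z i)) (sum-scaleˡ c (λ i → x i * z i))

  ⟨⟩-sumˡ : ∀ {m n} (v : Fin m → Point n) z → ⟨ (λ k → sum λ i → v i k) , z ⟩ ≈ sum (λ i → ⟨ v i , z ⟩)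
  ⟨⟩-sumˡ v z = trans (sum-cong λ k → *-distribʳ-sum (z k) (λ i → v i k)) (∑-comm (λ k i → v i k * z k))

  ⟨⟩-combˡ : ∀ {m n} (b : Point m) (v : Fin m → Point n) z → ⟨ (λ k → sum λ i → b i * v i k) , z ⟩ ≈ sum (λ i → b i * ⟨ v i , z ⟩)
  ⟨⟩-combˡ b v z = trans (⟨⟩-sumˡ (λ i k → b i * v i k) z) (sum-cong λ i → ⟨⟩-scaleˡ (b i) (v i) z)

  ⟨⟩-addʳ : ∀ {n} (z x y : Point n) → ⟨ z , (λ i → x i + y i) ⟩ ≈ ⟨ z , x ⟩ + ⟨ z , y ⟩
  ⟨⟩-addʳ z x y = trans (⟨⟩-comm z _) (trans (⟨⟩-addˡ x y z) (+-cong (⟨⟩-comm x z) (⟨⟩-comm y z)))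

  ⟨⟩-scaleʳ : ∀ {n} c (z x : Point n) → ⟨ z , (λ i → c * x i) ⟩ ≈ c * ⟨ z , x ⟩
  ⟨⟩-scaleʳ c z x = trans (⟨⟩-comm z _) (trans (⟨⟩-scaleˡ c x z) (*-congˡ (⟨⟩-comm x z)))

  ⟨⟩-combʳ : ∀ {m n} z (b : Point m) (v : Fin m → Point n) → ⟨ z , (λ k → sum λ i → b i * v i k) ⟩ ≈ sum (λ i → b i * ⟨ z , v i ⟩)
  ⟨⟩-combʳ z b v = trans (⟨⟩-comm z _) (trans (⟨⟩-combˡ b v z) (sum-cong λ i → *-congˡ {b i} (⟨⟩-comm (v i) z)))

  ⟨⟩-nonneg : ∀ {n} (x : Point n) → 0# ≤ ⟨ x , x ⟩
  ⟨⟩-nonneg x = sum-nonneg λ i → sq-nonneg (x i)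

  coordinate²≤ : ∀ {n} (x : Point n) i → x i * x i ≤ ⟨ x , x ⟩
  coordinate²≤ x = ≤-sum (λ i → x i * x i) (λ i → sq-nonneg (x i))

  identity-suc : ∀ {n} (i j : Fin n) → identity (suc i) (suc j) ≡ identity i j
  identity-suc i j with does (i ≟ j)
  ... | true  = refl
  ... | false = refl

  sum-identityˡ : ∀ {n} (i : Fin n) (y : Point n) → sum (λ j → y j * identity i j) ≈ y i
  sum-identityˡ {suc n} zero    y = trans (+-cong (*-identityʳ (y zero)) (sum-zero {n} λ j → zeroʳ (y (suc j)))) (+-identityʳ _)
  sum-identityˡ {suc n} (suc i) y = trans (+-cong (zeroʳ (y zero))
    (trans (sum-cong {n} λ j → *-congˡ (reflexive (identity-suc i j))) (sum-identityˡ i (y ∘ suc)))) (+-identityˡ _)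

  column : ∀ {m n} → (Fin m → Point n) → Fin n → Point m
  column A j i = A i j

  Orthonormal : ∀ {m n} → (Fin m → Point n) → Set
  Orthonormal A = ∀ i j → ⟨ column A i , column A j ⟩ ≈ identity i j

  ·-as-combination : ∀ {n} (A : Matrix n) x k → (A · x) k ≈ sum (λ i → x i * column A i k)
  ·-as-combination A x k = ⟨⟩-comm (A k) x

  orthonormal-isometry : ∀ {n} (A : Matrix n) → Orthonormal A → ∀ x y → ⟨ A · x , A · y ⟩ ≈ ⟨ x , y ⟩
  orthonormal-isometry A orth x y = begin
    ⟨ A · x , A · y ⟩                                          ≈⟨ ⟨⟩-cong (·-as-combination A x) (λ k → ≈-refl {(A · y) k}) ⟩
    ⟨ (λ k → sum λ i → x i * column A i k) , A · y ⟩           ≈⟨ ⟨⟩-combˡ x (column A) (A · y) ⟩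
    sum (λ i → x i * ⟨ column A i , A · y ⟩)                   ≈⟨ sum-cong (λ i → *-congˡ (inner i)) ⟩
    ⟨ x , y ⟩                                                  ∎
    where
    open ER
    inner : ∀ i → ⟨ column A i , A · y ⟩ ≈ y i
    inner i = begin
      ⟨ column A i , A · y ⟩                                   ≈⟨ ⟨⟩-cong (λ k → ≈-refl {column A i k}) (·-as-combination A y) ⟩
      ⟨ column A i , (λ k → sum λ j → y j * column A j k) ⟩    ≈⟨ ⟨⟩-combʳ (column A i) y (column A) ⟩
      sum (λ j → y j * ⟨ column A i , column A j ⟩)            ≈⟨ sum-cong (λ j → *-congˡ (orth i j)) ⟩
      sum (λ j → y j * identity i j)                           ≈⟨ sum-identityˡ i y ⟩
      y i                                                      ∎

  ·-cong : ∀ {n} {A A′ : Matrix n} {x x′ : Point n} → (∀ i j → A i j ≈ A′ i j) → (∀ i → x i ≈ x′ i) → ∀ i → (A · x) i ≈ (A′ · x′) i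
  ·-cong A≈ x≈ i = ⟨⟩-cong (A≈ i) x≈

  reflect : ∀ {n} → Point n → Point n → Point n
  reflect u x i = x i - 2# * ⟨ u , u ⟩ ⁻¹ * ⟨ u , x ⟩ * u i

  reflect-cong : ∀ {n} (u : Point n) {x y : Point n} → (∀ i → x i ≈ y i) → ∀ i → reflect u x i ≈ reflect u y i
  reflect-cong u x≈y i = +-cong (x≈y i) (-‿cong (*-congʳ (*-congˡ (⟨⟩-cong (λ k → ≈-refl {u k}) x≈y))))

  ⟨reflect⟩ʳ : ∀ {n} (u x z : Point n) → ⟨ z , reflect u x ⟩ ≈ ⟨ z , x ⟩ - 2# * ⟨ u , u ⟩ ⁻¹ * ⟨ u , x ⟩ * ⟨ z , u ⟩
  ⟨reflect⟩ʳ u x z = trans (⟨⟩-cong (λ i → ≈-refl {z i}) (λ i → +-congˡ (-‿distribˡ-* c (u i))))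
    (trans (⟨⟩-addʳ z x (λ i → - c * u i)) (+-congˡ (trans (⟨⟩-scaleʳ (- c) z u) (sym (-‿distribˡ-* c ⟨ z , u ⟩)))))
    where
    c : Carrier
    c = 2# * ⟨ u , u ⟩ ⁻¹ * ⟨ u , x ⟩

  module _ {n} (u : Point n) (u≉0 : ¬ (⟨ u , u ⟩ ≈ 0#)) where
    private
      γ = ⟨ u , u ⟩ ⁻¹

    γ*⟨u,u⟩ : γ * ⟨ u , u ⟩ ≈ 1#
    γ*⟨u,u⟩ = trans (*-comm γ ⟨ u , u ⟩) (⁻¹-inverse u≉0)

    reflect-normal : ∀ x → ⟨ u , reflect u x ⟩ ≈ - ⟨ u , x ⟩
    reflect-normal x = trans (⟨reflect⟩ʳ u x u) (trans
      (solve 3 (λ p γ g → p :- :2 :* γ :* p :* g := p :- :2 :* p :* (γ :* g)) ≈-refl ⟨ u , x ⟩ γ ⟨ u , u ⟩)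
      (trans (+-congˡ (-‿cong (*-congˡ γ*⟨u,u⟩))) (solve 1 (λ p → p :- :2 :* p :* :1 := :- p) ≈-refl ⟨ u , x ⟩)))

    reflect-involutive : ∀ x i → reflect u (reflect u x) i ≈ x i
    reflect-involutive x i = trans (+-congˡ (-‿cong (*-congʳ (*-congˡ (reflect-normal x)))))
      (solve 4 (λ x γ p u → x :- :2 :* γ :* p :* u :- :2 :* γ :* (:- p) :* u := x) ≈-refl (x i) γ ⟨ u , x ⟩ (u i))

    reflect-isometry : ∀ x y → ⟨ reflect u x , reflect u y ⟩ ≈ ⟨ x , y ⟩
    reflect-isometry x y = trans (⟨reflect⟩ʳ u y (reflect u x)) (trans
      (+-cong (trans (⟨⟩-comm (reflect u x) y) (⟨reflect⟩ʳ u x y))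
        (-‿cong (*-congˡ (trans (⟨⟩-comm (reflect u x) u) (reflect-normal x)))))
      (trans (+-cong (+-cong (⟨⟩-comm y x) (-‿cong (*-congˡ (⟨⟩-comm y u)))) ≈-refl)
      (solve 4 (λ a γ p q → a :- :2 :* γ :* p :* q :- :2 :* γ :* q :* (:- p) := a) ≈-refl ⟨ x , y ⟩ γ ⟨ u , x ⟩ ⟨ u , y ⟩)))

  sgn : Bool → Carrier
  sgn true  = 1#
  sgn false = - 1#

  sgn² : ∀ s → sgn s * sgn s ≈ 1#
  sgn² true  = *-identityˡ 1#
  sgn² false = solve 0 ((:- :1) :* (:- :1) := :1) ≈-refl

  sgn-not : ∀ s → sgn (not s) ≈ - sgn s
  sgn-not true  = ≈-refl
  sgn-not false = solve 0 (:1 := :- (:- :1)) ≈-refl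

  block : ∀ {n} → Matrix n → Matrix (suc n)
  block A zero    zero    = 1#
  block A zero    (suc j) = 0#
  block A (suc i) zero    = 0#
  block A (suc i) (suc j) = A i j

  -- One vector t for each reflection of the chart.
  Params : ℕ → Set
  Params zero    = ⊤
  Params (suc n) = Point n × Params n

  axis : ∀ {n} → Point n → Point (suc n)
  axis t = 1# V.∷ t

  chart : ∀ {n} → Vec Bool n → Params n → Matrix n
  chart (s ∷ ss) (t , ts) i j = sgn s * reflect (axis t) (column (block (chart ss ts)) j) i

  1≤axis : ∀ {n} (t : Point n) → 1# ≤ ⟨ axis t , axis t ⟩
  1≤axis t = ≤-resp (trans (+-identityʳ _) (*-identityˡ 1#)) ≈-refl (+-monoˡ-≤ (1# * 1#) (⟨⟩-nonneg t))

  axis≉0 : ∀ {n} (t : Point n) → ¬ (⟨ axis t , axis t ⟩ ≈ 0#)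
  axis≉0 t = >⇒≉ (0<of1≤ (1≤axis t))

  block-orthonormal : ∀ {n} {A : Matrix n} → Orthonormal A → Orthonormal (block A)
  block-orthonormal {n} orth zero    zero    = trans (+-cong (*-identityˡ 1#) (sum-zero {n} λ k → zeroˡ 0#)) (+-identityʳ 1#)
  block-orthonormal {n} orth zero    (suc j) = trans (+-cong (zeroʳ 1#) (sum-zero {n} λ k → zeroˡ _)) (+-identityʳ 0#)
  block-orthonormal {n} orth (suc i) zero    = trans (+-cong (zeroˡ 1#) (sum-zero {n} λ k → zeroʳ _)) (+-identityʳ 0#)
  block-orthonormal orth (suc i) (suc j) = trans (+-cong (zeroˡ 0#) (orth i j))
    (trans (+-identityˡ _) (reflexive (≡.sym (identity-suc i j))))

  chart-orthonormal : ∀ {n} (ss : Vec Bool n) ts → Orthonormal (chart ss ts)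
  chart-orthonormal (s ∷ ss) (t , ts) i j = begin
    ⟨ (λ k → sgn s * x k) , (λ k → sgn s * y k) ⟩   ≈⟨ ⟨⟩-scaleˡ (sgn s) x (λ k → sgn s * y k) ⟩
    sgn s * ⟨ x , (λ k → sgn s * y k) ⟩             ≈⟨ *-congˡ (⟨⟩-scaleʳ (sgn s) x y) ⟩
    sgn s * (sgn s * ⟨ x , y ⟩)                     ≈⟨ *-assoc (sgn s) (sgn s) _ ⟨
    sgn s * sgn s * ⟨ x , y ⟩                       ≈⟨ *-cong (sgn² s) (reflect-isometry (axis t) (axis≉0 t) (column B i) (column B j)) ⟩
    1# * ⟨ column B i , column B j ⟩                ≈⟨ *-identityˡ _ ⟩
    ⟨ column B i , column B j ⟩                     ≈⟨ block-orthonormal (chart-orthonormal ss ts) i j ⟩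
    identity i j                                    ∎
    where
    open ER
    B = block (chart ss ts)
    x = reflect (axis t) (column B i)
    y = reflect (axis t) (column B j)

  block-· : ∀ {n} (A : Matrix n) w i → (block A · w) i ≈ (head w V.∷ (A · tail w)) i
  block-· {n} A w zero    = trans (+-cong (*-identityˡ (head w)) (sum-zero {n} λ j → zeroˡ (w (suc j)))) (+-identityʳ _)
  block-· A w (suc i) = trans (+-cong (zeroˡ (head w)) ≈-refl) (+-identityˡ _)

  chart-· : ∀ {n} s (ss : Vec Bool n) t ts w i →
            (chart (s ∷ ss) (t , ts) · w) i ≈ sgn s * reflect (axis t) (head w V.∷ (chart ss ts · tail w)) i
  chart-· {n} s ss t ts w i = begin
    sum (λ j → sgn s * reflect u (column B j) i * w j)
      ≈⟨ sum-cong {suc n} (λ j → solve 6 (λ s b γ p u w → s :* (b :- :2 :* γ :* p :* u) :* w := s :* (b :* w :+ (:- (:2 :* γ :* u)) :* (w :* p)))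
           ≈-refl (sgn s) (B i j) γ ⟨ u , column B j ⟩ (u i) (w j)) ⟩
    sum (λ j → sgn s * (B i j * w j + - (2# * γ * u i) * (w j * ⟨ u , column B j ⟩)))
      ≈⟨ sum-scaleˡ {suc n} (sgn s) (λ j → B i j * w j + - (2# * γ * u i) * (w j * ⟨ u , column B j ⟩)) ⟩
    sgn s * sum (λ j → B i j * w j + - (2# * γ * u i) * (w j * ⟨ u , column B j ⟩))
      ≈⟨ *-congˡ (trans (∑-distrib-+ {suc n} (λ j → B i j * w j) (λ j → - (2# * γ * u i) * (w j * ⟨ u , column B j ⟩))) (+-congˡ (sum-scaleˡ {suc n} (- (2# * γ * u i)) (λ j → w j * ⟨ u , column B j ⟩)))) ⟩
    sgn s * ((B · w) i + - (2# * γ * u i) * sum (λ j → w j * ⟨ u , column B j ⟩))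
      ≈⟨ *-congˡ (+-congˡ (*-congˡ (trans (sym (⟨⟩-combʳ u w (column B))) (⟨⟩-cong (λ k → ≈-refl {u k}) (λ k → sym (·-as-combination B w k)))))) ⟩
    sgn s * ((B · w) i + - (2# * γ * u i) * ⟨ u , B · w ⟩)
      ≈⟨ solve 5 (λ s z γ p u → s :* (z :+ (:- (:2 :* γ :* u)) :* p) := s :* (z :- :2 :* γ :* p :* u)) ≈-refl (sgn s) ((B · w) i) γ ⟨ u , B · w ⟩ (u i) ⟩
    sgn s * reflect u (B · w) i
      ≈⟨ *-congˡ (reflect-cong u (block-· (chart ss ts) w) i) ⟩
    sgn s * reflect u (head w V.∷ (chart ss ts · tail w)) i ∎
    where
    open ER
    B = block (chart ss ts)
    u = axis t
    γ = ⟨ u , u ⟩ ⁻¹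

  ⁻¹-cong : ∀ {x y} → ¬ (x ≈ 0#) → x ≈ y → x ⁻¹ ≈ y ⁻¹
  ⁻¹-cong {x} {y} x≉0 x≈y = *-cancel x≉0 (trans (⁻¹-inverse x≉0)
    (sym (trans (*-congʳ x≈y) (⁻¹-inverse λ y≈0 → x≉0 (trans x≈y y≈0)))))

  _≈ᴾ_ : ∀ {n} → Params n → Params n → Set
  _≈ᴾ_ {zero}  _        _          = ⊤
  _≈ᴾ_ {suc n} (t , ts) (t′ , ts′) = (∀ i → t i ≈ t′ i) × ts ≈ᴾ ts′

  block-cong : ∀ {n} {A A′ : Matrix n} → (∀ i j → A i j ≈ A′ i j) → ∀ i j → block A i j ≈ block A′ i j
  block-cong A≈ zero    zero    = ≈-refl
  block-cong A≈ zero    (suc j) = ≈-refl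
  block-cong A≈ (suc i) zero    = ≈-refl
  block-cong A≈ (suc i) (suc j) = A≈ i j

  chart-cong : ∀ {n} (ss : Vec Bool n) {ts ts′} → ts ≈ᴾ ts′ → ∀ i j → chart ss ts i j ≈ chart ss ts′ i j
  chart-cong (s ∷ ss) {t , ts} {t′ , ts′} (t≈ , ts≈) i j = *-congˡ (+-cong (B≈ i j) (-‿cong (*-cong (*-cong
      (*-congˡ (⁻¹-cong (axis≉0 t) (⟨⟩-cong u≈ u≈))) (⟨⟩-cong u≈ (λ k → B≈ k j))) (u≈ i))))
    where
    B≈ = block-cong (chart-cong ss ts≈)
    u≈ : ∀ k → axis t k ≈ axis t′ k
    u≈ zero    = ≈-refl
    u≈ (suc k) = t≈ k

  RationalParams : ∀ {N n} → (Point N → Params n) → Set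
  RationalParams {n = zero}  P = ⊤
  RationalParams {n = suc n} P = (∀ k → IsRat (λ x → proj₁ (P x) k)) × RationalParams (proj₂ ∘ P)

  chart-rational : ∀ {N n} (ss : Vec Bool n) (P : Point N → Params n) → RationalParams P → ∀ i j → IsRat (λ x → chart ss (P x) i j)
  chart-rational {N} (s ∷ ss) P (t-rat , ts-rat) i j = products (constants (sgn s)) (differences (B-rat i j)
      (products (products (products (constants 2#) (isRat-⁻¹ (λ x → 1≤axis (proj₁ (P x)))
          (finiteSums {f = λ k x → axis (proj₁ (P x)) k * axis (proj₁ (P x)) k} λ k → products (u-rat k) (u-rat k))))
        (finiteSums {f = λ k x → axis (proj₁ (P x)) k * block (chart ss (proj₂ (P x))) k j} λ k → products (u-rat k) (B-rat k j))) (u-rat i)))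
    where
    open Closed (isRat-closed {N})
    u-rat : ∀ k → IsRat (λ x → axis (proj₁ (P x)) k)
    u-rat zero    = constants 1#
    u-rat (suc k) = t-rat k
    B-rat : ∀ i j → IsRat (λ x → block (chart ss (proj₂ (P x))) i j)
    B-rat zero    zero    = constants 1#
    B-rat zero    (suc j) = constants 0#
    B-rat (suc i) zero    = constants 0#
    B-rat (suc i) (suc j) = chart-rational ss (proj₂ ∘ P) ts-rat i j

  BoundedParams : ∀ {n} → Params n → Set
  BoundedParams {zero}  _        = ⊤
  BoundedParams {suc n} (t , ts) = (∀ k → ∣ t k ∣ ≤ 1#) × BoundedParams ts

  oppositeSign : ∀ x → ∃[ s ] sgn s * x ≤ 0#
  oppositeSign x with ≤-or-> 0# x
  ... | inj₁ 0≤x = false , ≤-resp (solve 1 (λ x → :- x := (:- :1) :* x) ≈-refl x) -0#≈0# (-‿anti-≤ 0≤x)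
  ... | inj₂ x<0 = true  , ≤-resp (sym (*-identityˡ x)) ≈-refl (inj₁ x<0)

  -- The reflection along u exchanges s x₀ and the first basis vector, where x₀
  -- is the first column of ρ; the sign s keeps u away from infinity.
  module Peel {n} (ρ : Matrix (suc n)) (orth : Orthonormal ρ) (s : Bool) (sx≤0 : sgn s * ρ zero zero ≤ 0#) where
    σ : Carrier
    σ = sgn s
    x : Point (suc n)
    x = column ρ zero
    h : Carrier
    h = 1# - σ * x zero
    1≤h : 1# ≤ h
    1≤h = ≤-resp (solve 0 (:1 :- :0 := :1) ≈-refl) ≈-refl (+-monoˡ-≤ 1# (-‿anti-≤ sx≤0))
    0<h : 0# < h
    0<h = 0<of1≤ 1≤h
    -- The vector from y = σ x to the first basis vector, divided by its first coordinate h so as to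
    -- have the form (1, t).
    t : Point n
    t k = - (σ * x (suc k)) * h ⁻¹
    u : Point (suc n)
    u = axis t
    y : Point (suc n)
    y i = σ * x i

    e₀-y : Point (suc n)
    e₀-y i = identity zero i + (- 1#) * y i

    h*u : ∀ i → h * u i ≈ e₀-y i
    h*u zero    = solve 2 (λ s x → (:1 :- s :* x) :* :1 := :1 :+ (:- :1) :* (s :* x)) ≈-refl σ (x zero)
    h*u (suc k) = trans (solve 3 (λ h y i → h :* ((:- y) :* i) := (:- y) :* (h :* i)) ≈-refl h (y (suc k)) (h ⁻¹))
      (trans (*-congˡ (⁻¹-inverse (>⇒≉ 0<h))) (solve 1 (λ y → (:- y) :* :1 := :0 :+ (:- :1) :* y) ≈-refl (y (suc k))))

    ⟨e₀,⟩ : ∀ (z : Point (suc n)) → ⟨ (λ i → identity zero i) , z ⟩ ≈ z zero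
    ⟨e₀,⟩ z = trans (⟨⟩-comm (identity zero) z) (sum-identityˡ zero z)

    ⟨y,y⟩ : ⟨ y , y ⟩ ≈ 1#
    ⟨y,y⟩ = trans (⟨⟩-scaleˡ σ x y) (trans (*-congˡ (⟨⟩-scaleʳ σ x x)) (trans (sym (*-assoc σ σ _))
      (trans (*-cong (sgn² s) (orth zero zero)) (*-identityˡ 1#))))

    ⟨e₀-y,y⟩ : ⟨ e₀-y , y ⟩ ≈ - h
    ⟨e₀-y,y⟩ = trans (⟨⟩-addˡ (identity zero) (λ i → (- 1#) * y i) y)
      (trans (+-cong (⟨e₀,⟩ y) (trans (⟨⟩-scaleˡ (- 1#) y y) (*-congˡ ⟨y,y⟩)))
      (solve 1 (λ y → y :+ (:- :1) :* :1 := :- (:1 :- y)) ≈-refl (y zero)))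

    ⟨u,y⟩ : ⟨ u , y ⟩ ≈ - 1#
    ⟨u,y⟩ = *-cancel (>⇒≉ 0<h) (trans (sym (⟨⟩-scaleˡ h u y)) (trans (⟨⟩-cong h*u (λ i → ≈-refl {y i}))
      (trans ⟨e₀-y,y⟩ (solve 1 (λ h → :- h := h :* (:- :1)) ≈-refl h))))

    h*⟨u,u⟩ : h * ⟨ u , u ⟩ ≈ 2#
    h*⟨u,u⟩ = trans (sym (⟨⟩-scaleˡ h u u)) (trans (⟨⟩-cong h*u (λ i → ≈-refl {u i}))
      (trans (⟨⟩-addˡ (identity zero) (λ i → (- 1#) * y i) u)
      (trans (+-cong (⟨e₀,⟩ u) (trans (⟨⟩-scaleˡ (- 1#) y u) (*-congˡ (trans (⟨⟩-comm y u) ⟨u,y⟩))))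
      (solve 0 (:1 :+ (:- :1) :* (:- :1) := :2) ≈-refl))))

    2γ≈h : 2# * ⟨ u , u ⟩ ⁻¹ ≈ h
    2γ≈h = trans (*-congʳ (sym h*⟨u,u⟩)) (trans (*-assoc h _ _) (trans (*-congˡ (⁻¹-inverse (axis≉0 t))) (*-identityʳ h)))

    C : Matrix (suc n)
    C i j = reflect u (λ k → σ * ρ k j) i

    C₀ : ∀ i → C i zero ≈ identity zero i
    C₀ i = trans (+-congˡ (-‿cong (*-congʳ (*-cong 2γ≈h ⟨u,y⟩))))
      (trans (solve 3 (λ y h u → y :- h :* (:- :1) :* u := y :+ h :* u) ≈-refl (y i) h (u i))
      (trans (+-congˡ (h*u i)) (solve 2 (λ y e → y :+ (e :+ (:- :1) :* y) := e) ≈-refl (y i) (identity zero i))))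

    C-orth : Orthonormal C
    C-orth i j = trans (reflect-isometry u (axis≉0 t) (λ k → σ * ρ k i) (λ k → σ * ρ k j))
      (trans (⟨⟩-scaleˡ σ (column ρ i) (λ k → σ * ρ k j)) (trans (*-congˡ (⟨⟩-scaleʳ σ (column ρ i) (column ρ j)))
      (trans (sym (*-assoc σ σ _)) (trans (*-cong (sgn² s) (orth i j)) (*-identityˡ _)))))

    -- The first column of C is the first basis vector, so the entries of the first row are inner
    -- products of that column with the others.
    C₀ⱼ : ∀ j → C zero (suc j) ≈ 0#
    C₀ⱼ j = trans (sym (⟨e₀,⟩ (column C (suc j))))
      (trans (⟨⟩-cong (λ i → sym (C₀ i)) (λ i → ≈-refl {C i (suc j)})) (C-orth zero (suc j)))

    ρ′ : Matrix n
    ρ′ i j = C (suc i) (suc j)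

    ρ′-orth : Orthonormal ρ′
    ρ′-orth i j = trans (sym (trans (+-congʳ (trans (*-congʳ (C₀ⱼ i)) (zeroˡ _))) (+-identityˡ _)))
      (trans (C-orth (suc i) (suc j)) (reflexive (identity-suc i j)))

    block-ρ′ : ∀ {A : Matrix n} → (∀ i j → ρ′ i j ≈ A i j) → ∀ i j → block A i j ≈ C i j
    block-ρ′ ρ′≈ zero    zero    = sym (C₀ zero)
    block-ρ′ ρ′≈ zero    (suc j) = sym (C₀ⱼ j)
    block-ρ′ ρ′≈ (suc i) zero    = sym (C₀ (suc i))
    block-ρ′ ρ′≈ (suc i) (suc j) = sym (ρ′≈ i j)

    peeled : ∀ {A : Matrix n} → (∀ i j → ρ′ i j ≈ A i j) → ∀ i j → ρ i j ≈ σ * reflect u (column (block A) j) i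
    peeled {A} ρ′≈ i j = sym (trans (*-congˡ (trans (reflect-cong u {column (block A) j} {column C j} (λ k → block-ρ′ ρ′≈ k j) i)
        (reflect-involutive u (axis≉0 t) (λ k → σ * ρ k j) i)))
      (trans (sym (*-assoc σ σ _)) (trans (*-congʳ (sgn² s)) (*-identityˡ _))))

    -- Up to sign h t k is a coordinate of the unit vector y, so |h t k| ≤ 1 ≤ h. The last
    -- inequality is where the choice of sign pays.
    t-bounded : ∀ k → ∣ t k ∣ ≤ 1#
    t-bounded k = *-cancelˡ-≤ 0<h (≤-trans (inj₂ (trans (*-congʳ (sym (∣∣-of-nonneg (inj₁ 0<h)))) (trans (sym (∣xy∣ h (t k)))
        (∣∣-cong (trans (h*u (suc k)) (solve 1 (λ y → :0 :+ (:- :1) :* y := :- y) ≈-refl (y (suc k))))))))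
      (≤-trans (inj₂ (∣-x∣ (y (suc k)))) (≤-trans (sq≤sq⇒∣∣≤ 0≤1 (≤-trans (coordinate²≤ y (suc k))
        (inj₂ (trans ⟨y,y⟩ (sym (*-identityˡ 1#)))))) (≤-trans 1≤h (inj₂ (sym (*-identityʳ h)))))))

  InChart : ∀ {n} → Matrix n → Set
  InChart {n} ρ = Σ[ ss ∈ Vec Bool n ] Σ[ ts ∈ Params n ] BoundedParams ts × (∀ i j → ρ i j ≈ chart ss ts i j)

  abstract
    chart-surjective : ∀ {n} (ρ : Matrix n) → Orthonormal ρ → InChart ρ
    chart-surjective {zero}  ρ orth = [] , tt , tt , λ ()
    chart-surjective {suc n} ρ orth = step (oppositeSign (ρ zero zero))
      where
      step : (∃[ s ] sgn s * ρ zero zero ≤ 0#) → InChart ρ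
      step (s , sx≤0) = finish (chart-surjective P.ρ′ P.ρ′-orth)
        where
        module P = Peel ρ orth s sx≤0
        finish : InChart P.ρ′ → InChart ρ
        finish (ss , ts , bounded , ρ′≈) = s ∷ ss , (P.t , ts) , (P.t-bounded , bounded) , P.peeled ρ′≈

  -- Determinants

  det-cong : ∀ {n} {A B : Matrix n} → (∀ i j → A i j ≈ B i j) → det A ≈ det B
  det-cong {zero}  A≈B = ≈-refl
  det-cong {suc n} A≈B = sum-cong {suc n} λ j →
    *-congˡ {(- 1#) ^ toℕ j} (*-cong (A≈B zero j) (det-cong λ i k → A≈B (suc i) (punchIn j k)))

  minor : ∀ {n} → Matrix (suc n) → Fin (suc n) → Matrix n
  minor A j i = removeAt (A (suc i)) j

  det-zeroColumn : ∀ {n} (A : Matrix (suc n)) → (∀ i → A i zero ≈ 0#) → det A ≈ 0#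
  det-zeroColumn {n} A A₀≈0 = sum-zero {suc n} summand
    where
    cofactor : ∀ {n} (A : Matrix (suc n)) → (∀ i → A i zero ≈ 0#) → ∀ j → A zero j * det (minor A j) ≈ 0#
    cofactor         A A₀≈0 zero    = trans (*-congʳ (A₀≈0 zero)) (zeroˡ _)
    cofactor {suc n} A A₀≈0 (suc j) = trans (*-congˡ (det-zeroColumn (minor A (suc j)) (A₀≈0 ∘ suc))) (zeroʳ _)
    summand : ∀ j → (- 1#) ^ toℕ j * (A zero j * det (minor A j)) ≈ 0#
    summand j = trans (*-congˡ (cofactor A A₀≈0 j)) (zeroʳ _)

  det-firstColumn : ∀ {n} (A : Matrix (suc n)) → (∀ i → A (suc i) zero ≈ 0#) → det A ≈ A zero zero * det (minor A zero)
  det-firstColumn {n} A A₀≈0 = trans (+-cong (*-identityˡ _) (sum-zero {n} (λ j → trans (*-congˡ (trans (*-congˡ (vanishes A A₀≈0 j)) (zeroʳ _))) (zeroʳ _)))) (+-identityʳ _)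
    where
    vanishes : ∀ {n} (A : Matrix (suc n)) → (∀ i → A (suc i) zero ≈ 0#) → ∀ j → det (minor A (suc j)) ≈ 0#
    vanishes {suc n} A A₀≈0 j = det-zeroColumn (minor A (suc j)) A₀≈0

  det-scaleRow : ∀ {n} (A B : Matrix (suc n)) c → (∀ j → A zero j ≈ c * B zero j) → (∀ i j → A (suc i) j ≈ B (suc i) j) → det A ≈ c * det B
  det-scaleRow {n} A B c A₀≈ A≈ = trans (sum-cong {suc n} λ j → trans
      (*-congˡ (*-cong (A₀≈ j) (det-cong λ i k → A≈ i (punchIn j k))))
      (solve 4 (λ p c b d → p :* (c :* b :* d) := c :* (p :* (b :* d))) ≈-refl ((- 1#) ^ toℕ j) c (B zero j) (det (minor B j))))
    (sum-scaleˡ {suc n} c (λ j → (- 1#) ^ toℕ j * (B zero j * det (minor B j))))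

  -- A is the product of a reflection in the first two coordinates with 1 ⊕ R.
  det-planeReflection : ∀ {n} (A : Matrix (suc (suc n))) (R : Matrix (suc n)) α β → α * α + β * β ≈ 1# →
    A zero zero ≈ α → (∀ j → A zero (suc j) ≈ β * R zero j) →
    A (suc zero) zero ≈ β → (∀ j → A (suc zero) (suc j) ≈ - α * R zero j) →
    (∀ i → A (suc (suc i)) zero ≈ 0#) → (∀ i j → A (suc (suc i)) (suc j) ≈ R (suc i) j) →
    det A ≈ - det R
  det-planeReflection {n} A R α β α²+β²≈1 A₀₀ A₀ⱼ A₁₀ A₁ⱼ Aᵢ₀ Aᵢⱼ = begin
    1# * (A zero zero * det (minor A zero)) + sum (λ j → - 1# * (- 1#) ^ toℕ j * (A zero (suc j) * det (minor A (suc j))))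
      ≈⟨ +-cong (*-congˡ (*-cong A₀₀ (det-scaleRow (minor A zero) R (- α) A₁ⱼ (λ i j → Aᵢⱼ i j))))
           (sum-cong {suc n} λ j → trans (*-congˡ (*-cong (A₀ⱼ j) (minor-suc A R A₁₀ Aᵢ₀ Aᵢⱼ j)))
             (solve 4 (λ p β r d → (:- :1) :* p :* (β :* r :* (β :* d)) := (:- (β :* β)) :* (p :* (r :* d))) ≈-refl
               ((- 1#) ^ toℕ j) β (R zero j) (det (minor R j)))) ⟩
    1# * (α * (- α * det R)) + sum (λ j → - (β * β) * ((- 1#) ^ toℕ j * (R zero j * det (minor R j))))
      ≈⟨ +-congˡ (sum-scaleˡ {suc n} (- (β * β)) (λ j → (- 1#) ^ toℕ j * (R zero j * det (minor R j)))) ⟩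
    1# * (α * (- α * det R)) + - (β * β) * det R
      ≈⟨ solve 3 (λ α β d → :1 :* (α :* ((:- α) :* d)) :+ (:- (β :* β)) :* d := :- ((α :* α :+ β :* β) :* d)) ≈-refl α β (det R) ⟩
    - ((α * α + β * β) * det R)
      ≈⟨ -‿cong (trans (*-congʳ α²+β²≈1) (*-identityˡ _)) ⟩
    - det R ∎
    where
    open ER
    minor-suc : ∀ {n β} (A : Matrix (suc (suc n))) (R : Matrix (suc n)) → A (suc zero) zero ≈ β →
      (∀ i → A (suc (suc i)) zero ≈ 0#) → (∀ i j → A (suc (suc i)) (suc j) ≈ R (suc i) j) →
      ∀ j → det (minor A (suc j)) ≈ β * det (minor R j)
    minor-suc A R A₁₀ Aᵢ₀ Aᵢⱼ j = trans (det-firstColumn (minor A (suc j)) Aᵢ₀)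
      (*-cong A₁₀ (det-cong λ i k → Aᵢⱼ i (punchIn j k)))

  -- Sparse parameters, and the inner products which they vary

  first : ∀ n → Carrier → Point n
  first (suc n) x zero    = x
  first (suc n) x (suc i) = 0#

  -- Parameters for which each reflection moves only the first two coordinates.
  sparse : ∀ {n} → Point n → Params n
  sparse {zero}  y = tt
  sparse {suc n} y = first n (head y) , sparse (tail y)

  ⟨axis-first,⟩ : ∀ {n} x (z : Point (suc (suc n))) → ⟨ axis (first (suc n) x) , z ⟩ ≈ z zero + x * z (suc zero)
  ⟨axis-first,⟩ {n} x z = +-cong (*-identityˡ _) (trans (+-congˡ (sum-zero {n} λ k → zeroˡ (z (suc (suc k))))) (+-identityʳ _))

  -- Each reflection contributes -1 whatever its parameter, so the determinant depends on the signs
  -- alone. All signs are `true` except the last, which is fitted to the parity of the dimension and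
  -- to τ. In dimension one the reflection is multiplication by -1, whence `not τ` there.
  sparse-det : ∀ m τ → Σ[ ss ∈ Vec Bool (suc m) ] ∀ (y : Point (suc m)) → det (chart ss (sparse y)) ≈ sgn τ
  sparse-det zero τ = not τ ∷ [] , λ y → begin
    1# * (sgn (not τ) * (1# - 2# * (1# * 1# + 0#) ⁻¹ * (1# * 1# + 0#) * 1#) * 1#) + 0#
      ≈⟨ solve 2 (λ s p → :1 :* (s :* (:1 :- :2 :* p :* (:1 :* :1 :+ :0) :* :1) :* :1) :+ :0 := s :* (:1 :- :2 :* p)) ≈-refl (sgn (not τ)) ((1# * 1# + 0#) ⁻¹) ⟩
    sgn (not τ) * (1# - 2# * (1# * 1# + 0#) ⁻¹)
      ≈⟨ *-cong (sgn-not τ) (+-congˡ (-‿cong (*-congˡ inv))) ⟩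
    - sgn τ * (1# - 2# * 1#)
      ≈⟨ solve 1 (λ s → (:- s) :* (:1 :- :2 :* :1) := s) ≈-refl (sgn τ) ⟩
    sgn τ ∎
    where
    open ER
    inv : (1# * 1# + 0#) ⁻¹ ≈ 1#
    inv = trans (sym (*-identityˡ _)) (trans (*-congʳ (solve 0 (:1 := :1 :* :1 :+ :0) ≈-refl))
      (⁻¹-inverse λ 1≈0 → 0≉1 (trans (sym 1≈0) (solve 0 (:1 :* :1 :+ :0 := :1) ≈-refl))))
  sparse-det (suc m) τ = true ∷ ss , λ y → trans (reduce y) (trans (-‿cong (trans (proj₂ rec (tail y)) (sgn-not τ)))
      (solve 1 (λ s → :- (:- s) := s) ≈-refl (sgn τ)))
    where
    rec : Σ[ ss ∈ Vec Bool (suc m) ] ∀ (y : Point (suc m)) → det (chart ss (sparse y)) ≈ sgn (not τ)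
    rec = sparse-det m (not τ)
    ss = proj₁ rec
    module _ (y : Point (suc (suc m))) where
      x = head y
      R = chart ss (sparse (tail y))
      u = axis (first (suc m) x)
      γ = ⟨ u , u ⟩ ⁻¹
      ⟨u,B₀⟩ : ⟨ u , column (block R) zero ⟩ ≈ 1#
      ⟨u,B₀⟩ = trans (⟨axis-first,⟩ x (column (block R) zero)) (trans (+-congˡ (zeroʳ x)) (+-identityʳ 1#))
      ⟨u,B⟩ : ∀ j → ⟨ u , column (block R) (suc j) ⟩ ≈ x * R zero j
      ⟨u,B⟩ j = trans (⟨axis-first,⟩ x (column (block R) (suc j))) (+-identityˡ _)
      γ[1+x²] : γ * (1# + x * x) ≈ 1#
      γ[1+x²] = trans (*-congˡ (sym (⟨axis-first,⟩ x u))) (γ*⟨u,u⟩ u (axis≉0 (first (suc m) x)))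
      -- With γ = 1 / (1 + x²) these are (x² - 1) / (1 + x²) and -2x / (1 + x²), the rational
      -- parametrization of the circle; the reflection acts on the first two coordinates by the rows
      -- (α, β) and (β, -α).
      α β : Carrier
      α = 1# - 2# * γ
      β = - (2# * γ * x)
      reduce : det (chart (true ∷ ss) (sparse y)) ≈ - det R
      reduce = det-planeReflection (chart (true ∷ ss) (sparse y)) R α β
        (trans (solve 2 (λ γ x → (:1 :- :2 :* γ) :* (:1 :- :2 :* γ) :+ (:- (:2 :* γ :* x)) :* (:- (:2 :* γ :* x)) :=
            :1 :- :2 :* :2 :* γ :+ :2 :* :2 :* γ :* (γ :* (:1 :+ x :* x))) ≈-refl γ x)
          (trans (+-congˡ (*-congˡ γ[1+x²])) (solve 1 (λ γ → :1 :- :2 :* :2 :* γ :+ :2 :* :2 :* γ :* :1 := :1) ≈-refl γ)))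
        (trans (*-congˡ (+-congˡ (-‿cong (*-congʳ (*-congˡ ⟨u,B₀⟩)))))
          (solve 1 (λ γ → :1 :* (:1 :- :2 :* γ :* :1 :* :1) := :1 :- :2 :* γ) ≈-refl γ))
        (λ j → trans (*-congˡ (+-congˡ (-‿cong (*-congʳ (*-congˡ (⟨u,B⟩ j))))))
          (solve 3 (λ γ x r → :1 :* (:0 :- :2 :* γ :* (x :* r) :* :1) := (:- (:2 :* γ :* x)) :* r) ≈-refl γ x (R zero j)))
        (trans (*-congˡ (+-congˡ (-‿cong (*-congʳ (*-congˡ ⟨u,B₀⟩)))))
          (solve 2 (λ γ x → :1 :* (:0 :- :2 :* γ :* :1 :* x) := :- (:2 :* γ :* x)) ≈-refl γ x))
        (λ j → trans (*-congˡ (+-congˡ (-‿cong (*-congʳ (*-congˡ (⟨u,B⟩ j))))))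
          (trans (solve 3 (λ γ x r → :1 :* (r :- :2 :* γ :* (x :* r) :* x) := r :* (:1 :+ :2 :* γ) :- :2 :* (γ :* (:1 :+ x :* x)) :* r) ≈-refl γ x (R zero j))
          (trans (+-congˡ (-‿cong (*-congʳ (*-congˡ γ[1+x²]))))
          (solve 2 (λ γ r → r :* (:1 :+ :2 :* γ) :- :2 :* :1 :* r := (:- (:1 :- :2 :* γ)) :* r) ≈-refl γ (R zero j)))))
        (λ i → solve 2 (λ γ p → :1 :* (:0 :- :2 :* γ :* p :* :0) := :0) ≈-refl γ ⟨ u , column (block R) zero ⟩)
        (λ i j → solve 3 (λ γ p r → :1 :* (r :- :2 :* γ :* p :* :0) := r) ≈-refl γ ⟨ u , column (block R) (suc j) ⟩ (R (suc i) j))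

  private
    -- c and the products are the values of the form at t = 0, 1, -1.
    degenerate : ∀ {a b v w c} → c ≈ 2# * (a * v) → 2# * c ≈ 2# * ((a + b) * (v + w)) → 2# * c ≈ 2# * ((a - b) * (v - w)) →
                 ¬ (v ≈ 0#) → a * a + b * b ≈ 0#
    degenerate {a} {b} {v} {w} {c} p q r v≉0 = integral (integral {2#} {v * (a * a + b * b)}
        (integral {2#} (begin
          2# * (2# * (v * (a * a + b * b)))
            ≈⟨ solve 5 (λ a b v w c → :2 :* (:2 :* (v :* (a :* a :+ b :* b))) :=
                 a :* ((:2 :* c :- :2 :* ((a :+ b) :* (v :+ w))) :+ (:2 :* c :- :2 :* ((a :- b) :* (v :- w))) :- :2 :* :2 :* (c :- :2 :* (a :* v)))
                 :- b :* ((:2 :* c :- :2 :* ((a :+ b) :* (v :+ w))) :- (:2 :* c :- :2 :* ((a :- b) :* (v :- w))))) ≈-refl a b v w c ⟩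
          a * ((2# * c - 2# * ((a + b) * (v + w))) + (2# * c - 2# * ((a - b) * (v - w))) - 2# * 2# * (c - 2# * (a * v)))
            - b * ((2# * c - 2# * ((a + b) * (v + w))) - (2# * c - 2# * ((a - b) * (v - w))))
            ≈⟨ +-cong (*-congˡ (+-cong (+-cong (zero-diff q) (zero-diff r)) (-‿cong (*-congˡ (zero-diff p)))))
                 (-‿cong (*-congˡ (+-cong (zero-diff q) (-‿cong (zero-diff r))))) ⟩
          a * (0# + 0# - 2# * 2# * 0#) - b * (0# - 0#)
            ≈⟨ solve 2 (λ a b → a :* (:0 :+ :0 :- :2 :* :2 :* :0) :- b :* (:0 :- :0) := :0) ≈-refl a b ⟩
          0# ∎) 2≉0) 2≉0) v≉0
      where
      open ER
      zero-diff : ∀ {x y} → x ≈ y → x - y ≈ 0#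
      zero-diff {x} {y} x≈y = trans (+-congʳ x≈y) (-‿inverseʳ y)

    -- The reflection changes ⟨ v , z ⟩ by 2 ⟨ u , z ⟩ ⟨ v , u ⟩ / ⟨ u , u ⟩. Multiplication by ⟨ u
    -- , u ⟩ = 1 + x² leaves a polynomial in x, which sees only the first two coordinates since u is
    -- sparse.
    chart-value : ∀ {m} s (ss : Vec Bool (suc m)) x (y : Point (suc m)) (v w : Point (suc (suc m))) {c} →
      let z = head w V.∷ (chart ss (sparse y) · tail w) in
      ⟨ v , chart (s ∷ ss) (sparse (x V.∷ y)) · w ⟩ ≈ c →
      (1# + x * x) * (⟨ v , z ⟩ - sgn s * c) ≈ 2# * ((z zero + x * z (suc zero)) * (v zero + x * v (suc zero)))
    chart-value {m} s ss x y v w {c} value = begin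
      (1# + x * x) * (⟨ v , z ⟩ - sgn s * c)
        ≈⟨ *-cong (sym (⟨axis-first,⟩ x u)) (+-congˡ (-‿cong (*-congˡ (sym value)))) ⟩
      ⟨ u , u ⟩ * (⟨ v , z ⟩ - sgn s * ⟨ v , chart (s ∷ ss) (sparse (x V.∷ y)) · w ⟩)
        ≈⟨ *-congˡ (+-congˡ (-‿cong (*-congˡ (trans (⟨⟩-cong (λ i → ≈-refl {v i}) (chart-· s ss (first (suc m) x) (sparse y) w))
             (trans (⟨⟩-scaleʳ (sgn s) v (reflect u z)) (*-congˡ (⟨reflect⟩ʳ u z v))))))) ⟩
      ⟨ u , u ⟩ * (⟨ v , z ⟩ - sgn s * (sgn s * (⟨ v , z ⟩ - 2# * γ * ⟨ u , z ⟩ * ⟨ v , u ⟩)))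
        ≈⟨ solve 6 (λ g a s γ p q → g :* (a :- s :* (s :* (a :- :2 :* γ :* p :* q))) := g :* a :- s :* s :* (g :* a :- :2 :* (γ :* g) :* (p :* q))) ≈-refl
             ⟨ u , u ⟩ ⟨ v , z ⟩ (sgn s) γ ⟨ u , z ⟩ ⟨ v , u ⟩ ⟩
      ⟨ u , u ⟩ * ⟨ v , z ⟩ - sgn s * sgn s * (⟨ u , u ⟩ * ⟨ v , z ⟩ - 2# * (γ * ⟨ u , u ⟩) * (⟨ u , z ⟩ * ⟨ v , u ⟩))
        ≈⟨ +-congˡ (-‿cong (*-cong (sgn² s) (+-congˡ (-‿cong (*-cong (*-congˡ (γ*⟨u,u⟩ u (axis≉0 (first (suc m) x))))
             (*-cong (⟨axis-first,⟩ x z) (trans (⟨⟩-comm v u) (⟨axis-first,⟩ x v)))))))) ⟩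
      ⟨ u , u ⟩ * ⟨ v , z ⟩ - 1# * (⟨ u , u ⟩ * ⟨ v , z ⟩ - 2# * 1# * ((z zero + x * z (suc zero)) * (v zero + x * v (suc zero))))
        ≈⟨ solve 2 (λ a b → a :- :1 :* (a :- :2 :* :1 :* b) := :2 :* b) ≈-refl (⟨ u , u ⟩ * ⟨ v , z ⟩) ((z zero + x * z (suc zero)) * (v zero + x * v (suc zero))) ⟩
      2# * ((z zero + x * z (suc zero)) * (v zero + x * v (suc zero))) ∎
      where
      open ER
      z = head w V.∷ (chart ss (sparse y) · tail w)
      u = axis (first (suc m) x)
      γ = ⟨ u , u ⟩ ⁻¹

    -- If the inner product never varies, `chart-value` makes the product of two real linear forms
    -- in x a constant multiple of 1 + x². That polynomial has no real linear factor, so the product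
    -- vanishes identically; as v zero is nonzero, the form built from z is zero. Three values of x
    -- suffice to compare the coefficients.
    constant⇒degenerate : ∀ {m} s (ss : Vec Bool (suc m)) (v w : Point (suc (suc m))) c → ¬ (v zero ≈ 0#) →
      (∀ y → ⟨ v , chart (s ∷ ss) (sparse y) · w ⟩ ≈ c) →
      ∀ y → head w * head w + (chart ss (sparse y) · tail w) zero * (chart ss (sparse y) · tail w) zero ≈ 0#
    constant⇒degenerate s ss v w c v≉0 value y = degenerate {w = v (suc zero)} {c = ⟨ v , z ⟩ - sgn s * c}
      (trans (solve 1 (λ c → c := (:1 :+ :0 :* :0) :* c) ≈-refl _) (trans (chart-value s ss 0# y v w (value (0# V.∷ y)))
        (solve 4 (λ a b v w → :2 :* ((a :+ :0 :* b) :* (v :+ :0 :* w)) := :2 :* (a :* v)) ≈-refl (z zero) (z (suc zero)) (v zero) (v (suc zero)))))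
      (trans (solve 1 (λ c → :2 :* c := (:1 :+ :1 :* :1) :* c) ≈-refl _) (trans (chart-value s ss 1# y v w (value (1# V.∷ y)))
        (solve 4 (λ a b v w → :2 :* ((a :+ :1 :* b) :* (v :+ :1 :* w)) := :2 :* ((a :+ b) :* (v :+ w))) ≈-refl (z zero) (z (suc zero)) (v zero) (v (suc zero)))))
      (trans (solve 1 (λ c → :2 :* c := (:1 :+ (:- :1) :* (:- :1)) :* c) ≈-refl _) (trans (chart-value s ss (- 1#) y v w (value ((- 1#) V.∷ y)))
        (solve 4 (λ a b v w → :2 :* ((a :+ (:- :1) :* b) :* (v :+ (:- :1) :* w)) := :2 :* ((a :- b) :* (v :- w))) ≈-refl (z zero) (z (suc zero)) (v zero) (v (suc zero)))))
      v≉0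
      where
      z = head w V.∷ (chart ss (sparse y) · tail w)

  NonZeroVector : ∀ {n} → Point n → Set
  NonZeroVector w = ¬ (∀ i → w i ≈ 0#)

  private
    mutual
      -- A mutual induction on the dimension. A constant inner product forces w zero to vanish, and
      -- also the first coordinate of the image of the tail of w for all y, against `moves` one
      -- dimension lower. In turn `moves` is `rich` with v the first basis vector and c = 0, down to
      -- dimension one, where the chart is plus or minus the identity.
      rich : ∀ {m} (ss : Vec Bool (suc (suc m))) (v w : Point (suc (suc m))) c → ¬ (v zero ≈ 0#) → NonZeroVector w →
                    ∃[ y ] ¬ (⟨ v , chart ss (sparse y) · w ⟩ ≈ c)
      rich (s ∷ ss) v w c v≉0 w≉0 = ¬∀⟶∃¬ (λ y → ⟨ v , chart (s ∷ ss) (sparse y) · w ⟩ ≈ c) λ value →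
        contradictory (constant⇒degenerate s ss v w c v≉0 value)
        where
        contradictory : (∀ y → head w * head w + (chart ss (sparse y) · tail w) zero * (chart ss (sparse y) · tail w) zero ≈ 0#) → ⊥
        contradictory sumsq = proj₂ moved (sq≈0⇒≈0 (sumsq≈0 (sq-nonneg _) (sq-nonneg _) (trans (+-comm _ _) (sumsq (proj₁ moved)))))
          where
          w₀≈0 : w zero ≈ 0#
          w₀≈0 = sq≈0⇒≈0 (sumsq≈0 (sq-nonneg _) (sq-nonneg _) (sumsq (λ _ → 0#)))
          moved = moves ss (tail w) λ w′≈0 → w≉0 λ { zero → w₀≈0 ; (suc i) → w′≈0 i }

      moves : ∀ {m} (ss : Vec Bool (suc m)) (w : Point (suc m)) → NonZeroVector w →
                     ∃[ y ] ¬ ((chart ss (sparse y) · w) zero ≈ 0#)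
      moves {zero} (s ∷ []) w w≉0 = (λ _ → 0#) , λ p → w≉0 λ { zero → *-cancel (sgn≉0 s) (trans
          (trans (solve 3 (λ s w γ → s :* w := (:- (s :* (w :- (:1 :+ :1) :* (γ :* (:1 :* :1 :+ :0)) :* w :* :1))) :+ (:2 :- :2 :* (γ :* (:1 :* :1 :+ :0))) :* s :* w) ≈-refl (sgn s) (w zero) γ)
          (trans (+-cong (-‿cong (trans (solve 3 (λ s w γ → s :* (w :- (:1 :+ :1) :* (γ :* (:1 :* :1 :+ :0)) :* w :* :1) := s :* (w :- :2 :* γ :* (:1 :* w :+ :0) :* :1)) ≈-refl (sgn s) (w zero) γ)
              (trans (sym (chart-· s [] (λ ()) tt w zero)) p)))
            (*-congʳ (*-congʳ (+-congˡ (-‿cong (*-congˡ (γ*⟨u,u⟩ (axis {0} (λ ())) (axis≉0 {0} (λ ())))))))))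
          (solve 2 (λ s w → (:- :0) :+ (:2 :- :2 :* :1) :* s :* w := s :* :0) ≈-refl (sgn s) (w zero)))) ≈-refl) }
        where
        γ = (1# * 1# + 0#) ⁻¹
        sgn≉0 : ∀ s → ¬ (sgn s ≈ 0#)
        sgn≉0 s s≈0 = 0≉1 (trans (sym (trans (*-congʳ s≈0) (zeroˡ _))) (sgn² s))
      moves {suc m} ss w w≉0 = y , λ p → ≢0 (trans (⟨⟩-comm (identity zero) z) (trans (sum-identityˡ zero z) p))
        where
        richness : ∃[ y ] ¬ (⟨ identity zero , chart ss (sparse y) · w ⟩ ≈ 0#)
        richness = rich ss (identity zero) w 0# (λ 1≈0 → 0≉1 (sym 1≈0)) w≉0
        y = proj₁ richness
        z = chart ss (sparse y) · w
        ≢0 = proj₂ richness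

  -- Opaque because the witness has a very large normal form.
  abstract
    sparse-rich : ∀ {m} (ss : Vec Bool (suc (suc m))) (v w : Point (suc (suc m))) c → ¬ (v zero ≈ 0#) → NonZeroVector w →
                  ∃[ y ] ¬ (⟨ v , chart ss (sparse y) · w ⟩ ≈ c)
    sparse-rich = rich

  sparse-rational : ∀ {N n} {Y : Point N → Point n} → (∀ i → IsRat (λ x → Y x i)) → RationalParams (λ x → sparse (Y x))
  sparse-rational {n = zero}  Y-rat = tt
  sparse-rational {N} {suc n} {Y} Y-rat = first-rat n , sparse-rational {Y = λ x → tail (Y x)} (Y-rat ∘ suc)
    where
    first-rat : ∀ n k → IsRat (λ x → first n (head (Y x)) k)
    first-rat (suc n) zero    = Y-rat zero
    first-rat (suc n) (suc k) = Closed.constants isRat-closed 0#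

  -- The exceptional rotations

  product : ∀ {m} → Vector Carrier m → Carrier
  product = V.foldr _*_ 1#

  product-cong : ∀ {m} {f g : Vector Carrier m} → (∀ i → f i ≈ g i) → product f ≈ product g
  product-cong {zero}  f≈g = ≈-refl
  product-cong {suc m} f≈g = *-cong (f≈g zero) (product-cong (f≈g ∘ suc))

  product-≉0 : ∀ {m} (f : Vector Carrier m) → (∀ i → ¬ (f i ≈ 0#)) → ¬ (product f ≈ 0#)
  product-≉0 {zero}  f f≉0 1≈0 = 0≉1 (sym 1≈0)
  product-≉0 {suc m} f f≉0     = *-≉0 (f≉0 zero) (product-≉0 (f ∘ suc) (f≉0 ∘ suc))

  product-zero : ∀ {m} (f : Vector Carrier m) i → f i ≈ 0# → product f ≈ 0#
  product-zero f zero    f≈0 = trans (*-congʳ f≈0) (zeroˡ _)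
  product-zero f (suc i) f≈0 = trans (*-congˡ (product-zero (f ∘ suc) i f≈0)) (zeroʳ _)

  finiteProducts : ∀ {X : Set} {𝒫 : (X → Carrier) → Set} → Closed 𝒫 → ∀ {m} {f : Fin m → X → Carrier} →
                   (∀ i → 𝒫 (f i)) → 𝒫 (λ x → product (λ i → f i x))
  finiteProducts cl {zero}  f∈ = Closed.constants cl 1#
  finiteProducts cl {suc m} f∈ = Closed.products cl (f∈ zero) (finiteProducts cl (f∈ ∘ suc))

  without : ∀ {m} → Fin m → Vector Carrier m → Vector Carrier m
  without i f k = if does (k ≟ i) then 0# else f k

  sum-split : ∀ {m} (i : Fin m) (f : Vector Carrier m) → sum f ≈ f i + sum (without i f)
  sum-split {suc m} zero    f = +-congˡ (sym (+-identityˡ _))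
  sum-split {suc m} (suc i) f = trans (+-congˡ (sum-split i (f ∘ suc)))
    (solve 3 (λ a b c → a :+ (b :+ c) := b :+ (a :+ c)) ≈-refl (f zero) (f (suc i)) _)

  without-other : ∀ {m} {i k : Fin m} (f : Vector Carrier m) → k ≢ i → without i f k ≡ f k
  without-other {i = i} {k} f k≢i with k ≟ i
  ... | yes k≡i = ⊥-elim (k≢i k≡i)
  ... | no  _   = refl

  without-cong : ∀ {m} {i k : Fin m} {f g : Vector Carrier m} → (k ≢ i → f k ≈ g k) → without i f k ≈ without i g k
  without-cong {i = i} {k} f≈g with k ≟ i
  ... | yes _   = ≈-refl
  ... | no  k≢i = f≈g k≢i

  module _ {A : Set} {m : ℕ} where
    select : Fin m → Fin m → A → A → A → Fin m → A
    select i j x y z k = if does (k ≟ i) then x else (if does (k ≟ j) then y else z)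

    select-first : ∀ i j {x y z} → select i j x y z i ≡ x
    select-first i j with i ≟ i
    ... | yes _   = refl
    ... | no  i≢i = ⊥-elim (i≢i refl)

    select-second : ∀ {i j x y z} → i ≢ j → select i j x y z j ≡ y
    select-second {i} {j} i≢j with j ≟ i | j ≟ j
    ... | yes j≡i | _       = ⊥-elim (i≢j (≡.sym j≡i))
    ... | no  _   | yes _   = refl
    ... | no  _   | no  j≢j = ⊥-elim (j≢j refl)

    select-other : ∀ {i j k x y z} → k ≢ i → k ≢ j → select i j x y z k ≡ z
    select-other {i} {j} {k} k≢i k≢j with k ≟ i | k ≟ j
    ... | yes k≡i | _       = ⊥-elim (k≢i k≡i)
    ... | no  _   | yes k≡j = ⊥-elim (k≢j k≡j)
    ... | no  _   | no  _   = refl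

  Word : ℕ → ℕ → Set
  Word d q = Vec (Fin q) d

  -- Hamming distance at least 2, in a form that supplies the two positions whose rotations are to
  -- be moved.
  Far : ∀ {d q} → Word d q → Word d q → Set
  Far {d} a b = Σ[ i ∈ Fin d ] Σ[ j ∈ Fin d ] i ≢ j × lookup a i ≢ lookup b i × lookup a j ≢ lookup b j

  lookup-ext : ∀ {A : Set} {d} {a b : Vec A d} → (∀ i → lookup a i ≡ lookup b i) → a ≡ b
  lookup-ext {a = a} {b} p = ≡.trans (≡.sym (tabulate∘lookup a)) (≡.trans (tabulate-cong p) (tabulate∘lookup b))

  differ-somewhere : ∀ {d q} {a b : Word d q} → a ≢ b → ∃[ i ] lookup a i ≢ lookup b i
  differ-somewhere a≢b = ¬∀⟶∃¬ _ λ same → a≢b (lookup-ext same)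

  data Relationship {d q} (a b : Word d q) : Set where
    equal    : a ≡ b → Relationship a b
    adjacent : (∃! _≡_ λ i → lookup a i ≢ lookup b i) → Relationship a b
    far      : Far a b → Relationship a b

  relationship : ∀ {d q} (a b : Word d q) → Relationship a b
  relationship a b = decide (excludedMiddle (a ≡ b)) (excludedMiddle (Far a b))
    where
    decide : Dec (a ≡ b) → Dec (Far a b) → Relationship a b
    decide (yes a≡b) _       = equal a≡b
    decide (no _)    (yes f) = far f
    decide (no a≢b)  (no ¬f) = adjacent (proj₁ diff , proj₂ diff , λ {j} aj≢bj → unique j aj≢bj)
      where
      diff = differ-somewhere a≢b
      unique : ∀ j → lookup a j ≢ lookup b j → proj₁ diff ≡ j
      unique j aj≢bj = ¬¬-elim λ i≢j → ¬f (proj₁ diff , j , i≢j , proj₂ diff , aj≢bj)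

  ∈-bools : ∀ s → s ∈ₗ (true ∷ false ∷ [])
  ∈-bools true  = here refl
  ∈-bools false = there (here refl)

  module MinkowskiSum {d n q : ℕ} (T : Vector (Point n) q)
                      (unitEdges : ∀ i j → i ≢ j → ⟨ T i ⊖ T j , T i ⊖ T j ⟩ ≈ 1#) where

    edge : Word d q → Word d q → Fin d → Point n
    edge a b i = T (lookup a i) ⊖ T (lookup b i)

    displacement : Vector (Matrix n) d → Word d q → Word d q → Point n
    displacement ρ a b k = sum λ i → (ρ i · edge a b i) k

    minkowski-displacement : ∀ ρ a b k → (minkowski ρ T a ⊖ minkowski ρ T b) k ≈ displacement ρ a b k
    minkowski-displacement ρ a b k = trans
      (+-congˡ (trans (solve 1 (λ x → :- x := (:- :1) :* x) ≈-refl (minkowski ρ T b k)) (*-distribˡ-sum {d} (- 1#) (λ i → (ρ i · T (lookup b i)) k))))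
      (trans (sym (∑-distrib-+ {d} (λ i → (ρ i · T (lookup a i)) k) (λ i → - 1# * (ρ i · T (lookup b i)) k)))
      (sum-cong {d} λ i → sym (trans (⟨⟩-addʳ (ρ i k) (T (lookup a i)) (λ j → - T (lookup b i) j))
        (+-congˡ (trans (⟨⟩-cong (λ j → ≈-refl {ρ i k j}) (λ j → solve 1 (λ x → :- x := (:- :1) :* x) ≈-refl (T (lookup b i) j)))
          (⟨⟩-scaleʳ (- 1#) (ρ i k) (T (lookup b i))))))))

    -- The two squared distances that far words must avoid: 1, reserved for adjacent words, and 0,
    -- which would break injectivity.
    κ : Bool → Carrier
    κ true  = 1#
    κ false = 0#

    norm² : Vector (Matrix n) d → Word d q → Word d q → Carrier
    norm² ρ a b = ⟨ displacement ρ a b , displacement ρ a b ⟩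

    Constraint : Set
    Constraint = Word d q × Word d q × Bool

    -- Pairs that are not far get the factor 1, so that a single product runs over all triples. The
    -- decision is an argument in order that later proofs can split on it.
    factorOf : ∀ a b → Dec (Far a b) → Vector (Matrix n) d → Bool → Carrier
    factorOf a b (yes _) ρ s = norm² ρ a b - κ s
    factorOf a b (no  _) ρ s = 1#

    factor : Constraint → Vector (Matrix n) d → Carrier
    factor (a , b , s) ρ = factorOf a b (excludedMiddle (Far a b)) ρ s

    allWords : List (Word d q)
    allWords = allVecs (allFin q) d

    constraints : List Constraint
    constraints = cartesianProduct allWords (cartesianProduct allWords (true ∷ false ∷ []))

    ∈-constraints : ∀ a b s → (a , b , s) ∈ₗ constraints
    ∈-constraints a b s = ∈-cartesianProduct⁺ (∈-allVecs ∈-allFin a) (∈-cartesianProduct⁺ (∈-allVecs ∈-allFin b) (∈-bools s))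

    exceptional : Vector (Matrix n) d → Carrier
    exceptional ρ = product λ m → factor (List.lookup constraints m) ρ

    factor-≉0 : ∀ ρ → ¬ (exceptional ρ ≈ 0#) → ∀ c → c ∈ₗ constraints → ¬ (factor c ρ ≈ 0#)
    factor-≉0 ρ ≉0 c c∈ factor≈0 = ≉0 (product-zero _ (Any.index c∈)
      (subst (λ c → factor c ρ ≈ 0#) (lookup-index c∈) factor≈0))

    far-norm² : ∀ ρ → ¬ (exceptional ρ ≈ 0#) → ∀ a b → Far a b → ∀ s → ¬ (norm² ρ a b ≈ κ s)
    far-norm² ρ ≉0 a b f s eq = factor-≉0 ρ ≉0 (a , b , s) (∈-constraints a b s) (vanishes (excludedMiddle (Far a b)))
      where
      vanishes : ∀ dec → factorOf a b dec ρ s ≈ 0#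
      vanishes (yes _) = trans (+-congʳ eq) (-‿inverseʳ _)
      vanishes (no ¬f) = ⊥-elim (¬f f)

    norm²-minkowski : ∀ ρ a b → ⟨ minkowski ρ T a ⊖ minkowski ρ T b , minkowski ρ T a ⊖ minkowski ρ T b ⟩ ≈ norm² ρ a b
    norm²-minkowski ρ a b = ⟨⟩-cong (minkowski-displacement ρ a b) (minkowski-displacement ρ a b)

    edge-zero : ∀ (A : Matrix n) {i j} → i ≡ j → ∀ k → (A · (T i ⊖ T j)) k ≈ 0#
    edge-zero A refl k = sum-zero {n} λ l → trans (*-congˡ (-‿inverseʳ _)) (zeroʳ _)

    adjacent-norm² : ∀ ρ → (∀ i → Orthonormal (ρ i)) → ∀ a b → (∃! _≡_ λ i → lookup a i ≢ lookup b i) → norm² ρ a b ≈ 1#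
    adjacent-norm² ρ orth a b (i , ai≢bi , unique) = trans (⟨⟩-cong single single)
      (trans (orthonormal-isometry (ρ i) (orth i) (edge a b i) (edge a b i)) (unitEdges (lookup a i) (lookup b i) ai≢bi))
      where
      single : ∀ k → displacement ρ a b k ≈ (ρ i · edge a b i) k
      single k = trans (sum-split {d} i (λ l → (ρ l · edge a b l) k)) (trans (+-congˡ (sum-zero {d} others)) (+-identityʳ _))
        where
        others : ∀ l → without i (λ l → (ρ l · edge a b l) k) l ≈ 0#
        others l with l ≟ i
        ... | yes _   = ≈-refl
        ... | no  l≢i = edge-zero (ρ l) (¬¬-elim λ al≢bl → l≢i (≡.sym (unique al≢bl))) k

    faithful : ∀ ρ → (∀ i → Orthonormal (ρ i)) → ¬ (exceptional ρ ≈ 0#) → IsFaithful (hamming d q) (minkowski ρ T)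
    faithful ρ orth ≉0 = record
      { injective    = λ {a} {b} Pa≈Pb → inj a b (trans (sym (norm²-minkowski ρ a b))
                         (sum-zero {n} λ k → trans (*-congʳ (trans (+-congʳ (Pa≈Pb k)) (-‿inverseʳ _))) (zeroˡ _))) (relationship a b)
      ; unitDistance = λ a b → mk⇔
          (λ (_ , 1≈) → unit a b (trans (sym (norm²-minkowski ρ a b)) (trans (sym 1≈) (*-identityˡ 1#))) (relationship a b))
          (λ adj → 0≤1 , trans (*-identityˡ 1#) (sym (trans (norm²-minkowski ρ a b) (adjacent-norm² ρ orth a b adj))))
      }
      where
      inj : ∀ a b → norm² ρ a b ≈ 0# → Relationship a b → a ≡ b
      inj a b ≈0 (equal a≡b)    = a≡b
      inj a b ≈0 (adjacent adj) = ⊥-elim (0≉1 (trans (sym ≈0) (adjacent-norm² ρ orth a b adj)))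
      inj a b ≈0 (far f)        = ⊥-elim (far-norm² ρ ≉0 a b f false ≈0)
      unit : ∀ a b → norm² ρ a b ≈ 1# → Relationship a b → ∃! _≡_ λ i → lookup a i ≢ lookup b i
      unit a b ≈1 (equal refl)   = ⊥-elim (0≉1 (trans (sym (sum-zero {n} λ k →
        trans (*-congʳ (sum-zero {d} λ i → edge-zero (ρ i) refl k)) (zeroˡ _))) ≈1))
      unit a b ≈1 (adjacent adj) = adj
      unit a b ≈1 (far f)        = ⊥-elim (far-norm² ρ ≉0 a b f true ≈1)

    displacement-cong : ∀ {ρ ρ′ : Vector (Matrix n) d} → (∀ i j k → ρ i j k ≈ ρ′ i j k) → ∀ a b k → displacement ρ a b k ≈ displacement ρ′ a b k
    displacement-cong ρ≈ a b k = sum-cong {d} λ i → ·-cong (ρ≈ i) (λ j → ≈-refl {edge a b i j}) k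

    factor-cong : ∀ {ρ ρ′} → (∀ i j k → ρ i j k ≈ ρ′ i j k) → ∀ c → factor c ρ ≈ factor c ρ′
    factor-cong {ρ} {ρ′} ρ≈ (a , b , s) = decided (excludedMiddle (Far a b))
      where
      decided : ∀ dec → factorOf a b dec ρ s ≈ factorOf a b dec ρ′ s
      decided (yes _) = +-congʳ (⟨⟩-cong (displacement-cong ρ≈ a b) (displacement-cong ρ≈ a b))
      decided (no _)  = ≈-refl

    exceptional-cong : ∀ {ρ ρ′} → (∀ i j k → ρ i j k ≈ ρ′ i j k) → exceptional ρ ≈ exceptional ρ′
    exceptional-cong ρ≈ = product-cong λ m → factor-cong ρ≈ (List.lookup constraints m)

    module _ {X : Set} {𝒫 : (X → Carrier) → Set} (cl : Closed 𝒫) (ρ : X → Vector (Matrix n) d)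
             (ρ∈ : ∀ i j k → 𝒫 (λ x → ρ x i j k)) where
      open Closed cl

      factor-closed : ∀ c → 𝒫 (factor c ∘ ρ)
      factor-closed (a , b , s) = decided (excludedMiddle (Far a b))
        where
        disp : ∀ k → 𝒫 (λ x → displacement (ρ x) a b k)
        disp k = finiteSums {f = λ i x → (ρ x i · edge a b i) k} λ i →
          finiteSums {f = λ j x → ρ x i k j * edge a b i j} λ j → products (ρ∈ i k j) (constants (edge a b i j))
        decided : ∀ dec → 𝒫 (λ x → factorOf a b dec (ρ x) s)
        decided (yes _) = differences (finiteSums {f = λ k x → displacement (ρ x) a b k * displacement (ρ x) a b k} λ k → products (disp k) (disp k)) (constants (κ s))
        decided (no _)  = constants 1#

      exceptional-closed : 𝒫 (exceptional ∘ ρ)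
      exceptional-closed = finiteProducts cl {f = λ m x → factor (List.lookup constraints m) (ρ x)} λ m → factor-closed (List.lookup constraints m)

  unflatten : ∀ {d k} → Point (d ℕ.* k) → Vector (Point k) d
  unflatten y i j = y (combine i j)

  flatten : ∀ {d k} → Vector (Point k) d → Point (d ℕ.* k)
  flatten {k = k} Y c = uncurry Y (remQuot k c)

  unflatten-flatten : ∀ {d k} (Y : Vector (Point k) d) i j → unflatten (flatten Y) i j ≡ Y i j
  unflatten-flatten {k = k} Y i j = cong (uncurry Y) (remQuot-combine i j)

  sparse-cong : ∀ {n} {y y′ : Point n} → (∀ i → y i ≈ y′ i) → sparse y ≈ᴾ sparse y′
  sparse-cong {zero}  y≈ = _
  sparse-cong {suc n} {y} {y′} y≈ = first-cong n , sparse-cong (y≈ ∘ suc)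
    where
    first-cong : ∀ n i → first n (head y) i ≈ first n (head y′) i
    first-cong (suc n) zero    = y≈ zero
    first-cong (suc n) (suc i) = ≈-refl

  charts : ∀ {d n} → Vec (Vec Bool n) d → Vector (Params n) d → Vector (Matrix n) d
  charts ss ts i = chart (lookup ss i) (ts i)

  module _ {d m q : ℕ} (T : Vector (Point (suc (suc m))) q)
           (unitEdges : ∀ i j → i ≢ j → ⟨ T i ⊖ T j , T i ⊖ T j ⟩ ≈ 1#) where
    private
      dim : ℕ
      dim = suc (suc m)
    open MinkowskiSum {d} T unitEdges

    nonzeroEdge : ∀ i j → i ≢ j → NonZeroVector (T i ⊖ T j)
    nonzeroEdge i j i≢j x≈0 = 0≉1 (trans (sym (sum-zero {dim} λ k → trans (*-congʳ {(T i ⊖ T j) k} (x≈0 k)) (zeroˡ ((T i ⊖ T j) k)))) (unitEdges i j i≢j))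

    -- With the other blocks fixed, first move block j to make the remaining sum
    -- nonzero in its first coordinate, and then block i to avoid one distance.
    module Move (ss : Vec (Vec Bool dim) d) (a b : Word d q) (c : Carrier) (i j : Fin d) (i≢j : i ≢ j)
                (ai≢bi : lookup a i ≢ lookup b i) (aj≢bj : lookup a j ≢ lookup b j) where

      image : Fin d → Point dim → Point dim
      image k y = chart (lookup ss k) (sparse y) · edge a b k

      rest : Point dim
      rest r = sum (without j (without i λ k → image k (λ _ → 0#) r))

      moveⱼ : ∃[ y ] ¬ (⟨ identity zero , image j y ⟩ ≈ - rest zero)
      moveⱼ = sparse-rich (lookup ss j) (identity zero) (edge a b j) (- rest zero) (λ 1≈0 → 0≉1 (sym 1≈0)) (nonzeroEdge (lookup a j) (lookup b j) aj≢bj)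

      partialSum : Point dim
      partialSum r = image j (proj₁ moveⱼ) r + rest r

      partialSum₀ : ¬ (partialSum zero ≈ 0#)
      partialSum₀ p = proj₂ moveⱼ (trans (⟨⟩-comm (identity zero) z) (trans (sum-identityˡ zero z)
        (trans (solve 2 (λ x y → x := x :+ y :- y) ≈-refl (z zero) (rest zero)) (trans (+-congʳ p) (+-identityˡ _)))))
        where
        z = image j (proj₁ moveⱼ)

      -- With v the partial sum and x the image of the unit edge at position i, |x + v|² = 1 + 2 ⟨ v
      -- , x ⟩ + |v|². This is c exactly when ⟨ v , x ⟩ is the target.
      target : Carrier
      target = ½ * (c - 1# - ⟨ partialSum , partialSum ⟩)

      moveᵢ : ∃[ y ] ¬ (⟨ partialSum , image i y ⟩ ≈ target)
      moveᵢ = sparse-rich (lookup ss i) partialSum (edge a b i) target partialSum₀ (nonzeroEdge (lookup a i) (lookup b i) ai≢bi)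

      Y : Fin d → Point dim
      Y = select i j (proj₁ moveᵢ) (proj₁ moveⱼ) (λ _ → 0#)

      ρ : Vector (Matrix dim) d
      ρ = charts ss (sparse ∘ Y)

      total : ∀ r → displacement ρ a b r ≈ image i (proj₁ moveᵢ) r + partialSum r
      total r = trans (sum-split {d} i f) (+-cong (reflexive (cong (λ y → image i y r) (select-first i j)))
        (trans (sum-split {d} j (without i f)) (+-cong
          (reflexive (≡.trans (without-other {i = i} f (i≢j ∘ ≡.sym)) (cong (λ y → image j y r) (select-second i≢j))))
          (sum-cong {d} λ k → without-cong {i = j} {k} {without i f} {without i f₀} λ k≢j → without-cong {i = i} {k} {f} {f₀} λ k≢i →
            reflexive (cong (λ y → image k y r) (select-other k≢i k≢j))))))
        where
        f : Vector Carrier d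
        f k = image k (Y k) r
        f₀ : Vector Carrier d
        f₀ k = image k (λ _ → 0#) r

      avoids : ¬ (norm² ρ a b ≈ c)
      avoids eq = proj₂ moveᵢ (trans (sym (halve ⟨ v , x ⟩))
        (trans (solve 3 (λ h p v → h :* p :+ h :* p := h :* ((:1 :+ p :+ (p :+ v)) :- :1 :- v)) ≈-refl ½ ⟨ v , x ⟩ ⟨ v , v ⟩)
        (*-congˡ (+-congʳ (+-congʳ (trans (sym expanded) eq))))))
        where
        v = partialSum
        x = image i (proj₁ moveᵢ)
        expanded : norm² ρ a b ≈ 1# + ⟨ v , x ⟩ + (⟨ v , x ⟩ + ⟨ v , v ⟩)
        expanded = trans (⟨⟩-cong total total) (trans (⟨⟩-addˡ x v (λ r → x r + v r))
          (+-cong (trans (⟨⟩-addʳ x x v) (+-cong (trans (orthonormal-isometry (chart (lookup ss i) (sparse (proj₁ moveᵢ)))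
            (chart-orthonormal (lookup ss i) (sparse (proj₁ moveᵢ))) (edge a b i) (edge a b i)) (unitEdges (lookup a i) (lookup b i) ai≢bi)) (⟨⟩-comm x v)))
            (⟨⟩-addʳ v x v)))

    factor-avoidable : ∀ ss c → Σ[ Y ∈ Vector (Point dim) d ] ¬ (factor c (charts ss (λ i → sparse (Y i))) ≈ 0#)
    factor-avoidable ss (a , b , s) = decided (excludedMiddle (Far a b))
      where
      decided : ∀ dec → Σ[ Y ∈ Vector (Point dim) d ] ¬ (factorOf a b dec (charts ss (λ i → sparse (Y i))) s ≈ 0#)
      decided (no _) = (λ _ _ → 0#) , λ 1≈0 → 0≉1 (sym 1≈0)
      decided (yes (i , j , i≢j , ai≢bi , aj≢bj)) = Y , λ ≈0 → avoids
        (trans (solve 2 (λ x k → x := x :- k :+ k) ≈-refl (norm² ρ a b) (κ s)) (trans (+-congʳ ≈0) (+-identityˡ _)))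
        where
        open Move ss a b (κ s) i j i≢j ai≢bi aj≢bj

    -- Each factor is avoided at parameters of its own. Regarded as rational functions of all the
    -- sparse parameters together, the factors thus have nonzero numerators, and `commonNonzero`
    -- finds one point for all of them.
    commonPoint : ∀ ss → Σ[ Y ∈ Vector (Point dim) d ] ¬ (exceptional (charts ss (λ i → sparse (Y i))) ≈ 0#)
    commonPoint ss = unflatten y , product-≉0 (λ m → factor (List.lookup constraints m) (at y))
        (λ m ≈0 → proj₂ common m (trans (sym (IsRat.den*f (rat m) y)) (trans (*-congˡ ≈0) (zeroʳ _))))
      where
      at : Point (d ℕ.* dim) → Vector (Matrix dim) d
      at y = charts ss (λ i → sparse (unflatten y i))
      rat : ∀ m → IsRat (λ y → factor (List.lookup constraints m) (at y))
      rat m = factor-closed isRat-closed at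
        (λ i → chart-rational (lookup ss i) (λ y → sparse (unflatten y i)) (sparse-rational {Y = λ y → unflatten y i} λ j → isPoly⇒isRat (isPoly-variable (combine i j))))
        (List.lookup constraints m)
      nonzero : ∀ m → NonZeroᵖ (IsRat.num (rat m))
      nonzero m = nonZero-of-point _ (flatten Y) λ num≈0 → proj₂ avoid (trans
          (factor-cong (λ i → chart-cong (lookup ss i) (sparse-cong λ j → reflexive (≡.sym (unflatten-flatten Y i j)))) (List.lookup constraints m))
          (integral (trans (IsRat.den*f (rat m) (flatten Y)) num≈0) (>⇒≉ (0<of1≤ (IsRat.1≤den (rat m) (flatten Y))))))
        where
        avoid = factor-avoidable ss (List.lookup constraints m)
        Y = proj₁ avoid
      common : ∃[ y ] ∀ m → ¬ (eval (IsRat.num (rat m)) y ≈ 0#)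
      common = commonNonzero (λ m → IsRat.num (rat m)) nonzero
      y = proj₁ common

  -- Null sets

  -- The number n(n-1)/2 of parameters of a chart, by the recursion of `Params`, along which the
  -- coordinates are split.
  tri : ℕ → ℕ
  tri zero    = 0
  tri (suc n) = n ℕ.+ tri n

  tri≡C : ∀ n → tri n ≡ n Combinatorics.C 2
  tri≡C zero    = refl
  tri≡C (suc n) = ≡.trans (cong₂ ℕ._+_ (≡.sym (Combinatorics.nC1≡n n)) (tri≡C n)) (Combinatorics.nCk+nC[k+1]≡[n+1]C[k+1] n 1)

  -- An affine change of variables: the grid divides [0,1], while the chart parameters range over
  -- [-1,1].
  boxParams : ∀ n → Point (tri n) → Params n
  boxParams zero    τ = tt
  boxParams (suc n) τ = (λ k → 2# * τ (k ↑ˡ tri n) - 1#) , boxParams n (λ k → τ (n ↑ʳ k))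

  boxPoint : ∀ n → Params n → Point (tri n)
  boxPoint zero    _        = λ ()
  boxPoint (suc n) (t , ts) = (λ k → ½ * (t k + 1#)) V.++ boxPoint n ts

  boxParams-boxPoint : ∀ n (ts : Params n) {τ} → (∀ k → τ k ≈ boxPoint n ts k) → boxParams n τ ≈ᴾ ts
  boxParams-boxPoint zero    _        τ≈ = tt
  boxParams-boxPoint (suc n) (t , ts) τ≈ =
    (λ k → trans (+-congʳ (*-congˡ (trans (τ≈ (k ↑ˡ tri n)) (reflexive (lookup-++ˡ t′ (boxPoint n ts) k)))))
      (trans (solve 2 (λ h t → :2 :* (h :* (t :+ :1)) :- :1 := (h :+ h) :* (t :+ :1) :- :1) ≈-refl ½ (t k))
      (trans (+-congʳ (*-congʳ ½+½)) (solve 1 (λ t → :1 :* (t :+ :1) :- :1 := t) ≈-refl (t k))))) ,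
    boxParams-boxPoint n ts (λ k → trans (τ≈ (n ↑ʳ k)) (reflexive (lookup-++ʳ t′ (boxPoint n ts) k)))
    where
    t′ : Point n
    t′ k = ½ * (t k + 1#)

  ++-∈Box : ∀ {m n} {x : Point m} {y : Point n} → Box x → Box y → Box (x V.++ y)
  ++-∈Box {m} x∈ y∈ k with splitAt m k
  ... | inj₁ i = x∈ i
  ... | inj₂ j = y∈ j

  boxPoint∈Box : ∀ n (ts : Params n) → BoundedParams ts → Box (boxPoint n ts)
  boxPoint∈Box (suc n) (t , ts) (t≤1 , bounded) =
    ++-∈Box (λ j → *-nonneg (inj₁ 0<½) (lower (t j) (t≤1 j)) , upper (t j) (t≤1 j)) (boxPoint∈Box n ts bounded)
    where
    lower : ∀ x → ∣ x ∣ ≤ 1# → 0# ≤ x + 1#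
    lower x x≤1 = ≤-resp (-‿inverseʳ x) ≈-refl (+-monoˡ-≤ x (≤-trans (-x≤∣x∣ x) x≤1))
    upper : ∀ x → ∣ x ∣ ≤ 1# → ½ * (x + 1#) ≤ 1#
    upper x x≤1 = ≤-trans (*-monoˡ-≤ (inj₁ 0<½) (+-monoʳ-≤ 1# (≤-trans (x≤∣x∣ x) x≤1)))
      (inj₂ (trans (*-comm ½ 2#) (⁻¹-inverse 2≉0)))

  boxParams-rational : ∀ {N} n {τ : Point N → Point (tri n)} → (∀ k → IsRat (λ x → τ x k)) → RationalParams (λ x → boxParams n (τ x))
  boxParams-rational         zero        τ-rat = tt
  boxParams-rational {N} (suc n) {τ} τ-rat = (λ k → differences (products (constants 2#) (τ-rat (k ↑ˡ tri n))) (constants 1#)) ,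
    boxParams-rational n {τ = λ x k → τ x (n ↑ʳ k)} (λ k → τ-rat (n ↑ʳ k))
    where
    open Closed (isRat-closed {N})

  findInterval : ∀ M y → 0# ≤ y → y ≤ ι (suc M) → Σ[ k ∈ Fin (suc M) ] ι (toℕ k) ≤ y × y ≤ ι (suc (toℕ k))
  findInterval zero    y 0≤y y≤1 = zero , ≤-trans (inj₂ ι-zero) 0≤y , y≤1
  findInterval (suc M) y 0≤y y≤ = [ below , above ]′ (≤-or-> y (ι (suc M)))
    where
    Interval : Set
    Interval = Σ[ k ∈ Fin (suc (suc M)) ] ι (toℕ k) ≤ y × y ≤ ι (suc (toℕ k))
    below : y ≤ ι (suc M) → Interval
    below y≤′ = inject₁ (proj₁ rec) , subst (λ k → ι k ≤ y × y ≤ ι (suc k)) (≡.sym (toℕ-inject₁ (proj₁ rec))) (proj₂ rec)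
      where rec = findInterval M y 0≤y y≤′
    above : ι (suc M) < y → Interval
    above <y = fromℕ (suc M) , subst (λ k → ι k ≤ y × y ≤ ι (suc k)) (≡.sym (toℕ-fromℕ (suc M))) (inj₁ <y , y≤)

  findCell : ∀ {N} M (t : Point N) → Box t → Σ[ k ∈ Vec (Fin (suc M)) N ] InCell k t
  findCell M t t∈ = tabulate (proj₁ ∘ find) , λ i → subst (λ k → InInterval k (t i)) (≡.sym (lookup∘tabulate (proj₁ ∘ find) i)) (proj₂ (find i))
    where
    find : ∀ i → Σ[ k ∈ Fin (suc M) ] InInterval k (t i)
    find i = findInterval M (ι (suc M) * t i) (*-nonneg (ι-nonneg (suc M)) (proj₁ (t∈ i)))
      (≤-trans (*-monoˡ-≤ (ι-nonneg (suc M)) (proj₂ (t∈ i))) (inj₂ (*-identityʳ _)))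

  -- With f = p / q and f′, p′, q′ the values at t′, one has q (f - f′) = (p - p′) - f′ (q - q′). As
  -- q ≥ 1, the left side dominates f - f′, and |f′| ≤ |p′| is bounded on the box.
  isRat-lipschitz : ∀ {N} {f : Point N → Carrier} → IsRat f → ∃[ L ] 0# ≤ L × LipschitzOn f L
  isRat-lipschitz {N} {f} (mkRat p q 1≤q eq) = combine-bounds (eval-lipschitz p) (eval-lipschitz q) (eval-bounded p)
    where
    ≤-by-den : ∀ t x → ∣ x ∣ ≤ ∣ eval q t * x ∣
    ≤-by-den t x = ≤-trans (inj₂ (sym (*-identityˡ _))) (≤-trans
      (*-monoʳ-≤ (∣∣-nonneg x) (≤-trans (1≤q t) (x≤∣x∣ _))) (inj₂ (sym (∣xy∣ _ _))))
    combine-bounds : (∃[ L ] 0# ≤ L × LipschitzOn (eval p) L) → (∃[ L ] 0# ≤ L × LipschitzOn (eval q) L) →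
                     (∃[ B ] 0# ≤ B × (∀ t → Box t → ∣ eval p t ∣ ≤ B)) → ∃[ L ] 0# ≤ L × LipschitzOn f L
    combine-bounds (L , 0≤L , p-lip) (L′ , 0≤L′ , q-lip) (B , 0≤B , p≤B) = L + B * L′ , +-nonneg 0≤L (*-nonneg 0≤B 0≤L′) , bound
      where
      bound : LipschitzOn f (L + B * L′)
      bound t t′ δ t∈ t′∈ 0≤δ t≈t′ = ≤-trans (≤-by-den t (f t - f t′)) (≤-trans
        (inj₂ (∣∣-cong (trans (solve 4 (λ q f q′ f′ → q :* (f :- f′) := (q :* f :- q′ :* f′) :- f′ :* (q :- q′)) ≈-refl (eval q t) (f t) (eval q t′) (f t′))
          (+-congʳ (+-cong (eq t) (-‿cong (eq t′)))))))
        (≤-trans (∣x-y∣≤ _ _) (≤-trans (+-mono-≤ (p-lip t t′ δ t∈ t′∈ 0≤δ t≈t′)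
          (≤-trans (inj₂ (∣xy∣ _ _)) (*-mono-≤ 0≤B (∣∣-nonneg _)
            (≤-trans (≤-by-den t′ (f t′)) (≤-trans (inj₂ (∣∣-cong (eq t′))) (p≤B t′ t′∈))) (q-lip t t′ δ t∈ t′∈ 0≤δ t≈t′))))
        (inj₂ (solve 4 (λ L B L′ δ → L :* δ :+ B :* (L′ :* δ) := (L :+ B :* L′) :* δ) ≈-refl L B L′ δ)))))

  sum-squares : ∀ {n} (f : Vector Carrier n) → (∀ i → 0# ≤ f i) → sum (λ i → f i * f i) ≤ sum f * sum f
  sum-squares {zero}  f 0≤f = inj₂ (sym (zeroˡ _))
  sum-squares {suc n} f 0≤f = ≤-trans (+-monoˡ-≤ (f zero * f zero) (sum-squares (f ∘ suc) (0≤f ∘ suc)))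
    (0≤y-x⇒x≤y (≤-resp ≈-refl (solve 2 (λ a s → :2 :* (a :* s) := (a :+ s) :* (a :+ s) :- (a :* a :+ s :* s)) ≈-refl (f zero) (sum (f ∘ suc)))
      (*-nonneg (inj₁ 0<2) (*-nonneg (0≤f zero) (sum-nonneg (0≤f ∘ suc))))))

  ∈-Ball : ∀ {N} {x y : Point N} {r} → 0# ≤ r → ⟨ y ⊖ x , y ⊖ x ⟩ < r * r → y ∈ Ball x r
  ∈-Ball {x = x} {y} {r} 0≤r <r² = root (sqrt ⟨ y ⊖ x , y ⊖ x ⟩ (⟨⟩-nonneg (y ⊖ x)))
    where
    root : (∃[ s ] 0# ≤ s × s * s ≈ ⟨ y ⊖ x , y ⊖ x ⟩) → y ∈ Ball x r
    root (s , 0≤s , s²≈) = s , (0≤s , s²≈) , sq-reflect-< 0≤r (≤-<-trans (inj₂ s²≈) <r²)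

  ^-distrib-* : ∀ x y k → (x * y) ^ k ≈ x ^ k * y ^ k
  ^-distrib-* x y zero    = sym (*-identityˡ 1#)
  ^-distrib-* x y (suc k) = trans (*-congˡ (^-distrib-* x y k))
    (solve 4 (λ x y a b → (x :* y) :* (a :* b) := (x :* a) :* (y :* b)) ≈-refl x y (x ^ k) (y ^ k))

  ι-^ : ∀ M k → ι (M ℕ.^ k) ≈ ι M ^ k
  ι-^ M zero    = trans (ι-suc 0) (trans (+-congʳ ι-zero) (+-identityˡ 1#))
  ι-^ M (suc k) = trans (ι-* M (M ℕ.^ k)) (*-congˡ (ι-^ M k))

  ^-nonneg : ∀ {x} k → 0# ≤ x → 0# ≤ x ^ k
  ^-nonneg zero    0≤x = 0≤1
  ^-nonneg (suc k) 0≤x = *-nonneg 0≤x (^-nonneg k 0≤x)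

  ^-≤1 : ∀ {x} k → 0# ≤ x → x ≤ 1# → x ^ k ≤ 1#
  ^-≤1 zero    0≤x x≤1 = ≤-refl
  ^-≤1 (suc k) 0≤x x≤1 = ≤-trans (*-mono-≤ 0≤1 (^-nonneg k 0≤x) x≤1 (^-≤1 k 0≤x x≤1)) (inj₂ (*-identityˡ 1#))

  volume : ∀ {N} → ℕ → List (Point N × Carrier) → Carrier
  volume D []             = 0#
  volume D ((c , r) ∷ cs) = r ^ D + volume D cs

  InBallOf : ∀ {N} → Point N → Point N × Carrier → Set
  InBallOf y (c , r) = y ∈ Ball c r

  -- Finite lists of balls suffice for the image of one chart, and the union over the finitely many
  -- charts is concatenation; the sequences required by `IsNull` are produced only at the end.
  Coverable : ∀ {N} → ℕ → (Point N → Set) → Set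
  Coverable {N} D S = ∀ ϵ → 0# < ϵ → Σ[ cs ∈ List (Point N × Carrier) ]
    All (λ c → 0# < proj₂ c) cs × volume D cs ≤ ϵ × (∀ y → S y → Any (InBallOf y) cs)

  -- The image of a cell of side 1/M under a map whose coordinates have Lipschitz
  -- constants Lc lies in a ball of radius (1 + Σ Lc)/M.
  module Balls {N D : ℕ} (g : Point D → Point N) (Lc : Fin N → Carrier) (0≤Lc : ∀ c → 0# ≤ Lc c)
               (lip : ∀ c → LipschitzOn (λ x → g x c) (Lc c)) (M₀ : ℕ) where
    M : ℕ
    M = suc M₀
    -- The summand 1 makes the radius positive, and makes the inequality strict as membership in an
    -- open ball requires, even if all Lipschitz constants are 0.
    L : Carrier
    L = sum Lc + 1#
    0<L : 0# < L
    0<L = ≤-<-trans (sum-nonneg 0≤Lc) (x<x+1 (sum Lc))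
    δ : Carrier
    δ = ι M ⁻¹
    0<δ : 0# < δ
    0<δ = ⁻¹-pos (ι-pos M₀)
    r : Carrier
    r = L * δ
    0<r : 0# < r
    0<r = *-positive 0<L 0<δ

    ballsOf : List (Vec (Fin M) D) → List (Point N × Carrier)
    ballsOf = map λ k → g (corner k) , r

    volume-ballsOf : ∀ ks → volume D (ballsOf ks) ≈ ι (length ks) * r ^ D
    volume-ballsOf []       = sym (trans (*-congʳ ι-zero) (zeroˡ _))
    volume-ballsOf (k ∷ ks) = trans (+-congˡ (volume-ballsOf ks)) (sym (trans (*-congʳ (ι-suc (length ks)))
      (solve 2 (λ l r → (l :+ :1) :* r := r :+ l :* r) ≈-refl (ι (length ks)) (r ^ D))))

    positive : ∀ ks → All (λ c → 0# < proj₂ c) (ballsOf ks)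
    positive []       = []
    positive (k ∷ ks) = 0<r ∷ positive ks

    -- The factors Mᴰ cancel: at most Mᴰ/K balls of radius L/M have total volume at most Lᴰ/K,
    -- whatever the grid.
    small : ∀ {ϵ} l K → 0# < ι K → L ^ D ≤ ϵ * ι K → l ℕ.* K ℕ.≤ M ℕ.^ D → ι l * r ^ D ≤ ϵ
    small {ϵ} l K 0<K L^D≤ϵK lK≤ = *-cancelˡ-≤ 0<K (≤-trans
      (inj₂ (trans (solve 3 (λ k l r → k :* (l :* r) := l :* k :* r) ≈-refl (ι K) (ι l) (r ^ D)) (*-congʳ (sym (ι-* l K)))))
      (≤-trans (*-monoʳ-≤ (^-nonneg D (inj₁ 0<r)) (≤-trans (ι-mono-≤ lK≤) (inj₂ (ι-^ M D))))
      (≤-trans (inj₂ (trans (sym (^-distrib-* (ι M) r D)) (^-congˡ D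
        (trans (solve 3 (λ m l i → m :* (l :* i) := l :* (m :* i)) ≈-refl (ι M) L δ)
          (trans (*-congˡ (⁻¹-inverse (>⇒≉ (ι-pos M₀)))) (*-identityʳ L))))))
      (≤-trans L^D≤ϵK (inj₂ (*-comm ϵ (ι K)))))))

    module _ (k : Vec (Fin M) D) {y : Point N} {τ : Point D} (τ∈k : InCell k τ) (y≈ : ∀ c → y c ≈ g τ c) where
      diff : Point N
      diff = y ⊖ g (corner k)

      close : ∀ c → ∣ diff c ∣ ≤ Lc c * δ
      close c = ≤-trans (inj₂ (∣∣-cong (+-congʳ (y≈ c)))) (lip c τ (corner k) δ
        (cell⊆box k τ∈k) (cell⊆box k (corner∈cell k)) (inj₁ 0<δ) (near-corner k τ∈k))

      diff² : ⟨ diff , diff ⟩ ≤ sum Lc * δ * (sum Lc * δ)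
      diff² = ≤-trans (sum-mono {N} λ c → ≤-trans
          (inj₂ (sym (trans (sym (∣xy∣ (diff c) (diff c))) (∣∣-of-nonneg (sq-nonneg (diff c))))))
          (sq-mono-≤ (∣∣-nonneg (diff c)) (close c)))
        (≤-trans (sum-squares {N} (λ c → Lc c * δ) (λ c → *-nonneg (0≤Lc c) (inj₁ 0<δ)))
          (inj₂ (*-cong (sym (*-distribʳ-sum δ Lc)) (sym (*-distribʳ-sum δ Lc)))))

      Lcδ<r : sum Lc * δ < r
      Lcδ<r = <-resp (*-comm _ _) (*-comm _ _) (*-monoˡ-< 0<δ (x<x+1 (sum Lc)))

      inBall : y ∈ Ball (g (corner k)) r
      inBall = ∈-Ball {N} {g (corner k)} {y} {r} (inj₁ 0<r) (≤-<-trans diff²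
        (≤-<-trans (*-monoˡ-≤ (*-nonneg (sum-nonneg 0≤Lc) (inj₁ 0<δ)) (inj₁ Lcδ<r))
          (<-resp (*-comm _ _) ≈-refl (*-monoˡ-< 0<r Lcδ<r))))

    covering : ∀ {p : Poly D} {K η ϵ} → 0# < η → ThinAt p K η M → 0# < ι K → L ^ D ≤ ϵ * ι K →
      Σ[ cs ∈ List (Point N × Carrier) ] All (λ c → 0# < proj₂ c) cs × volume D cs ≤ ϵ ×
        (∀ y → (∃[ τ ] Box τ × (∀ c → y c ≈ g τ c) × eval p τ ≈ 0#) → Any (InBallOf y) cs)
    covering {p} {K} {η} 0<η (ks , ks≤ , complete) 0<K L^D≤ϵK = ballsOf ks , positive ks ,
        ≤-trans (inj₂ (volume-ballsOf ks)) (small (length ks) K 0<K L^D≤ϵK ks≤) , locate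
      where
      locate : ∀ y → (∃[ τ ] Box τ × (∀ c → y c ≈ g τ c) × eval p τ ≈ 0#) → Any (InBallOf y) (ballsOf ks)
      locate y (τ , τ∈ , y≈ , pτ≈0) = Anyₚ.map⁺ (Any.map (λ { refl → inBall k τ∈k y≈ })
          (complete k τ τ∈k (≤-trans (inj₂ (trans (∣∣-cong pτ≈0) ∣0∣)) (inj₁ 0<η))))
        where
        k : Vec (Fin M) D
        k = proj₁ (findCell M₀ τ τ∈)
        τ∈k : InCell k τ
        τ∈k = proj₂ (findCell M₀ τ τ∈)

  zeroLocus-coverable : ∀ {N D} {g : Point D → Point N} {f : Point D → Carrier} → (∀ c → IsRat (λ x → g x c)) →
    IsRat f → (∃[ x ] ¬ (f x ≈ 0#)) → Coverable D (λ y → ∃[ τ ] Box τ × (∀ c → y c ≈ g τ c) × f τ ≈ 0#)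
  zeroLocus-coverable {N} {D} {g} {f} g-rat (mkRat p q 1≤q eq) (x₀ , fx₀≉0) ϵ 0<ϵ =
    -- K has to be fixed before the grid. This is possible because `B.L` does not depend on its grid
    -- argument, for which 0 is a dummy.
    scale (archimedean (B.L 0 ^ D * ϵ ⁻¹))
    where
    module B = Balls g (λ c → proj₁ (isRat-lipschitz (g-rat c))) (λ c → proj₁ (proj₂ (isRat-lipschitz (g-rat c))))
                 (λ c → proj₂ (proj₂ (isRat-lipschitz (g-rat c))))
    Covering : Set
    Covering = Σ[ cs ∈ List (Point N × Carrier) ] All (λ c → 0# < proj₂ c) cs × volume D cs ≤ ϵ ×
      (∀ y → (∃[ τ ] Box τ × (∀ c → y c ≈ g τ c) × f τ ≈ 0#) → Any (InBallOf y) cs)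
    p≢0 : NonZeroᵖ p
    p≢0 = nonZero-of-point p x₀ λ px₀≈0 → fx₀≉0 (integral (trans (eq x₀) px₀≈0) (>⇒≉ (0<of1≤ (1≤q x₀))))
    zero-of-p : ∀ τ → f τ ≈ 0# → eval p τ ≈ 0#
    zero-of-p τ fτ≈0 = trans (sym (eq τ)) (trans (*-congˡ fτ≈0) (zeroʳ _))
    scale : (∃[ n ] B.L 0 ^ D * ϵ ⁻¹ ≤ ι n) → Covering
    scale (n , L≤n) = finish (thin p p≢0 (suc n))
      where
      L^D≤ϵK : B.L 0 ^ D ≤ ϵ * ι (suc n)
      L^D≤ϵK = ≤-trans (inj₂ (sym (trans (solve 3 (λ e l i → e :* (l :* i) := l :* (e :* i)) ≈-refl ϵ (B.L 0 ^ D) (ϵ ⁻¹))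
          (trans (*-congˡ (⁻¹-inverse (>⇒≉ 0<ϵ))) (*-identityʳ _)))))
        (*-monoˡ-≤ (inj₁ 0<ϵ) (≤-trans L≤n (ι-mono-≤ (ℕₚ.n≤1+n n))))
      finish : (∃[ η ] 0# < η × ∃[ M₀ ] ∀ M → M₀ ℕ.≤ M → ThinAt p (suc n) η M) → Covering
      finish (η , 0<η , M₀ , thinAt) = proj₁ cov , proj₁ (proj₂ cov) , proj₁ (proj₂ (proj₂ cov)) ,
          λ y (τ , τ∈ , y≈ , fτ≈0) → proj₂ (proj₂ (proj₂ cov)) y (τ , τ∈ , y≈ , zero-of-p τ fτ≈0)
        where
        cov = B.covering M₀ {p} {suc n} {η} {ϵ} 0<η (thinAt (suc M₀) (ℕₚ.n≤1+n M₀)) (ι-pos n) L^D≤ϵK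

  volume-++ : ∀ {N} D (cs ds : List (Point N × Carrier)) → volume D (cs ++ ds) ≈ volume D cs + volume D ds
  volume-++ D []       ds = sym (+-identityˡ _)
  volume-++ D (c ∷ cs) ds = trans (+-congˡ (volume-++ D cs ds)) (sym (+-assoc _ _ _))

  union-coverable : ∀ {N D} {A : Set} (S : A → Point N → Set) → (∀ a → Coverable D (S a)) → ∀ as → Coverable D (λ y → Any (λ a → S a y) as)
  union-coverable S S-cov []       ϵ 0<ϵ = [] , [] , inj₁ 0<ϵ , λ y ()
  union-coverable {D = D} S S-cov (a ∷ as) ϵ 0<ϵ = proj₁ A ++ proj₁ B ,
    Allₚ.++⁺ (proj₁ (proj₂ A)) (proj₁ (proj₂ B)) ,
    ≤-trans (inj₂ (volume-++ D (proj₁ A) (proj₁ B))) (≤-trans (+-mono-≤ (proj₁ (proj₂ (proj₂ A))) (proj₁ (proj₂ (proj₂ B)))) (inj₂ (halve ϵ))) ,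
    λ { y (here Sy)   → Anyₚ.++⁺ˡ (proj₂ (proj₂ (proj₂ A)) y Sy)
      ; y (there Sys) → Anyₚ.++⁺ʳ (proj₁ A) (proj₂ (proj₂ (proj₂ B)) y Sys) }
    where
    A = S-cov a (½ * ϵ) (0<½* 0<ϵ)
    B = union-coverable S S-cov as (½ * ϵ) (0<½* 0<ϵ)

  tiny : Carrier → ℕ → Carrier
  tiny η zero    = η
  tiny η (suc k) = tiny (½ * η) k

  tiny-pos : ∀ {η} → 0# < η → ∀ k → 0# < tiny η k
  tiny-pos 0<η zero    = 0<η
  tiny-pos 0<η (suc k) = tiny-pos (0<½* 0<η) k

  -- A positive power of a number in [0,1] is at most that number, so a geometric series bounds the
  -- sum. With exponent 0 each extra ball would have volume 1, which is why the dimension is a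
  -- successor from here on.
  sum-tiny : ∀ D {η} → 0# < η → η ≤ 1# → ∀ K → sum {K} (λ k → tiny η (toℕ k) ^ suc D) ≤ η + η
  sum-tiny D 0<η η≤1 zero    = inj₁ (+-pos-nonneg 0<η (inj₁ 0<η))
  sum-tiny D {η} 0<η η≤1 (suc K) = +-mono-≤
    (≤-trans (*-monoˡ-≤ (inj₁ 0<η) (^-≤1 D (inj₁ 0<η) η≤1)) (inj₂ (*-identityʳ η)))
    (≤-trans (sum-tiny D (0<½* 0<η) (≤-trans (inj₁ (½*x<x 0<η)) η≤1) K) (inj₂ (halve η)))

  -- Null sets are covered by infinitely many balls of positive radius, so a finite
  -- list is continued with shrinking balls.
  ballSequence : ∀ {N} → List (Point N × Carrier) → Carrier → ℕ → Point N × Carrier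
  ballSequence []       η k       = (λ _ → 0#) , tiny η k
  ballSequence (c ∷ cs) η zero    = c
  ballSequence (c ∷ cs) η (suc k) = ballSequence cs η k

  ballSequence-pos : ∀ {N} (cs : List (Point N × Carrier)) → All (λ c → 0# < proj₂ c) cs → ∀ {η} → 0# < η → ∀ k → 0# < proj₂ (ballSequence cs η k)
  ballSequence-pos []       _          0<η k       = tiny-pos 0<η k
  ballSequence-pos (c ∷ cs) (0<r ∷ _)  0<η zero    = 0<r
  ballSequence-pos (c ∷ cs) (_ ∷ 0<rs) 0<η (suc k) = ballSequence-pos cs 0<rs 0<η k

  ballSequence-volume : ∀ {N} D (cs : List (Point N × Carrier)) → All (λ c → 0# < proj₂ c) cs → ∀ {η} → 0# < η → η ≤ 1# → ∀ K →
    sum {K} (λ k → proj₂ (ballSequence cs η (toℕ k)) ^ suc D) ≤ volume (suc D) cs + (η + η)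
  ballSequence-volume D []       _            0<η η≤1 K       = ≤-trans (sum-tiny D 0<η η≤1 K) (inj₂ (sym (+-identityˡ _)))
  ballSequence-volume D (c ∷ cs) (0<r ∷ 0<rs) 0<η η≤1 zero    =
    +-nonneg (volume-nonneg (c ∷ cs) (0<r ∷ 0<rs)) (inj₁ (+-pos-nonneg 0<η (inj₁ 0<η)))
    where
    volume-nonneg : ∀ {N} (cs : List (Point N × Carrier)) → All (λ c → 0# < proj₂ c) cs → 0# ≤ volume (suc D) cs
    volume-nonneg []       _            = ≤-refl
    volume-nonneg (c ∷ cs) (0<r ∷ 0<rs) = +-nonneg (^-nonneg (suc D) (inj₁ 0<r)) (volume-nonneg cs 0<rs)
  ballSequence-volume D (c ∷ cs) (0<r ∷ 0<rs) 0<η η≤1 (suc K) =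
    ≤-trans (+-monoˡ-≤ _ (ballSequence-volume D cs 0<rs 0<η η≤1 K)) (inj₂ (sym (+-assoc _ _ _)))

  ballSequence-∈ : ∀ {N} {y : Point N} (cs : List (Point N × Carrier)) η → Any (InBallOf y) cs → ∃[ k ] InBallOf y (ballSequence cs η k)
  ballSequence-∈ (c ∷ cs) η (here y∈)   = 0 , y∈
  ballSequence-∈ (c ∷ cs) η (there y∈cs) = suc (proj₁ rec) , proj₂ rec
    where rec = ballSequence-∈ cs η y∈cs

  NullIn : ∀ {N} → ℕ → (Point N → Set) → Set
  NullIn {N} D S = ∀ ϵ → 0# < ϵ → Σ[ c ∈ (ℕ → Point N) ] Σ[ r ∈ (ℕ → Carrier) ]
    (∀ k → 0# < r k) × (∀ K → sum {K} (λ k → r (toℕ k) ^ D) ≤ ϵ) × (∀ y → S y → ∃[ k ] y ∈ Ball (c k) (r k))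

  coverable⇒null : ∀ {N D} {S : Point N → Set} → Coverable (suc D) S → NullIn (suc D) S
  coverable⇒null {N} {D} {S} cov ϵ 0<ϵ = sequence (cov (½ * ϵ) (0<½* 0<ϵ)) (commonLower 0<1 (0<½* (0<½* 0<ϵ)))
    where
    sequence : (Σ[ cs ∈ List (Point N × Carrier) ] All (λ c → 0# < proj₂ c) cs × volume (suc D) cs ≤ ½ * ϵ × (∀ y → S y → Any (InBallOf y) cs)) →
               (∃[ η ] 0# < η × η ≤ 1# × η ≤ ½ * (½ * ϵ)) → _
    sequence (cs , 0<rs , vol , covers) (η , 0<η , η≤1 , η≤¼ϵ) =
      proj₁ ∘ ballSequence cs η , proj₂ ∘ ballSequence cs η , ballSequence-pos cs 0<rs 0<η ,
      (λ K → ≤-trans (ballSequence-volume D cs 0<rs 0<η η≤1 K)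
        (≤-trans (+-mono-≤ vol (≤-trans (+-mono-≤ η≤¼ϵ η≤¼ϵ) (inj₂ (halve (½ * ϵ))))) (inj₂ (halve ϵ)))) ,
      λ y Sy → ballSequence-∈ cs η (covers y Sy)

  -- The exceptional set: analytic, proper and null

  uncoordinates : ∀ {d n} → Point (d ℕ.* (n ℕ.* n)) → Vector (Matrix n) d
  uncoordinates y i j k = y (combine i (combine j k))

  uncoordinates-coordinates : ∀ {d n} (ρ : Vector (Matrix n) d) i j k → uncoordinates (coordinates ρ) i j k ≡ ρ i j k
  uncoordinates-coordinates {n = n} ρ i j k = ≡.trans
    (cong (λ z → V.concat (ρ (proj₁ z)) (proj₂ z)) (remQuot-combine {k = n ℕ.* n} i (combine j k)))
    (cong (λ z → ρ i (proj₁ z) (proj₂ z)) (remQuot-combine {k = n} j k))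

  coordinates-cong : ∀ {d n} {ρ ρ′ : Vector (Matrix n) d} → (∀ i j k → ρ i j k ≈ ρ′ i j k) → ∀ c → coordinates ρ c ≈ coordinates ρ′ c
  coordinates-cong ρ≈ c = ρ≈ _ _ _

  charts-rational : ∀ {N d n} (ss : Vec (Vec Bool n) d) (P : Point N → Vector (Params n) d) → (∀ i → RationalParams (λ x → P x i)) →
                    ∀ i j k → IsRat (λ x → charts ss (P x) i j k)
  charts-rational ss P P-rat i = chart-rational (lookup ss i) (λ x → P x i) (P-rat i)

  module _ {d m q : ℕ} (T : Vector (Point (suc (suc m))) q)
           (unitEdges : ∀ i j → i ≢ j → ⟨ T i ⊖ T j , T i ⊖ T j ⟩ ≈ 1#) where
    private
      n : ℕ
      n = suc (suc m)
    open MinkowskiSum {suc d} T unitEdges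

    Exceptional : Vector (Matrix n) (suc d) → Set
    Exceptional ρ = exceptional ρ ≈ 0#

    exceptional-analytic : IsAnalyticSubset Exceptional
    exceptional-analytic ρ _ = 1# , 0<1 , 1 , (λ _ → f) , (λ _ y _ → analytic-of-poly f-cong f-poly y) ,
        λ σ _ _ → mk⇔ (λ e _ → trans (same σ) e) (λ e → trans (sym (same σ)) (e zero))
      where
      -- The product of constraints makes sense for all matrices, orthogonal or not, so this one
      -- function serves near every point.
      f : Point (suc d ℕ.* (n ℕ.* n)) → Carrier
      f y = exceptional (uncoordinates y)
      f-cong : ∀ {x y} → (∀ i → x i ≈ y i) → f x ≈ f y
      f-cong x≈y = exceptional-cong λ i j k → x≈y (combine i (combine j k))
      f-poly : ∀ x → IsPoly (λ h → f (λ i → x i + h i))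
      f-poly x = exceptional-closed isPoly-closed (λ h → uncoordinates (λ i → x i + h i))
        λ i j k → Closed.sums isPoly-closed (Closed.constants isPoly-closed (x (combine i (combine j k)))) (isPoly-variable (combine i (combine j k)))
      same : ∀ σ → f (coordinates σ) ≈ exceptional σ
      same σ = exceptional-cong λ i j k → reflexive (uncoordinates-coordinates σ i j k)

    -- `commonPoint` works for any signs; those of `sparse-det` give every block determinant 1,
    -- whatever the sparse parameters turn out to be.
    exceptional-proper : IsProper Exceptional
    exceptional-proper = charts ss (λ i → sparse (proj₁ common i)) ,
        (λ i → chart-orthonormal (lookup ss i) _ , subst (λ s → det (chart s (sparse (proj₁ common i))) ≈ 1#)
          (≡.sym (lookup∘tabulate (λ _ → proj₁ signs) i)) (proj₂ signs (proj₁ common i))) ,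
        proj₂ common
      where
      signs : Σ[ s ∈ Vec Bool n ] ∀ (y : Point n) → det (chart s (sparse y)) ≈ sgn true
      signs = sparse-det (suc m) true
      ss : Vec (Vec Bool n) (suc d)
      ss = tabulate λ _ → proj₁ signs
      common : Σ[ Y ∈ Vector (Point n) (suc d) ] ¬ (exceptional (charts ss (λ i → sparse (Y i))) ≈ 0#)
      common = commonPoint T unitEdges ss

    D : ℕ
    D = suc d ℕ.* tri n

    N : ℕ
    N = suc d ℕ.* (n ℕ.* n)

    private
      params : Point D → Vector (Params n) (suc d)
      params τ i = boxParams n (unflatten τ i)

      params-rational : ∀ i → RationalParams (λ τ → params τ i)
      params-rational i = boxParams-rational n {τ = λ τ → unflatten τ i} λ k → isPoly⇒isRat (isPoly-variable (combine i k))

      point : Vector (Params n) (suc d) → Point D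
      point ts = flatten (λ i → boxPoint n (ts i))

      params-point : ∀ ts i → params (point ts) i ≈ᴾ ts i
      params-point ts i = boxParams-boxPoint n (ts i) λ k → reflexive (unflatten-flatten (λ i → boxPoint n (ts i)) i k)

      ExceptionalInChart : Vec (Vec Bool n) (suc d) → Point N → Set
      ExceptionalInChart ss y = ∃[ τ ] Box τ × (∀ c → y c ≈ coordinates (charts ss (params τ)) c) × exceptional (charts ss (params τ)) ≈ 0#

      chart-coverable : ∀ ss → Coverable D (ExceptionalInChart ss)
      chart-coverable ss = zeroLocus-coverable {N} {D}
          (λ c → charts-rational ss params params-rational _ _ _)
          (exceptional-closed isRat-closed (λ τ → charts ss (params τ)) (charts-rational ss params params-rational))
          -- This point need not lie in the unit box: it only certifies that the numerator is not
          -- the zero polynomial.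
          (point (λ i → sparse (proj₁ common i)) , λ ≈0 → proj₂ common (trans
            (exceptional-cong λ i → chart-cong (lookup ss i) (≈ᴾ-sym n (params-point (λ i → sparse (proj₁ common i)) i))) ≈0))
        where
        common : Σ[ Y ∈ Vector (Point n) (suc d) ] ¬ (exceptional (charts ss (λ i → sparse (Y i))) ≈ 0#)
        common = commonPoint T unitEdges ss
        ≈ᴾ-sym : ∀ n {ts ts′ : Params n} → ts ≈ᴾ ts′ → ts′ ≈ᴾ ts
        ≈ᴾ-sym zero    _          = tt
        ≈ᴾ-sym (suc n) (t≈ , ts≈) = (λ i → sym (t≈ i)) , ≈ᴾ-sym n ts≈

      allSigns : List (Vec (Vec Bool n) (suc d))
      allSigns = allVecs (allVecs (true ∷ false ∷ []) n) (suc d)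

      exceptional-null′ : NullIn D (λ y → Any (λ ss → ExceptionalInChart ss y) allSigns)
      exceptional-null′ = coverable⇒null (union-coverable ExceptionalInChart chart-coverable allSigns)

      inSomeChart : ∀ ρ → ρ ∈ SO^ (suc d) n → Exceptional ρ → Any (λ ss → ExceptionalInChart ss (coordinates ρ)) allSigns
      inSomeChart ρ ρ∈SO ρ∈E = Any.map (λ { refl → point ts , point∈ , coordinates-cong ρ≈ , trans (sym (exceptional-cong ρ≈)) ρ∈E })
          (∈-allVecs (∈-allVecs ∈-bools) ss)
        where
        located : ∀ i → InChart (ρ i)
        located i = chart-surjective (ρ i) (proj₁ (ρ∈SO i))
        ss : Vec (Vec Bool n) (suc d)
        ss = tabulate λ i → proj₁ (located i)
        ts : Vector (Params n) (suc d)
        ts i = proj₁ (proj₂ (located i))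
        point∈ : Box (point ts)
        point∈ c = boxPoint∈Box n (ts (proj₁ (remQuot (tri n) c))) (proj₁ (proj₂ (proj₂ (located (proj₁ (remQuot (tri n) c)))))) (proj₂ (remQuot {suc d} (tri n) c))
        ρ≈ : ∀ i j k → ρ i j k ≈ charts ss (params (point ts)) i j k
        ρ≈ i j k = trans (proj₂ (proj₂ (proj₂ (located i))) j k) (trans
          (reflexive (cong (λ s → chart s (ts i) j k) (≡.sym (lookup∘tabulate (λ i → proj₁ (located i)) i))))
          (sym (chart-cong (lookup ss i) (params-point ts i) j k)))

    exceptional-null : IsNull Exceptional
    exceptional-null ϵ 0<ϵ =
      let c , r , 0<r , volume≤ , covers = subst (λ D → NullIn {N} D λ y → Any (λ ss → ExceptionalInChart ss y) allSigns) (cong (suc d ℕ.*_) (tri≡C n)) exceptional-null′ ϵ 0<ϵ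
      in c , r , 0<r , volume≤ , λ ρ ρ∈SO ρ∈E → covers (coordinates ρ) (inSomeChart ρ ρ∈SO ρ∈E)

    generically-faithful : Generically (λ ρ → IsFaithful (hamming (suc d) q) (minkowski ρ T))
    generically-faithful = Exceptional , exceptional-analytic , exceptional-proper , exceptional-null ,
      λ ρ ρ∈SO ρ∉E → faithful ρ (λ i → proj₁ (ρ∈SO i)) ρ∉E

    faithful-exists : Realizable (hamming (suc d) q) n
    faithful-exists = minkowski (proj₁ exceptional-proper) T ,
      faithful (proj₁ exceptional-proper) (λ i → proj₁ (proj₁ (proj₂ exceptional-proper) i)) (proj₂ (proj₂ exceptional-proper))

  -- Lower bounds and regular simplices

  identity-diagonal : ∀ {n} (i : Fin n) → identity i i ≈ 1#
  identity-diagonal zero    = ≈-refl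
  identity-diagonal (suc i) = trans (reflexive (identity-suc i i)) (identity-diagonal i)

  identity-off : ∀ {n} {i j : Fin n} → i ≢ j → identity i j ≈ 0#
  identity-off {i = zero}  {zero}  i≢j = ⊥-elim (i≢j refl)
  identity-off {i = zero}  {suc j} i≢j = ≈-refl
  identity-off {i = suc i} {zero}  i≢j = ≈-refl
  identity-off {i = suc i} {suc j} i≢j = trans (reflexive (identity-suc i j)) (identity-off (i≢j ∘ cong suc))

  ⟨identity,⟩ : ∀ {n} (i : Fin n) (z : Point n) → ⟨ identity i , z ⟩ ≈ z i
  ⟨identity,⟩ i z = trans (⟨⟩-comm (identity i) z) (sum-identityˡ i z)

  ⊖-norm² : ∀ {n} (x y : Point n) → ⟨ x ⊖ y , x ⊖ y ⟩ ≈ ⟨ x , x ⟩ - 2# * ⟨ x , y ⟩ + ⟨ y , y ⟩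
  ⊖-norm² {n} x y = trans (sum-cong {n} λ k → solve 2 (λ x y → (x :- y) :* (x :- y) := x :* x :+ ((:- :2) :* (x :* y) :+ y :* y)) ≈-refl (x k) (y k))
    (trans (∑-distrib-+ {n} (λ k → x k * x k) (λ k → - 2# * (x k * y k) + y k * y k)) (trans (+-congˡ
      (trans (∑-distrib-+ {n} (λ k → - 2# * (x k * y k)) (λ k → y k * y k)) (+-congʳ (sum-scaleˡ {n} (- 2#) (λ k → x k * y k)))))
    (solve 3 (λ a b c → a :+ ((:- :2) :* b :+ c) := a :- :2 :* b :+ c) ≈-refl ⟨ x , x ⟩ ⟨ x , y ⟩ ⟨ y , y ⟩)))

  sum-constant : ∀ n c → sum {n} (λ _ → c) ≈ ι n * c
  sum-constant zero    c = sym (trans (*-congʳ ι-zero) (zeroˡ c))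
  sum-constant (suc n) c = trans (+-congˡ (sum-constant n c)) (sym (trans (*-congʳ (ι-suc n))
    (solve 2 (λ n c → (n :+ :1) :* c := c :+ n :* c) ≈-refl (ι n) c)))

  -- With G the Gram matrix ½(I + J) of the edge vectors vᵢ from one vertex, the
  -- projection onto their span has k-th diagonal entry ⟨ G⁻¹a , a ⟩ ≤ 1 for
  -- aᵢ = vᵢ(k), and summing over the j coordinates gives its rank m ≤ j.
  module Projection {m j : ℕ} (v : Fin m → Point j) (gram : ∀ i l → ⟨ v i , v l ⟩ ≈ ½ * (1# + identity i l)) where
    w : Carrier
    w = ι m + 1#
    0<w : 0# < w
    0<w = ≤-<-trans (ι-nonneg m) (x<x+1 (ι m))
    u : Carrier
    u = w ⁻¹
    w*u : w * u ≈ 1#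
    w*u = ⁻¹-inverse (>⇒≉ 0<w)

    gram-sum : ∀ (b : Point m) i → sum (λ l → b l * ⟨ v i , v l ⟩) ≈ ½ * (sum b + b i)
    gram-sum b i = trans (sum-cong {m} λ l → trans (*-congˡ (gram i l))
        (solve 3 (λ b h d → b :* (h :* (:1 :+ d)) := h :* (b :+ b :* d)) ≈-refl (b l) ½ (identity i l)))
      (trans (sum-scaleˡ {m} ½ (λ l → b l + b l * identity i l)) (*-congˡ (trans (∑-distrib-+ {m} b (λ l → b l * identity i l))
        (+-congˡ (sum-identityˡ i b)))))

    module _ (k : Fin j) where
      a : Point m
      a i = v i k
      A : Carrier
      A = sum a
      -- This is G⁻¹a: the inverse of ½(I + J) is 2(I - uJ) with u = 1/(m + 1), because J² = mJ.
      -- Then y is the projection of the k-th basis vector onto the span of the v i.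
      b : Point m
      b i = 2# * a i + - (2# * u * A)
      y : Point j
      y r = sum λ i → b i * v i r

      sum-b : sum b ≈ 2# * u * A
      sum-b = trans (∑-distrib-+ {m} (λ i → 2# * a i) (λ _ → - (2# * u * A))) (trans (+-cong (sum-scaleˡ {m} 2# a) (sum-constant m (- (2# * u * A))))
        (trans (+-congʳ (trans (*-congˡ (trans (sym (*-identityˡ A)) (*-congʳ (sym w*u)))) ≈-refl))
        (solve 3 (λ m u A → :2 :* ((m :+ :1) :* u :* A) :+ m :* (:- (:2 :* u :* A)) := :2 :* u :* A) ≈-refl (ι m) u A)))

      ⟨v,y⟩ : ∀ i → ⟨ v i , y ⟩ ≈ a i
      ⟨v,y⟩ i = trans (⟨⟩-combʳ (v i) b v) (trans (gram-sum b i) (trans (*-congˡ (+-congʳ sum-b))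
        (trans (solve 4 (λ h u A a → h :* (:2 :* u :* A :+ (:2 :* a :- :2 :* u :* A)) := (h :+ h) :* a) ≈-refl ½ u A (a i))
        (trans (*-congʳ ½+½) (*-identityˡ _)))))

      entry : Carrier
      entry = sum λ i → b i * a i

      -- Both the k-th coordinate of y and |y|² equal `entry`, as for any orthogonal projection. The
      -- squared distance from the k-th basis vector to y is therefore 1 - `entry`, and it is
      -- nonnegative.
      entry≤1 : entry ≤ 1#
      entry≤1 = 0≤y-x⇒x≤y (≤-resp ≈-refl (trans (⊖-norm² (identity k) y) (trans
        (+-cong (+-cong (trans (⟨identity,⟩ k (identity k)) (identity-diagonal k)) (-‿cong (*-congˡ (⟨identity,⟩ k y))))
          (trans (⟨⟩-combˡ b v y) (sum-cong {m} λ i → *-congˡ {b i} (⟨v,y⟩ i))))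
        (solve 1 (λ e → :1 :- :2 :* e :+ e := :1 :- e) ≈-refl entry))) (⟨⟩-nonneg (identity k ⊖ y)))

      entry≈ : entry ≈ 2# * sum (λ i → a i * a i) + - (2# * u) * (A * A)
      entry≈ = trans (sum-cong {m} λ i → solve 3 (λ a u A → (:2 :* a :+ (:- (:2 :* u :* A))) :* a := :2 :* (a :* a) :+ (:- (:2 :* u :* A)) :* a) ≈-refl (a i) u A)
        (trans (∑-distrib-+ {m} (λ i → 2# * (a i * a i)) (λ i → - (2# * u * A) * a i))
        (+-cong (sum-scaleˡ {m} 2# (λ i → a i * a i)) (trans (sum-scaleˡ {m} (- (2# * u * A)) a)
          (solve 2 (λ u A → (:- (:2 :* u :* A)) :* A := (:- (:2 :* u)) :* (A :* A)) ≈-refl u A))))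

    total : Point j
    total k = sum λ i → v i k

    ⟨total,total⟩ : ⟨ total , total ⟩ ≈ ½ * (ι m * w)
    ⟨total,total⟩ = trans (⟨⟩-sumˡ v total) (trans (sum-cong {m} λ i → trans (⟨⟩-comm (v i) total) (trans (⟨⟩-sumˡ v (v i))
        (trans (sum-cong {m} λ l → trans (⟨⟩-comm (v l) (v i)) (sym (*-identityˡ _))) (trans (gram-sum (λ _ → 1#) i)
          (*-congˡ (+-congʳ (trans (sum-constant m 1#) (*-identityʳ _))))))))
      (trans (sum-constant m (½ * w)) (solve 3 (λ m h w → m :* (h :* w) := h :* (m :* w)) ≈-refl (ι m) ½ w)))

    trace : sum entry ≈ ι m
    trace = trans (sum-cong {j} entry≈) (trans (∑-distrib-+ {j} (λ k → 2# * sum (λ i → v i k * v i k)) (λ k → - (2# * u) * (total k * total k)))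
      (trans (+-cong
          (trans (sum-scaleˡ {j} 2# (λ k → sum (λ i → v i k * v i k))) (*-congˡ (trans (∑-comm {j} {m} (λ k i → v i k * v i k))
            (trans (sum-cong {m} λ i → trans (gram i i) (*-congˡ (+-congˡ (identity-diagonal i)))) (sum-constant m (½ * 2#))))))
          (trans (sum-scaleˡ {j} (- (2# * u)) (λ k → total k * total k)) (*-congˡ ⟨total,total⟩)))
      (trans (solve 4 (λ h m u w → :2 :* (m :* (h :* :2)) :+ (:- (:2 :* u)) :* (h :* (m :* w)) := (h :+ h) :* m :* (:2 :- w :* u)) ≈-refl ½ (ι m) u w)
      (trans (*-cong (*-congʳ ½+½) (+-congˡ (-‿cong w*u))) (solve 1 (λ m → :1 :* m :* (:2 :- :1) := m) ≈-refl (ι m))))))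

    rank≤ : m ℕ.≤ j
    rank≤ = ι-reflect-≤ (≤-trans (inj₂ (sym trace)) (≤-trans (sum-mono {j} entry≤1) (inj₂ (trans (sum-constant j 1#) (*-identityʳ _)))))

  equilateral-bound : ∀ {m j} (x : Fin (suc m) → Point j) → (∀ i l → i ≢ l → ⟨ x i ⊖ x l , x i ⊖ x l ⟩ ≈ 1#) → m ℕ.≤ j
  equilateral-bound {m} {j} x unit = Projection.rank≤ v gram
    where
    v : Fin m → Point j
    v i = x (suc i) ⊖ x zero
    norm-v : ∀ i → ⟨ v i , v i ⟩ ≈ 1#
    norm-v i = unit (suc i) zero (λ ())
    v⊖v : ∀ i l → ⟨ v i ⊖ v l , v i ⊖ v l ⟩ ≈ ⟨ x (suc i) ⊖ x (suc l) , x (suc i) ⊖ x (suc l) ⟩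
    v⊖v i l = ⟨⟩-cong same same
      where
      same : ∀ k → (v i ⊖ v l) k ≈ (x (suc i) ⊖ x (suc l)) k
      same k = solve 3 (λ a b c → a :- c :- (b :- c) := a :- b) ≈-refl (x (suc i) k) (x (suc l) k) (x zero k)
    suc-injective : ∀ {i l : Fin m} → Fin.suc i ≡ suc l → i ≡ l
    suc-injective refl = refl
    gram : ∀ i l → ⟨ v i , v l ⟩ ≈ ½ * (1# + identity i l)
    gram i l with i ≟ l
    ... | yes refl = trans (norm-v i) (sym (trans (*-comm ½ _) (⁻¹-inverse 2≉0)))
    ... | no  i≢l  = trans (sym (halve ⟨ v i , v l ⟩)) (trans
      (solve 2 (λ h p → h :* p :+ h :* p := h :* (:1 :+ :1 :- (:1 :- :2 :* p :+ :1))) ≈-refl ½ ⟨ v i , v l ⟩)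
      (trans (*-congˡ (+-congˡ (-‿cong (trans (+-cong (+-congʳ (sym (norm-v i))) (sym (norm-v l)))
        (trans (sym (⊖-norm² (v i) (v l))) (trans (v⊖v i l) (unit (suc i) (suc l) (i≢l ∘ suc-injective))))))))
      (solve 1 (λ h → h :* (:1 :+ :1 :- :1) := h :* (:1 :+ :0)) ≈-refl ½)))

  -- Dimensions of Hamming graphs and hypercubes

  words-adjacent₀ : ∀ {A : Set} {d} {a b : A} (u : Vec A d) → a ≢ b → ∃! _≡_ λ i → lookup (a ∷ u) i ≢ lookup (b ∷ u) i
  words-adjacent₀ u a≢b = zero , a≢b , λ { {zero} _ → refl ; {suc i} u≢u → ⊥-elim (u≢u refl) }

  norm²-of-adjacent : ∀ {d q j} {p : Word d q → Point j} → IsFaithful (hamming d q) p →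
    ∀ a b → (∃! _≡_ λ i → lookup a i ≢ lookup b i) → ⟨ p a ⊖ p b , p a ⊖ p b ⟩ ≈ 1#
  norm²-of-adjacent faithful a b a~b = trans (sym (proj₂ (Equivalence.from (IsFaithful.unitDistance faithful a b) a~b))) (*-identityˡ 1#)

  -- Words that differ in the first letter only form a clique, whose images are equilateral.
  hamming-bound : ∀ d m j → Realizable (hamming (suc d) (suc m)) j → m ℕ.≤ j
  hamming-bound d m j (p , faithful) = equilateral-bound (λ i → p (i ∷ replicate d zero))
    λ i l i≢l → norm²-of-adjacent faithful _ _ (words-adjacent₀ (replicate d zero) i≢l)

  regularSimplex : ∀ n → Σ[ T ∈ Vector (Point (suc n)) (suc (suc n)) ] (∀ i j → i ≢ j → ⟨ T i ⊖ T j , T i ⊖ T j ⟩ ≈ 1#)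
  regularSimplex n = build (sqrt ½ (inj₁ 0<½)) (sqrt (ι (suc n) + 1#) (+-nonneg (ι-nonneg (suc n)) 0≤1))
    where
    build : (∃[ a ] 0# ≤ a × a * a ≈ ½) → (∃[ s ] 0# ≤ s × s * s ≈ ι (suc n) + 1#) →
            Σ[ T ∈ Vector (Point (suc n)) (suc (suc n)) ] (∀ i j → i ≢ j → ⟨ T i ⊖ T j , T i ⊖ T j ⟩ ≈ 1#)
    build (a , _ , a²≈½) (s , _ , s²≈) = T , unit
      where
      ν : Carrier
      ν = ι (suc n) ⁻¹
      ν*n : ι (suc n) * ν ≈ 1#
      ν*n = ⁻¹-inverse (>⇒≉ (ι-pos n))
      -- Here a = 1/√2, so the vertices a eᵢ are at mutual distance 1. In dimension N = n + 1, the
      -- point (c, ..., c) is at distance 1 from them when N c² - 2ac = ½; this is the positive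
      -- root.
      c : Carrier
      c = a * (1# + s) * ν
      T : Vector (Point (suc n)) (suc (suc n))
      T zero    k = c
      T (suc i) k = a * identity i k
      norm-T₀ : ⟨ T zero , T zero ⟩ ≈ ι (suc n) * (c * c)
      norm-T₀ = sum-constant (suc n) (c * c)
      ⟨T,Tᵢ⟩ : ∀ i z → ⟨ T (suc i) , z ⟩ ≈ a * z i
      ⟨T,Tᵢ⟩ i z = trans (⟨⟩-scaleˡ a (identity i) z) (*-congˡ (⟨identity,⟩ i z))
      unit₀ : ∀ i → ⟨ T zero ⊖ T (suc i) , T zero ⊖ T (suc i) ⟩ ≈ 1#
      unit₀ i = trans (⊖-norm² (T zero) (T (suc i))) (trans
        (+-cong (+-cong norm-T₀ (-‿cong (*-congˡ (trans (⟨⟩-comm (T zero) (T (suc i))) (⟨T,Tᵢ⟩ i (T zero))))))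
          (trans (⟨T,Tᵢ⟩ i (T (suc i))) (*-congˡ (*-congˡ (identity-diagonal i)))))
        (trans (solve 4 (λ m a s u → m :* (a :* (:1 :+ s) :* u :* (a :* (:1 :+ s) :* u)) :- :2 :* (a :* (a :* (:1 :+ s) :* u)) :+ a :* (a :* :1) :=
            (a :* a) :* ((:1 :+ s) :* u :* ((m :* u) :* (:1 :+ s) :- :2) :+ :1)) ≈-refl (ι (suc n)) a s ν)
        (trans (*-cong a²≈½ (+-congʳ (trans (*-congˡ (+-congʳ (*-congʳ ν*n)))
            (trans (solve 2 (λ s u → (:1 :+ s) :* u :* (:1 :* (:1 :+ s) :- :2) := (s :* s :- :1) :* u) ≈-refl s ν)
              (trans (*-congʳ (trans (+-congʳ s²≈) (solve 1 (λ m → m :+ :1 :- :1 := m) ≈-refl (ι (suc n))))) ν*n)))))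
          (trans (*-comm ½ 2#) (⁻¹-inverse 2≉0)))))
      unitᵢ : ∀ i j → i ≢ j → ⟨ T (suc i) ⊖ T (suc j) , T (suc i) ⊖ T (suc j) ⟩ ≈ 1#
      unitᵢ i j i≢j = trans (⊖-norm² (T (suc i)) (T (suc j))) (trans
        (+-cong (+-cong (trans (⟨T,Tᵢ⟩ i (T (suc i))) (*-congˡ (*-congˡ (identity-diagonal i))))
            (-‿cong (*-congˡ (trans (⟨T,Tᵢ⟩ i (T (suc j))) (*-congˡ (*-congˡ (identity-off (i≢j ∘ ≡.sym))))))))
          (trans (⟨T,Tᵢ⟩ j (T (suc j))) (*-congˡ (*-congˡ (identity-diagonal j)))))
        (trans (solve 1 (λ a → a :* (a :* :1) :- :2 :* (a :* (a :* :0)) :+ a :* (a :* :1) := a :* a :+ a :* a) ≈-refl a)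
        (trans (+-cong a²≈½ a²≈½) ½+½)))
      unit : ∀ i j → i ≢ j → ⟨ T i ⊖ T j , T i ⊖ T j ⟩ ≈ 1#
      unit zero    zero    0≢0 = ⊥-elim (0≢0 refl)
      unit zero    (suc j) _   = unit₀ j
      unit (suc i) zero    _   = trans (⟨⟩-neg (T (suc i)) (T zero)) (unit₀ i)
        where
        ⟨⟩-neg : ∀ {n} (x y : Point n) → ⟨ x ⊖ y , x ⊖ y ⟩ ≈ ⟨ y ⊖ x , y ⊖ x ⟩
        ⟨⟩-neg {n} x y = sum-cong {n} λ k → solve 2 (λ x y → (x :- y) :* (x :- y) := (y :- x) :* (y :- x)) ≈-refl (x k) (y k)
      unit (suc i) (suc j) i≢j = unitᵢ i j (i≢j ∘ cong suc)

  hamming-edim : ∀ d m → edim hamming (suc d) (suc (suc (suc m))) ≡ suc (suc m)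
  hamming-edim d m = faithful-exists (proj₁ simplex) (proj₂ simplex) , λ j → hamming-bound d (suc (suc m)) j
    where
    simplex = regularSimplex (suc m)

  -- On a line there is no rotation to choose. Placed in the plane, the segment has unit edges in
  -- dimension 2, and the generic Minkowski sum of its rotated copies realizes the hypercube.
  segment : Σ[ T ∈ Vector (Point 2) 2 ] (∀ i j → i ≢ j → ⟨ T i ⊖ T j , T i ⊖ T j ⟩ ≈ 1#)
  segment = T , unit
    where
    T : Vector (Point 2) 2
    T zero    _ = 0#
    T (suc _)   = identity zero
    unit : ∀ i j → i ≢ j → ⟨ T i ⊖ T j , T i ⊖ T j ⟩ ≈ 1#
    unit zero       zero       0≢0 = ⊥-elim (0≢0 refl)
    unit (suc zero) (suc zero) 1≢1 = ⊥-elim (1≢1 refl)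
    unit zero       (suc zero) _   = solve 0 ((:0 :- :1) :* (:0 :- :1) :+ ((:0 :- :0) :* (:0 :- :0) :+ :0) := :1) ≈-refl
    unit (suc zero) zero       _   = solve 0 ((:1 :- :0) :* (:1 :- :0) :+ ((:0 :- :0) :* (:0 :- :0) :+ :0) := :1) ≈-refl

  -- On a line, both common neighbours of two points are the two points at distance 1.
  line-fourCycle : ∀ {x y z w} → (x - y) * (x - y) ≈ 1# → (x - z) * (x - z) ≈ 1# → (w - y) * (w - y) ≈ 1# → (w - z) * (w - z) ≈ 1# →
                   ¬ (y ≈ z) → x ≈ w
  line-fourCycle {x} {y} {z} {w} xy xz wy wz y≉z = *-cancel 2≉0 (trans (midpoint xy xz) (sym (midpoint wy wz)))
    where
    midpoint : ∀ {x} → (x - y) * (x - y) ≈ 1# → (x - z) * (x - z) ≈ 1# → 2# * x ≈ y + z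
    midpoint {x} xy xz = trans (solve 3 (λ x y z → :2 :* x := :2 :* x :- y :- z :+ (y :+ z)) ≈-refl x y z)
      (trans (+-congʳ (integral {z - y} (trans (solve 3 (λ x y z → (z :- y) :* (:2 :* x :- y :- z) := (x :- y) :* (x :- y) :- (x :- z) :* (x :- z)) ≈-refl x y z)
        (trans (+-cong xy (-‿cong xz)) (-‿inverseʳ 1#)))
        λ z-y≈0 → y≉z (sym (trans (solve 2 (λ y z → z := z :- y :+ y) ≈-refl y z) (trans (+-congʳ z-y≈0) (+-identityˡ y))))))
      (+-identityˡ _))

  -- In dimension 0 all points coincide. On a line, the 4-cycle of words that begin with 00, 01, 11,
  -- 10 would bring its opposite corners 00 and 11 together.
  hypercube-bound : ∀ d j → Realizable (hamming (suc (suc d)) 2) j → 2 ℕ.≤ j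
  hypercube-bound d zero (p , faithful) = ⊥-elim (00≢11 (IsFaithful.injective faithful {word zero zero} {word (suc zero) (suc zero)} λ ()))
    where
    word : Fin 2 → Fin 2 → Vec (Fin 2) (suc (suc d))
    word s t = s ∷ t ∷ replicate d zero
    00≢11 : word zero zero ≢ word (suc zero) (suc zero)
    00≢11 ()
  hypercube-bound d (suc zero) (p , faithful) = ⊥-elim (00≢11 (injective λ { zero → line-fourCycle
      (adjacent₁ zero λ ()) (adjacent₀ zero λ ()) (adjacent₀ (suc zero) λ ()) (adjacent₁ (suc zero) λ ())
      λ y≈z → 01≢10 (injective λ { zero → y≈z }) }))
    where
    open IsFaithful faithful using (injective)
    word : Fin 2 → Fin 2 → Vec (Fin 2) (suc (suc d))
    word s t = s ∷ t ∷ replicate d zero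
    00≢11 : word zero zero ≢ word (suc zero) (suc zero)
    00≢11 ()
    01≢10 : word zero (suc zero) ≢ word (suc zero) zero
    01≢10 ()
    x : Fin 2 → Fin 2 → Carrier
    x s t = p (word s t) zero
    square : ∀ {a b} → (∃! _≡_ λ i → lookup a i ≢ lookup b i) → (p a zero - p b zero) * (p a zero - p b zero) ≈ 1#
    square {a} {b} a~b = trans (sym (+-identityʳ _)) (norm²-of-adjacent faithful a b a~b)
    adjacent₀ : ∀ t {s s′} → s ≢ s′ → (x s t - x s′ t) * (x s t - x s′ t) ≈ 1#
    adjacent₀ t s≢s′ = square (words-adjacent₀ (t ∷ replicate d zero) s≢s′)
    adjacent₁ : ∀ s {t t′} → t ≢ t′ → (x s t - x s t′) * (x s t - x s t′) ≈ 1#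
    adjacent₁ s t≢t′ = square (suc zero , t≢t′ , λ { {zero} s≢s → ⊥-elim (s≢s refl) ; {suc zero} _ → refl ; {suc (suc i)} u≢u → ⊥-elim (u≢u refl) })
  hypercube-bound d (suc (suc j)) _ = s≤s (s≤s z≤n)

  hypercube-edim : ∀ d → edim hamming (suc (suc d)) 2 ≡ 2
  hypercube-edim d = faithful-exists (proj₁ segment) (proj₂ segment) , hypercube-bound d

  hamming≅hypercube : ∀ d → hamming d 2 ≅ hypercube d
  hamming≅hypercube d = ↔⇒⤖ (mk↔ₛ′ (Vec.map to) (Vec.map from) (map-inverse to from strictlyInverseˡ) (map-inverse from to strictlyInverseʳ)) ,
      λ u v → mk⇔
        (λ (i , ui≢vi , unique) → i , forward u v ui≢vi , λ di≢ → unique (backward u v di≢))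
        (λ (i , di≢ , unique) → i , backward u v di≢ , λ ui≢vi → unique (forward u v ui≢vi))
    where
    open Inverse 2↔Bool using (to; from; strictlyInverseˡ; strictlyInverseʳ)
    map-inverse : ∀ {A B : Set} (f : A → B) (g : B → A) → (∀ y → f (g y) ≡ y) → ∀ {d} (ys : Vec B d) → Vec.map f (Vec.map g ys) ≡ ys
    map-inverse f g fg ys = ≡.trans (≡.sym (map-∘ f g ys)) (≡.trans (map-cong fg ys) (map-id ys))
    to-injective : ∀ {s t} → to s ≡ to t → s ≡ t
    to-injective {s} {t} eq = ≡.trans (≡.sym (strictlyInverseʳ s)) (≡.trans (cong from eq) (strictlyInverseʳ t))
    forward : ∀ (u v : Vec (Fin 2) d) {i} → lookup u i ≢ lookup v i → lookup (Vec.map to u) i ≢ lookup (Vec.map to v) i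
    forward u v {i} ui≢vi eq = ui≢vi (to-injective (≡.trans (≡.sym (lookup-map i to u)) (≡.trans eq (lookup-map i to v))))
    backward : ∀ (u v : Vec (Fin 2) d) {i} → lookup (Vec.map to u) i ≢ lookup (Vec.map to v) i → lookup u i ≢ lookup v i
    backward u v {i} di≢ eq = di≢ (≡.trans (lookup-map i to u) (≡.trans (cong to eq) (≡.sym (lookup-map i to v))))

  simplex-generic : ∀ d m (T : Vector (Point (suc (suc m))) (suc (suc (suc m)))) → IsRegularUnitSimplex T →
    Generically (λ (ρ : Vector (Matrix (suc (suc m))) (suc d)) → IsFaithful (hamming (suc d) (suc (suc (suc m)))) (minkowski ρ T))
  simplex-generic d m T regular = generically-faithful T λ i j i≢j → trans (sym (proj₂ (regular i j i≢j))) (*-identityˡ 1#)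

  planar : ∀ d m → Realizable (hamming (suc d) (suc (suc (suc m)))) 2 ⇔ suc (suc (suc m)) ≡ 3
  planar d m = mk⇔ (λ realizable → cong (λ k → suc (suc (suc k))) (ℕₚ.n≤0⇒n≡0 (ℕₚ.≤-pred (ℕₚ.≤-pred (hamming-bound d (suc (suc m)) 2 realizable)))))
    λ { refl → proj₁ (hamming-edim d 0) }

open import Data.Nat.Base using (_≤_)

theorem2 : (ℝ : CompleteOrderedField) → let open Euclidean ℝ in
    (∀ d q → 1 ≤ d → 3 ≤ q →
    (edim hamming d q ≡ (q ∸ 1))
    × (∀ (T : Vector (Point (q ∸ 1)) q) → IsRegularUnitSimplex T →
    Generically (λ (ρ : Vector (Matrix (q ∸ 1)) d) → IsFaithful (hamming d q) (minkowski ρ T)))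
    × (Realizable (hamming d q) 2 ⇔ (q ≡ 3)))
    × (∀ d → hamming d 2 ≅ hypercube d)
    × (∀ d → 2 ≤ d → edim hamming d 2 ≡ 2)
theorem2 ℝ =
  (λ { (suc d) (suc (suc (suc m))) _ (s≤s (s≤s (s≤s z≤n))) → hamming-edim d m , simplex-generic d m , planar d m }) ,
  hamming≅hypercube ,
  (λ { (suc (suc d)) (s≤s (s≤s z≤n)) → hypercube-edim d })
  where open HammingDimension ℝ
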